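{- Let $n_1,n_2$ be positive integers and $n=\max\{n_1,n_2\}$. Let $\tau\in S_{n_1}$ be a $k$-Grassmannian permutation whose associated Young diagram has exactly two rows, $\lambda=(m_1,m_2)$ with $m_1\ge m_2>0$. Let $w\in S_{n_2}$ and write \[\mathfrak{S}_{w}\, s_{\lambda}(x_1,\dots,x_k)=\sum_{v} c_{w\tau}^{v}\,\mathfrak{S}_{v}.\] If $n_2-k<m_2$, then $c_{w\tau}^{v}\le 2^{n_2-k}(n_2-k)!$ for all $v$. If moreover $w(k+1)>w(k+2)>\cdots>w(n_2)$, then $c_{w\tau}^{v}\le 2^{n_2-k}$ for all $v$.
   Context: For $w\in S_N$, $\mathfrak{S}_w$ denotes the Schubert polynomial: $\mathfrak{S}_{w_0}=x_1^{N-1}x_2^{N-2}\cdots x_{N-1}$ for the longest element $w_0\in S_N$, and $\mathfrak{S}_{ws_i}=\partial_i\mathfrak{S}_w$ whenever $w(i)>w(i+1)$, where $\partial_i f=(f-s_if)/(x_i-x_{i+1})$ and $s_i$ swaps $x_i,x_{i+1}$. Permutations in $S_N$ are regarded as permutations of larger symmetric groups fixing the larger integers; Schubert polynomials are stable under this and form a basis of the polynomial ring, so the coefficients are well defined. A permutation $\tau\in S_{N}$ is $k$-Grassmannian if $\tau(1)<\dots<\tau(k)$ and $\tau(k+1)<\dots<\tau(N)$; its associated Young diagram is $\lambda=(\tau(k)-k,\dots,\tau(1)-1)$ (zero parts removed), and $\mathfrak{S}_\tau=s_\lambda(x_1,\dots,x_k)$, the Schur polynomial of shape $\lambda$ in $k$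 variables. -}

module Defs where

open import Data.Nat using (ℕ; zero; suc; _+_; _*_; _∸_; _≡ᵇ_; _<ᵇ_; _≤_; _<_)
open import Data.Integer as ℤ using (ℤ; +_; -[1+_])
open import Data.Bool using (Bool; true; false; _∧_; if_then_else_)
open import Data.Maybe using (Maybe; just; nothing)
open import Data.List using (List; []; _∷_; _++_; map; concatMap; upTo; reverse; foldr; filter; applyUpTo)
open import Data.List.Relation.Unary.All using (All)
open import Data.List.Relation.Unary.Unique.Propositional using (Unique)
open import Data.List.Relation.Binary.Permutation.Propositional using (_↭_)
open import Data.Product using (_×_; _,_; proj₁; proj₂)
open import Relation.Binary.PropositionalEquality using (_≡_)
open import Relation.Nullary.Decidable using (¬?)
open import Data.Nat.Properties using (_≟_)

-- Polynomials in x₁, x₂, … with integer coefficients.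
-- A monomial is its exponent list: position j (0-based) = exponent of x_{j+1};
-- missing trailing positions mean exponent 0.
-- A polynomial is a finite formal sum of terms (coefficient , monomial);
-- equality of polynomials is equality of all coefficients.

Monomial : Set
Monomial = List ℕ

Poly : Set
Poly = List (ℤ × Monomial)

monEq : Monomial → Monomial → Bool
monEq []       []       = true
monEq []       (b ∷ bs) = (b ≡ᵇ 0) ∧ monEq [] bs
monEq (a ∷ as) []       = (a ≡ᵇ 0) ∧ monEq as []
monEq (a ∷ as) (b ∷ bs) = (a ≡ᵇ b) ∧ monEq as bs

coeff : Poly → Monomial → ℤ
coeff []             m = + 0
coeff ((c , a) ∷ p)  m = (if monEq a m then c else + 0) ℤ.+ coeff p m

infix 4 _≈P_
_≈P_ : Poly → Poly → Set
p ≈P q = ∀ m → coeff p m ≡ coeff q m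

_+P_ : Poly → Poly → Poly
p +P q = p ++ q

sumP : List Poly → Poly
sumP = foldr _+P_ []

scaleP : ℤ → Poly → Poly
scaleP c = map (λ t → (c ℤ.* proj₁ t , proj₂ t))

monMul : Monomial → Monomial → Monomial
monMul []       b        = b
monMul (a ∷ as) []       = a ∷ as
monMul (a ∷ as) (b ∷ bs) = (a + b) ∷ monMul as bs

_*P_ : Poly → Poly → Poly
p *P q = concatMap (λ s → map (λ t → (proj₁ s ℤ.* proj₁ t , monMul (proj₂ s) (proj₂ t))) q) p

expo : Monomial → ℕ → ℕ
expo []       _       = 0
expo (a ∷ as) zero    = a
expo (a ∷ as) (suc j) = expo as j

setExp : ℕ → ℕ → Monomial → Monomial
setExp zero    e []       = e ∷ []
setExp zero    e (a ∷ as) = e ∷ as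
setExp (suc j) e []       = 0 ∷ setExp j e []
setExp (suc j) e (a ∷ as) = a ∷ setExp j e as

-- Divided difference ∂_i (i ≥ 1), acting on x_i, x_{i+1}:
-- ∂_i f = (f - s_i f)/(x_i - x_{i+1}).  On a monomial with exponents a of x_i
-- and b of x_{i+1} the quotient is computed exactly:
--   a > b :   Σ_{j<a-b}  x_i^{a-1-j} x_{i+1}^{b+j}
--   a < b : - Σ_{j<b-a}  x_i^{b-1-j} x_{i+1}^{a+j}
--   a = b :   0
-- extended linearly.

∂mon : ℕ → ℤ × Monomial → Poly
∂mon i (c , m) with expo m (i ∸ 1) | expo m i
... | a | b =
  if b <ᵇ a
  then map (λ j → (c , setExp i (b + j) (setExp (i ∸ 1) (a ∸ suc j) m))) (upTo (a ∸ b))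
  else (if a <ᵇ b
        then map (λ j → (ℤ.- c , setExp i (a + j) (setExp (i ∸ 1) (b ∸ suc j) m))) (upTo (b ∸ a))
        else [])

∂ : ℕ → Poly → Poly
∂ i = concatMap (∂mon i)

-- Permutations of S_N in one-line notation: the list [w(1), …, w(N)].

IsPerm : ℕ → List ℕ → Set
IsPerm N w = w ↭ map suc (upTo N)

-- w(i) for i ≥ 1; permutations are extended by the identity beyond their size
app : List ℕ → ℕ → ℕ
app w i = go w (i ∸ 1)
  where
  go : List ℕ → ℕ → ℕ
  go []       _       = i
  go (a ∷ as) zero    = a
  go (a ∷ as) (suc j) = go as j

-- w ↦ w s_{j+1} : swap the entries in (0-based) positions j and j+1
swapAt : ℕ → List ℕ → List ℕ
swapAt zero    (a ∷ b ∷ r) = b ∷ a ∷ r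
swapAt zero    r           = r
swapAt (suc j) []          = []
swapAt (suc j) (a ∷ r)     = a ∷ swapAt j r

firstAscent : List ℕ → Maybe ℕ
firstAscent (a ∷ b ∷ r) = if a <ᵇ b then just 0 else shift (firstAscent (b ∷ r))
  where
  shift : Maybe ℕ → Maybe ℕ
  shift (just j) = just (suc j)
  shift nothing  = nothing
firstAscent _ = nothing

topSchub : ℕ → Poly
topSchub N = (+ 1 , map (λ j → N ∸ suc j) (upTo N)) ∷ []

-- Schubert polynomial: if w has no ascent then w = w₀; otherwise with an
-- ascent at i (w(i) < w(i+1)), u = w s_i has u(i) > u(i+1) and
-- 𝔖_w = 𝔖_{u s_i} = ∂_i 𝔖_u.  Each step strictly increases the number of
-- inversions, so fuel N*N always suffices.
schubFuel : ℕ → ℕ → List ℕ → Poly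
schubFuel N zero    w = topSchub N
schubFuel N (suc f) w with firstAscent w
... | nothing = topSchub N
... | just j  = ∂ (suc j) (schubFuel N f (swapAt j w))

Schub : ℕ → List ℕ → Poly
Schub N w = schubFuel N (N * N) w

Grassmannian : ℕ → ℕ → List ℕ → Set
Grassmannian N k τ =
  (∀ i j → 1 ≤ i → i < j → j ≤ k → app τ i < app τ j) ×
  (∀ i j → k + 1 ≤ i → i < j → j ≤ N → app τ i < app τ j)

shape : ℕ → List ℕ → List ℕ
shape k τ = filter (λ p → ¬? (p ≟ 0)) (map (λ i → app τ (k ∸ i) ∸ (k ∸ i)) (upTo k))

IsSchubExpansion : ℕ → Poly → List (ℤ × List ℕ) → Set
IsSchubExpansion N p cs =
  All (λ t → IsPerm N (proj₂ t)) cs ×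
  Unique (map proj₂ cs) ×
  (p ≈P sumP (map (λ t → scaleP (proj₁ t) (Schub N (proj₂ t))) cs))

{-# OPTIONS --safe #-}
module Submission where

-- For a permutation V let ⟦V⟧(f) be the constant term of ∂_V f.  These functionals are dual to
-- the Schubert polynomials, and Leibniz' rule for divided differences gives Monk's rule for
-- ⟦V⟧(x_b f).  By Jacobi–Trudi s_λ = h_{m₁} h_{m₂} - h_{m₁+1} h_{m₂-1}, so the coefficient of 𝔖_v
-- in 𝔖_w s_λ is at most its coefficient in 𝔖_w h_{m₁} h_{m₂}, the products 𝔖_w h_a h_b being
-- Schubert positive.
--
-- Multiplication by h_m(x_1,…,x_k) commutes with ∂_j for j > k, so the entries of w behind position
-- k may be assumed to decrease.  On ⟦V⟧, V ∈ S_N, the relation h_m(X_b) = h_m(X_{b+1}) - x_{b+1} h_{m-1}(X_{b+1})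
-- and h_m(X_N) = 0 expand h_m(X_k) 𝔖_w: run through the positions b behind k and either skip b or
-- exchange its entry with a smaller one to the left along a Bruhat cover.  If v is fixed, the
-- partner in each exchange is forced, so the permutations u in w → u → v are determined by the set
-- of positions used in w → u.  Among the positions that are fixed by w (those beyond n₂) this set
-- is an interval determined by its size, which leaves at most 2^(n₂-k) sets.

open import Defs
open import Data.Nat using (ℕ; zero; suc; pred; _+_; _*_; _∸_; _^_; _⊔_; _!; _<_; _≤_; z≤n; s≤s; _<?_; _≤?_; _≟_; _<ᵇ_; _≡ᵇ_)
open import Data.Nat.Properties as ℕₚ using (≤-refl; ≤-trans; ≤-reflexive; <-trans; <-≤-trans; ≤-<-trans; <⇒≢; >⇒≢; n<1+n; ≮⇒≥; ≰⇒>; ≤⇒≯; <⇒≤; suc-injective; <-cmp; <-irrefl; <-asym; ≤∧≢⇒<; allUpTo?; m≤n⇒m<n∨m≡n; +-suc; +-identityʳ; m≤n+m; m≤m+n; m<n⇒m<1+n; m≤n⇒m≤1+n; +-monoʳ-<; m+[n∸m]≡n; m∸n+n≡m; ≤-pred)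
open import Data.Integer as ℤ using (ℤ; 0ℤ; 1ℤ; +_; +≤+)
open import Data.Integer.Properties as ℤₚ using ()
import Data.Integer.Tactic.RingSolver as ℤ-Solver
import Data.Nat.Tactic.RingSolver as ℕ-Solver
open import Data.Bool as Bool using (true; false; _∧_; if_then_else_)
open import Data.Maybe using (just; nothing)
open import Data.List using (List; []; _∷_; _++_; map; upTo; length; applyUpTo; filter)
open import Data.List.Properties using (map-upTo; length-map; length-upTo)
open import Data.List.Membership.Propositional using (_∈_)
open import Data.List.Membership.Propositional.Properties using (∈-map⁺; ∈-map⁻; ∈-upTo⁺; ∈-upTo⁻)
open import Data.List.Relation.Unary.Any using (here; there)
open import Data.List.Relation.Unary.All as All using (All; []; _∷_)
open import Data.List.Relation.Unary.AllPairs using ([]; _∷_)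
open import Data.List.Relation.Unary.Unique.Propositional using (Unique)
open import Data.List.Relation.Unary.Unique.Propositional.Properties using (map⁺; upTo⁺)
open import Data.List.Relation.Binary.Permutation.Propositional using (_↭_; ↭-refl; ↭-sym; ↭-trans; ↭-prep; ↭-swap; ↭⇒↭ₛ)
open import Data.List.Relation.Binary.Permutation.Propositional.Properties using (∈-resp-↭; ↭-length)
import Data.List.Relation.Binary.Permutation.Setoid.Properties as Permutationₛ
open import Data.Product using (Σ; _×_; _,_; proj₁; proj₂)
open import Data.Sum using (_⊎_; inj₁; inj₂)
open import Data.Empty using (⊥; ⊥-elim)
open import Data.Unit using (⊤; tt)
open import Function using (_∘_)
open import Relation.Nullary using (Dec; yes; no; ¬_)
open import Relation.Nullary.Decidable using (_×-dec_; ¬?; _→-dec_; map′)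
open import Relation.Binary.Definitions using (tri<; tri≈; tri>)
open import Relation.Binary.PropositionalEquality using (_≡_; _≢_; _≗_; refl; sym; trans; cong; cong₂; subst; subst₂; setoid; module ≡-Reasoning)

-- The recursion behind position k ends only because h_m in all N variables annihilates ⟦V⟧, so it
-- visits N - k positions, while the bound involves n₂ - k alone. The extra positions are controlled
-- by descents. Once the entries behind k are sorted, the large ones fixed by w come first, with
-- consecutive values, and V descends along them unless the coefficient is zero. An entry exchanged
-- there drops below its right neighbour; if the neighbour stayed, this ascent would persist and
-- kill the coefficient. So from the first used position of this block on, all are used.
--
-- The partner l of a label γ is forced for three reasons. Used positions behind k carry increasing
-- entries as far as these lie below γ, so only one of them can give a cover. If l is before k, then
-- in the second product the exchanges of labels above γ are read off from V and agree for all
-- candidates, and γ itself is not exchanged as a label; hence its place in V determines l. Two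
-- candidates on different sides of k are incompatible: the entry of V at the one behind k would
-- have to be below, and also not below, the current entry at the other.

-- Exponent vectors and the divided difference of a monomial

Exp : Set
Exp = ℕ → ℕ

inc : ℕ → Exp → Exp
inc zero    e zero    = suc (e zero)
inc zero    e (suc i) = e (suc i)
inc (suc b) e zero    = e zero
inc (suc b) e (suc i) = inc b (e ∘ suc) i

dec : ℕ → Exp → Exp
dec zero    e zero    = pred (e zero)
dec zero    e (suc i) = e (suc i)
dec (suc b) e zero    = e zero
dec (suc b) e (suc i) = dec b (e ∘ suc) i

set₂ : ℕ → ℕ → ℕ → Exp → Exp
set₂ zero    u v e zero          = u
set₂ zero    u v e (suc zero)    = v
set₂ zero    u v e (suc (suc i)) = e (suc (suc i))
set₂ (suc j) u v e zero          = e zero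
set₂ (suc j) u v e (suc i)       = set₂ j u v (e ∘ suc) i

inc-cong : ∀ b {e e′ : Exp} → e ≗ e′ → inc b e ≗ inc b e′
inc-cong zero    p zero    = cong suc (p zero)
inc-cong zero    p (suc i) = p (suc i)
inc-cong (suc b) p zero    = p zero
inc-cong (suc b) p (suc i) = inc-cong b (p ∘ suc) i

set₂-cong : ∀ j u v {e e′ : Exp} → e ≗ e′ → set₂ j u v e ≗ set₂ j u v e′
set₂-cong zero    u v p zero          = refl
set₂-cong zero    u v p (suc zero)    = refl
set₂-cong zero    u v p (suc (suc i)) = p (suc (suc i))
set₂-cong (suc j) u v p zero          = p zero
set₂-cong (suc j) u v p (suc i)       = set₂-cong j u v (p ∘ suc) i

inc-same : ∀ b e → inc b e b ≡ suc (e b)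
inc-same zero    e = refl
inc-same (suc b) e = inc-same b (e ∘ suc)

inc-other : ∀ b e {i} → i ≢ b → inc b e i ≡ e i
inc-other zero    e {zero}  i≢b = ⊥-elim (i≢b refl)
inc-other zero    e {suc i} i≢b = refl
inc-other (suc b) e {zero}  i≢b = refl
inc-other (suc b) e {suc i} i≢b = inc-other b (e ∘ suc) (i≢b ∘ cong suc)

dec-same : ∀ b e → dec b e b ≡ pred (e b)
dec-same zero    e = refl
dec-same (suc b) e = dec-same b (e ∘ suc)

dec-other : ∀ b e {i} → i ≢ b → dec b e i ≡ e i
dec-other zero    e {zero}  i≢b = ⊥-elim (i≢b refl)
dec-other zero    e {suc i} i≢b = refl
dec-other (suc b) e {zero}  i≢b = refl
dec-other (suc b) e {suc i} i≢b = dec-other b (e ∘ suc) (i≢b ∘ cong suc)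

inc-dec : ∀ b e {a} → e b ≡ suc a → e ≗ inc b (dec b e)
inc-dec zero    e p zero rewrite p = refl
inc-dec zero    e p (suc i) = refl
inc-dec (suc b) e p zero    = refl
inc-dec (suc b) e p (suc i) = inc-dec b (e ∘ suc) p i

inc-comm : ∀ a b e → inc a (inc b e) ≗ inc b (inc a e)
inc-comm zero    zero    e i       = refl
inc-comm zero    (suc b) e zero    = refl
inc-comm zero    (suc b) e (suc i) = refl
inc-comm (suc a) zero    e zero    = refl
inc-comm (suc a) zero    e (suc i) = refl
inc-comm (suc a) (suc b) e zero    = refl
inc-comm (suc a) (suc b) e (suc i) = inc-comm a b (e ∘ suc) i

set₂-self : ∀ j e → set₂ j (e j) (e (suc j)) e ≗ e
set₂-self zero    e zero          = refl
set₂-self zero    e (suc zero)    = refl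
set₂-self zero    e (suc (suc i)) = refl
set₂-self (suc j) e zero          = refl
set₂-self (suc j) e (suc i)       = set₂-self j (e ∘ suc) i

set₂-incˡ : ∀ j u v e → set₂ j u v (inc j e) ≗ set₂ j u v e
set₂-incˡ zero    u v e zero          = refl
set₂-incˡ zero    u v e (suc zero)    = refl
set₂-incˡ zero    u v e (suc (suc i)) = refl
set₂-incˡ (suc j) u v e zero          = refl
set₂-incˡ (suc j) u v e (suc i)       = set₂-incˡ j u v (e ∘ suc) i

set₂-incʳ : ∀ j u v e → set₂ j u v (inc (suc j) e) ≗ set₂ j u v e
set₂-incʳ zero    u v e zero          = refl
set₂-incʳ zero    u v e (suc zero)    = refl
set₂-incʳ zero    u v e (suc (suc i)) = refl
set₂-incʳ (suc j) u v e zero          = refl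
set₂-incʳ (suc j) u v e (suc i)       = set₂-incʳ j u v (e ∘ suc) i

inc-set₂ˡ : ∀ j u v e → inc j (set₂ j u v e) ≗ set₂ j (suc u) v e
inc-set₂ˡ zero    u v e zero          = refl
inc-set₂ˡ zero    u v e (suc zero)    = refl
inc-set₂ˡ zero    u v e (suc (suc i)) = refl
inc-set₂ˡ (suc j) u v e zero          = refl
inc-set₂ˡ (suc j) u v e (suc i)       = inc-set₂ˡ j u v (e ∘ suc) i

inc-set₂ʳ : ∀ j u v e → inc (suc j) (set₂ j u v e) ≗ set₂ j u (suc v) e
inc-set₂ʳ zero    u v e zero          = refl
inc-set₂ʳ zero    u v e (suc zero)    = refl
inc-set₂ʳ zero    u v e (suc (suc i)) = refl
inc-set₂ʳ (suc j) u v e zero          = refl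
inc-set₂ʳ (suc j) u v e (suc i)       = inc-set₂ʳ j u v (e ∘ suc) i

set₂-inc-far : ∀ j b u v e → b ≢ j → b ≢ suc j → set₂ j u v (inc b e) ≗ inc b (set₂ j u v e)
set₂-inc-far zero    zero          u v e p q i = ⊥-elim (p refl)
set₂-inc-far zero    (suc zero)    u v e p q i = ⊥-elim (q refl)
set₂-inc-far zero    (suc (suc b)) u v e p q zero          = refl
set₂-inc-far zero    (suc (suc b)) u v e p q (suc zero)    = refl
set₂-inc-far zero    (suc (suc b)) u v e p q (suc (suc i)) = refl
set₂-inc-far (suc j) zero    u v e p q zero    = refl
set₂-inc-far (suc j) zero    u v e p q (suc i) = refl
set₂-inc-far (suc j) (suc b) u v e p q zero    = refl
set₂-inc-far (suc j) (suc b) u v e p q (suc i) =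
  set₂-inc-far j b u v (e ∘ suc) (p ∘ cong suc) (q ∘ cong suc) i

-- dd G a b is the value of G, extended linearly to polynomials in x and y, at
-- (xᵃyᵇ - xᵇyᵃ)/(x - y).
dd : (ℕ → ℕ → ℤ) → ℕ → ℕ → ℤ
dd G zero    zero    = 0ℤ
dd G (suc a) zero    = dd (λ u v → G u (suc v)) a zero ℤ.+ G a zero
dd G zero    (suc b) = dd (λ u v → G (suc u) v) zero b ℤ.- G zero b
dd G (suc a) (suc b) = dd (λ u v → G (suc u) (suc v)) a b

dd-cong : ∀ {G H : ℕ → ℕ → ℤ} → (∀ u v → G u v ≡ H u v) → ∀ a b → dd G a b ≡ dd H a b
dd-cong p zero    zero    = refl
dd-cong p (suc a) zero    = cong₂ ℤ._+_ (dd-cong (λ u v → p u (suc v)) a zero) (p a zero)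
dd-cong p zero    (suc b) = cong₂ ℤ._-_ (dd-cong (λ u v → p (suc u) v) zero b) (p zero b)
dd-cong p (suc a) (suc b) = dd-cong (λ u v → p (suc u) (suc v)) a b

private
  swap₄ : ∀ a b c d → (a ℤ.+ b) ℤ.+ (c ℤ.+ d) ≡ (a ℤ.+ c) ℤ.+ (b ℤ.+ d)
  swap₄ = ℤ-Solver.solve-∀
  swap₄- : ∀ a b c d → (a ℤ.+ b) ℤ.- (c ℤ.+ d) ≡ (a ℤ.- c) ℤ.+ (b ℤ.- d)
  swap₄- = ℤ-Solver.solve-∀
  cancel₁ : ∀ d g → d ≡ d ℤ.- g ℤ.+ g
  cancel₁ = ℤ-Solver.solve-∀
  cancel₂ : ∀ d g → d ≡ d ℤ.+ g ℤ.- g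
  cancel₂ = ℤ-Solver.solve-∀

dd-+ : ∀ (G H : ℕ → ℕ → ℤ) a b → dd (λ u v → G u v ℤ.+ H u v) a b ≡ dd G a b ℤ.+ dd H a b
dd-+ G H zero    zero    = refl
dd-+ G H (suc a) zero    = trans (cong (ℤ._+ (G a zero ℤ.+ H a zero)) (dd-+ _ _ a zero)) (swap₄ (dd (λ u v → G u (suc v)) a zero) _ _ _)
dd-+ G H zero    (suc b) = trans (cong (ℤ._- (G zero b ℤ.+ H zero b)) (dd-+ _ _ zero b)) (swap₄- (dd (λ u v → G (suc u) v) zero b) _ _ _)
dd-+ G H (suc a) (suc b) = dd-+ _ _ a b

dd-neg : ∀ (G : ℕ → ℕ → ℤ) a b → dd (λ u v → ℤ.- G u v) a b ≡ ℤ.- dd G a b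
dd-neg G zero    zero    = refl
dd-neg G (suc a) zero    = trans (cong (ℤ._- G a zero) (dd-neg _ a zero)) (sym (ℤₚ.neg-distrib-+ (dd (λ u v → G u (suc v)) a zero) (G a zero)))
dd-neg G zero    (suc b) = trans (cong (λ z → z ℤ.- ℤ.- G zero b) (dd-neg _ zero b)) (sym (ℤₚ.neg-distrib-+ (dd (λ u v → G (suc u) v) zero b) (ℤ.- G zero b)))
dd-neg G (suc a) (suc b) = dd-neg _ a b

dd-0 : ∀ a b → dd (λ _ _ → 0ℤ) a b ≡ 0ℤ
dd-0 zero    zero    = refl
dd-0 (suc a) zero    = cong (ℤ._+ 0ℤ) (dd-0 a zero)
dd-0 zero    (suc b) = cong (ℤ._- 0ℤ) (dd-0 zero b)
dd-0 (suc a) (suc b) = dd-0 a b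

-- The twisted Leibniz rule ∂(x f) = y ∂f + f; its companion `dd-sucʳ` is ∂(y f) = x ∂f - f. All
-- later commutation rules rest on these two.
dd-sucˡ : ∀ (G : ℕ → ℕ → ℤ) a b → dd G (suc a) b ≡ dd (λ u v → G u (suc v)) a b ℤ.+ G a b
dd-sucˡ G a       zero    = refl
dd-sucˡ G zero    (suc b) = cancel₁ _ _
dd-sucˡ G (suc a) (suc b) = dd-sucˡ (λ u v → G (suc u) (suc v)) a b

dd-sucʳ : ∀ (G : ℕ → ℕ → ℤ) a b → dd G a (suc b) ≡ dd (λ u v → G (suc u) v) a b ℤ.- G a b
dd-sucʳ G zero    b       = refl
dd-sucʳ G (suc a) zero    = cancel₂ _ _
dd-sucʳ G (suc a) (suc b) = dd-sucʳ (λ u v → G (suc u) (suc v)) a b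

-- Linear functionals and the relations between divided differences

-- A linear functional on polynomials, given by its values on monomials.
record Fn : Set where
  constructor fn
  field
    at  : Exp → ℤ
    ext : ∀ {e e′} → e ≗ e′ → at e ≡ at e′
open Fn public

infix 4 _≈_
record _≈_ (L M : Fn) : Set where
  constructor mk
  field un : ∀ e → at L e ≡ at M e
open _≈_ public

≈-refl : ∀ {L} → L ≈ L
≈-refl = mk λ e → refl

≈-sym : ∀ {L M} → L ≈ M → M ≈ L
≈-sym p = mk λ e → sym (un p e)

≈-trans : ∀ {L M K} → L ≈ M → M ≈ K → L ≈ K
≈-trans p q = mk λ e → trans (un p e) (un q e)

infixr 5 _▸_
_▸_ : ∀ {L M K} → L ≈ M → M ≈ K → L ≈ K
_▸_ = ≈-trans

infixl 6 _⊕_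
infix  8 ⊖_

opaque
  𝟘 : Fn
  𝟘 = fn (λ _ → 0ℤ) (λ _ → refl)

  _⊕_ : Fn → Fn → Fn
  L ⊕ M = fn (λ e → at L e ℤ.+ at M e) (λ p → cong₂ ℤ._+_ (ext L p) (ext M p))

  ⊖_ : Fn → Fn
  ⊖ L = fn (λ e → ℤ.- at L e) (λ p → cong ℤ.-_ (ext L p))

  -- Operators act on functionals by precomposition: `X b L` is f ↦ L(x_b f) and `D j L` is f ↦
  -- L(∂_j f). Composites therefore read in the opposite order to the operators on polynomials.
  X : ℕ → Fn → Fn
  X b L = fn (λ e → at L (inc b e)) (λ p → ext L (inc-cong b p))

  D : ℕ → Fn → Fn
  D j L = fn (λ e → dd (λ u v → at L (set₂ j u v e)) (e j) (e (suc j)))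
    λ {e} {e′} p → trans (dd-cong (λ u v → ext L (set₂-cong j u v p)) (e j) (e (suc j)))
                         (cong₂ (dd _) (p j) (p (suc j)))

  at-𝟘 : ∀ e → at 𝟘 e ≡ 0ℤ
  at-𝟘 e = refl

  at-⊕ : ∀ L M e → at (L ⊕ M) e ≡ at L e ℤ.+ at M e
  at-⊕ L M e = refl

  at-⊖ : ∀ L e → at (⊖ L) e ≡ ℤ.- at L e
  at-⊖ L e = refl

  at-X : ∀ b L e → at (X b L) e ≡ at L (inc b e)
  at-X b L e = refl

  at-D : ∀ j L e → at (D j L) e ≡ dd (λ u v → at L (set₂ j u v e)) (e j) (e (suc j))
  at-D j L e = refl

  ⊕-cong : ∀ {L L′ M M′} → L ≈ L′ → M ≈ M′ → L ⊕ M ≈ L′ ⊕ M′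
  ⊕-cong p q = mk λ e → cong₂ ℤ._+_ (un p e) (un q e)

  ⊖-cong : ∀ {L L′} → L ≈ L′ → ⊖ L ≈ ⊖ L′
  ⊖-cong p = mk λ e → cong ℤ.-_ (un p e)

  X-cong : ∀ b {L M} → L ≈ M → X b L ≈ X b M
  X-cong b p = mk λ e → un p (inc b e)

  X-⊕ : ∀ b L M → X b (L ⊕ M) ≈ X b L ⊕ X b M
  X-⊕ b L M = ≈-refl

  X-⊖ : ∀ b L → X b (⊖ L) ≈ ⊖ X b L
  X-⊖ b L = ≈-refl

  X-⊕⊖ : ∀ b L M → X b (L ⊕ ⊖ M) ≈ X b L ⊕ ⊖ X b M
  X-⊕⊖ b L M = ≈-refl

  X-𝟘 : ∀ b → X b 𝟘 ≈ 𝟘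
  X-𝟘 b = ≈-refl

  XX : ∀ a b L → X a (X b L) ≈ X b (X a L)
  XX a b L = mk λ e → ext L (inc-comm b a e)

  D-cong : ∀ j {L M} → L ≈ M → D j L ≈ D j M
  D-cong j p = mk λ e → dd-cong (λ u v → un p (set₂ j u v e)) (e j) (e (suc j))

  D-⊕ : ∀ j L M → D j (L ⊕ M) ≈ D j L ⊕ D j M
  D-⊕ j L M = mk λ e → dd-+ _ _ (e j) (e (suc j))

  D-⊖ : ∀ j L → D j (⊖ L) ≈ ⊖ D j L
  D-⊖ j L = mk λ e → dd-neg _ (e j) (e (suc j))

  D-𝟘 : ∀ j → D j 𝟘 ≈ 𝟘
  D-𝟘 j = mk λ e → dd-0 (e j) (e (suc j))

  D-at-0 : ∀ j L e → e j ≡ 0 → e (suc j) ≡ 0 → at (D j L) e ≡ 0ℤ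
  D-at-0 j L e p q = cong₂ (dd (λ u v → at L (set₂ j u v e))) p q

  cancel⊖⊕ : ∀ A B → A ⊕ ⊖ B ⊕ B ≈ A
  cancel⊖⊕ A B = mk λ e → lem (at A e) (at B e)
    where lem : ∀ a b → a ℤ.+ ℤ.- b ℤ.+ b ≡ a
          lem = ℤ-Solver.solve-∀

  cancel⊕⊖ : ∀ A B → A ⊕ B ⊕ ⊖ B ≈ A
  cancel⊕⊖ A B = mk λ e → lem (at A e) (at B e)
    where lem : ∀ a b → a ℤ.+ b ℤ.+ ℤ.- b ≡ a
          lem = ℤ-Solver.solve-∀

  cancel-com : ∀ A B C → (A ⊕ C) ⊕ ⊖ (B ⊕ C) ≈ A ⊕ ⊖ B
  cancel-com A B C = mk λ e → lem (at A e) (at B e) (at C e)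
    where lem : ∀ x y c → x ℤ.+ c ℤ.+ ℤ.- (y ℤ.+ c) ≡ x ℤ.+ ℤ.- y
          lem = ℤ-Solver.solve-∀

  ⊖-≈ : ∀ {A B} → (∀ e → at (A ⊕ ⊖ B) e ≡ 0ℤ) → A ≈ B
  ⊖-≈ {A} {B} p = mk λ e → trans (sym (lem (at A e) (at B e))) (trans (cong (ℤ._+ at B e) (p e)) (ℤₚ.+-identityˡ (at B e)))
    where lem : ∀ a b → a ℤ.+ ℤ.- b ℤ.+ b ≡ a
          lem = ℤ-Solver.solve-∀

  ⊕⊖-0 : ∀ A B {e} → at A e ≡ 0ℤ → at B e ≡ 0ℤ → at (A ⊕ ⊖ B) e ≡ 0ℤ
  ⊕⊖-0 A B p q = cong₂ (λ a b → a ℤ.+ ℤ.- b) p q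

n≢1+n : ∀ n → n ≢ suc n
n≢1+n (suc n) p = n≢1+n n (suc-injective p)

opaque
  unfolding X

  XDˡ : ∀ j L → X j (D j L) ≈ D j (X (suc j) L) ⊕ L
  XDˡ j L = mk λ e → begin
    dd (λ u v → at L (set₂ j u v (inc j e))) (inc j e j) (inc j e (suc j))
      ≡⟨ cong₂ (dd _) (inc-same j e) (inc-other j e (n≢1+n j ∘ sym)) ⟩
    dd (λ u v → at L (set₂ j u v (inc j e))) (suc (e j)) (e (suc j))
      ≡⟨ dd-cong (λ u v → ext L (set₂-incˡ j u v e)) (suc (e j)) (e (suc j)) ⟩
    dd (λ u v → at L (set₂ j u v e)) (suc (e j)) (e (suc j))
      ≡⟨ dd-sucˡ _ (e j) (e (suc j)) ⟩
    _ ≡⟨ cong₂ ℤ._+_ (dd-cong (λ u v → ext L (λ i → sym (inc-set₂ʳ j u v e i))) (e j) (e (suc j))) (ext L (set₂-self j e)) ⟩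
    _ ∎
    where open ≡-Reasoning

  XDʳ : ∀ j L → X (suc j) (D j L) ≈ D j (X j L) ⊕ ⊖ L
  XDʳ j L = mk λ e → begin
    dd (λ u v → at L (set₂ j u v (inc (suc j) e))) (inc (suc j) e j) (inc (suc j) e (suc j))
      ≡⟨ cong₂ (dd _) (inc-other (suc j) e (n≢1+n j)) (inc-same (suc j) e) ⟩
    dd (λ u v → at L (set₂ j u v (inc (suc j) e))) (e j) (suc (e (suc j)))
      ≡⟨ dd-cong (λ u v → ext L (set₂-incʳ j u v e)) (e j) (suc (e (suc j))) ⟩
    dd (λ u v → at L (set₂ j u v e)) (e j) (suc (e (suc j)))
      ≡⟨ dd-sucʳ _ (e j) (e (suc j)) ⟩
    _ ≡⟨ cong₂ ℤ._-_ (dd-cong (λ u v → ext L (λ i → sym (inc-set₂ˡ j u v e i))) (e j) (e (suc j))) (ext L (set₂-self j e)) ⟩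
    _ ∎
    where open ≡-Reasoning

  XD-far : ∀ b j L → b ≢ j → b ≢ suc j → X b (D j L) ≈ D j (X b L)
  XD-far b j L p q = mk λ e →
    trans (cong₂ (dd _) (inc-other b e (p ∘ sym)) (inc-other b e (q ∘ sym)))
          (dd-cong (λ u v → ext L (set₂-inc-far j b u v e p q)) (e j) (e (suc j)))

-- A linear operator that vanishes on monomials free of x_b and that moves past
-- multiplication by x_b vanishes on all monomials.
opaque
  unfolding X

  peel : ∀ b (T : Fn → Fn) → (∀ L → Σ Fn λ M → X b (T L) ≈ T M) →
    (Z : Exp → Set) → (∀ {e} → Z e → Z (dec b e)) →
    (∀ L e → Z e → e b ≡ 0 → at (T L) e ≡ 0ℤ) →
    ∀ L e → Z e → at (T L) e ≡ 0ℤ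
  peel b T mv Z Zdec base = λ L e z → go (e b) L e refl z
    where
    go : ∀ n L e → e b ≡ n → Z e → at (T L) e ≡ 0ℤ
    go zero    L e p z = base L e z p
    go (suc n) L e p z = trans (ext (T L) (inc-dec b e p)) (trans (un (proj₂ (mv L)) (dec b e))
      (go n (proj₁ (mv L)) (dec b e) (trans (dec-same b e) (cong pred p)) (Zdec z)))

-- By Leibniz, x_j and x_{j+1} pass through ∂_j∂_j with corrections that cancel. `peel` then leaves
-- monomials free of both variables, which ∂_j annihilates. The other two relations follow the same
-- scheme, applied to the difference of their sides.
DD : ∀ j L → D j (D j L) ≈ 𝟘
DD j L = mk λ e → trans (
  peel j T mvˡ (λ _ → ⊤) (λ _ → tt)
    (λ L e _ p → peel (suc j) T mvʳ (λ e → e j ≡ 0) (λ {e} q → trans (dec-other (suc j) e (n≢1+n j)) q)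
      (λ L e q r → D-at-0 j (D j L) e q r) L e p) L e tt) (sym (at-𝟘 e))
  where
  T : Fn → Fn
  T L = D j (D j L)
  mvˡ : ∀ L → Σ Fn λ M → X j (T L) ≈ T M
  mvˡ L = X j L , (XDˡ j (D j L) ▸ ⊕-cong (D-cong j (XDʳ j L) ▸ D-⊕ j _ _ ▸ ⊕-cong ≈-refl (D-⊖ j L)) ≈-refl
                   ▸ cancel⊖⊕ _ _)
  mvʳ : ∀ L → Σ Fn λ M → X (suc j) (T L) ≈ T M
  mvʳ L = X (suc j) L , (XDʳ j (D j L) ▸ ⊕-cong (D-cong j (XDˡ j L) ▸ D-⊕ j _ _) ≈-refl
                   ▸ cancel⊕⊖ _ _)

DD-far : ∀ i j L → suc i < j → D i (D j L) ≈ D j (D i L)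
DD-far i j L i<j = ⊖-≈ λ e →
  (peel i T mv₁ (λ _ → ⊤) (λ _ → tt)
    (λ L e _ p₁ → peel (suc i) T mv₂ (λ e → e i ≡ 0) (λ {e} z → trans (dec-other (suc i) e (n≢1+n i)) z)
      (λ L e p₁ p₂ → peel j T mv₃ (λ e → e i ≡ 0 × e (suc i) ≡ 0)
        (λ {e} z → trans (dec-other j e i≢j) (proj₁ z) , trans (dec-other j e si≢j) (proj₂ z))
        (λ L e p p₃ → peel (suc j) T mv₄ (λ e → e i ≡ 0 × e (suc i) ≡ 0 × e j ≡ 0)
          (λ {e} z → trans (dec-other (suc j) e i≢sj) (proj₁ z) , trans (dec-other (suc j) e si≢sj) (proj₁ (proj₂ z))
                   , trans (dec-other (suc j) e (n≢1+n j)) (proj₂ (proj₂ z)))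
          (λ L e (q₁ , q₂ , q₃) q₄ → ⊕⊖-0 _ _ (D-at-0 i (D j L) e q₁ q₂) (D-at-0 j (D i L) e q₃ q₄))
          L e (proj₁ p , proj₂ p , p₃))
        L e (p₁ , p₂))
      L e p₁)
    L e tt)
  where
  i≢j : i ≢ j
  i≢j = <⇒≢ (<⇒≤ i<j)
  si≢j : suc i ≢ j
  si≢j = <⇒≢ i<j
  i≢sj : i ≢ suc j
  i≢sj = <⇒≢ (<-trans (<⇒≤ i<j) (n<1+n j))
  si≢sj : suc i ≢ suc j
  si≢sj = i≢j ∘ suc-injective
  T : Fn → Fn
  T L = D i (D j L) ⊕ ⊖ D j (D i L)
  mv₁ : ∀ L → Σ Fn λ M → X i (T L) ≈ T M
  mv₁ L = X (suc i) L ,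
    (X-⊕⊖ _ _ _ ▸ ⊕-cong (XDˡ i (D j L) ▸ ⊕-cong (D-cong i (XD-far (suc i) j L si≢j si≢sj)) ≈-refl)
            (⊖-cong (XD-far i j (D i L) i≢j i≢sj ▸ D-cong j (XDˡ i L) ▸ D-⊕ j _ _))
     ▸ cancel-com _ _ _)
  mv₂ : ∀ L → Σ Fn λ M → X (suc i) (T L) ≈ T M
  mv₂ L = X i L ,
    (X-⊕⊖ _ _ _ ▸ ⊕-cong (XDʳ i (D j L) ▸ ⊕-cong (D-cong i (XD-far i j L i≢j i≢sj)) ≈-refl)
            (⊖-cong (XD-far (suc i) j (D i L) si≢j si≢sj ▸ D-cong j (XDʳ i L) ▸ D-⊕ j _ _ ▸ ⊕-cong ≈-refl (D-⊖ j L)))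
     ▸ cancel-com _ _ _)
  mv₃ : ∀ L → Σ Fn λ M → X j (T L) ≈ T M
  mv₃ L = X (suc j) L ,
    (X-⊕⊖ _ _ _ ▸ ⊕-cong (XD-far j i (D j L) (i≢j ∘ sym) (si≢j ∘ sym) ▸ D-cong i (XDˡ j L) ▸ D-⊕ i _ _)
            (⊖-cong (XDˡ j (D i L) ▸ ⊕-cong (D-cong j (XD-far (suc j) i L (i≢sj ∘ sym) (si≢sj ∘ sym))) ≈-refl))
     ▸ cancel-com _ _ _)
  mv₄ : ∀ L → Σ Fn λ M → X (suc j) (T L) ≈ T M
  mv₄ L = X j L ,
    (X-⊕⊖ _ _ _ ▸ ⊕-cong (XD-far (suc j) i (D j L) (i≢sj ∘ sym) (si≢sj ∘ sym) ▸ D-cong i (XDʳ j L) ▸ D-⊕ i _ _ ▸ ⊕-cong ≈-refl (D-⊖ i L))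
            (⊖-cong (XDʳ j (D i L) ▸ ⊕-cong (D-cong j (XD-far j i L (i≢j ∘ sym) (si≢j ∘ sym))) ≈-refl))
     ▸ cancel-com _ _ _)

opaque
  unfolding X

  braid-cancel₁ : ∀ A B C E → E ≈ 𝟘 → (A ⊕ E ⊕ C) ⊕ ⊖ (B ⊕ C ⊕ 𝟘) ≈ A ⊕ ⊖ B
  braid-cancel₁ A B C E p = mk λ e → lem (at A e) (at B e) (at C e) (at E e) (un p e)
    where
    lem : ∀ x y c d → d ≡ 0ℤ → x ℤ.+ d ℤ.+ c ℤ.+ ℤ.- (y ℤ.+ c ℤ.+ 0ℤ) ≡ x ℤ.+ ℤ.- y
    lem x y c d refl = lem′ x y c
      where lem′ : ∀ x y c → x ℤ.+ 0ℤ ℤ.+ c ℤ.+ ℤ.- (y ℤ.+ c ℤ.+ 0ℤ) ≡ x ℤ.+ ℤ.- y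
            lem′ = ℤ-Solver.solve-∀

  braid-cancel₂ : ∀ A B C E → (A ⊕ C ⊕ ⊖ E) ⊕ ⊖ (B ⊕ ⊖ E ⊕ C) ≈ A ⊕ ⊖ B
  braid-cancel₂ A B C E = mk λ e → lem (at A e) (at B e) (at C e) (at E e)
    where
    lem : ∀ x y c d → x ℤ.+ c ℤ.+ ℤ.- d ℤ.+ ℤ.- (y ℤ.+ ℤ.- d ℤ.+ c) ≡ x ℤ.+ ℤ.- y
    lem = ℤ-Solver.solve-∀

  braid-cancel₃ : ∀ A B C E F → E ≈ 𝟘 → F ≈ 𝟘 → (A ⊕ ⊖ C ⊕ ⊖ E) ⊕ ⊖ (B ⊕ ⊖ F ⊕ ⊖ C) ≈ A ⊕ ⊖ B
  braid-cancel₃ A B C E F p q = mk λ e → lem (at A e) (at B e) (at C e) (at E e) (at F e) (un p e) (un q e)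
    where
    lem : ∀ x y c d f → d ≡ 0ℤ → f ≡ 0ℤ → x ℤ.+ ℤ.- c ℤ.+ ℤ.- d ℤ.+ ℤ.- (y ℤ.+ ℤ.- f ℤ.+ ℤ.- c) ≡ x ℤ.+ ℤ.- y
    lem x y c d f refl refl = lem′ x y c
      where lem′ : ∀ x y c → x ℤ.+ ℤ.- c ℤ.+ ℤ.- 0ℤ ℤ.+ ℤ.- (y ℤ.+ ℤ.- 0ℤ ℤ.+ ℤ.- c) ≡ x ℤ.+ ℤ.- y
            lem′ = ℤ-Solver.solve-∀

-- Multiplication by x_i, x_{i+1}, x_{i+2} passes through either side as multiplication by x_{i+2},
-- x_{i+1}, x_i. The corrections on the two sides agree, in part because ∂∂ = 0.
DDD : ∀ j L → D j (D (suc j) (D j L)) ≈ D (suc j) (D j (D (suc j) L))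
DDD i L = ⊖-≈ λ e →
  (peel i T mv₁ (λ _ → ⊤) (λ _ → tt)
    (λ L e _ p₁ → peel j T mv₂ (λ e → e i ≡ 0) (λ {e} z → trans (dec-other j e (n≢1+n i)) z)
      (λ L e p₁ p₂ → peel k T mv₃ (λ e → e i ≡ 0 × e j ≡ 0)
        (λ {e} z → trans (dec-other k e i≢k) (proj₁ z) , trans (dec-other k e (n≢1+n j)) (proj₂ z))
        (λ L e (q₁ , q₂) q₃ → ⊕⊖-0 _ _ (D-at-0 i (D j (D i L)) e q₁ q₂) (D-at-0 j (D i (D j L)) e q₂ q₃))
        L e (p₁ , p₂))
      L e p₁)
    L e tt)
  where
  j k : ℕ
  j = suc i
  k = suc j
  i≢k : i ≢ k
  i≢k p = go i p
    where go : ∀ n → n ≢ suc (suc n)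
          go (suc n) q = go n (suc-injective q)
  T : Fn → Fn
  T L = D i (D j (D i L)) ⊕ ⊖ D j (D i (D j L))
  mv₁ : ∀ L → Σ Fn λ M → X i (T L) ≈ T M
  mv₁ L = X k L ,
    (X-⊕⊖ _ _ _ ▸ ⊕-cong (XDˡ i (D j (D i L)) ▸ ⊕-cong (D-cong i (XDˡ j (D i L) ▸ ⊕-cong (D-cong j (XD-far k i L (i≢k ∘ sym) (n≢1+n j ∘ sym))) ≈-refl)
                                            ▸ D-⊕ i _ _) ≈-refl)
            (⊖-cong (XD-far i j (D i (D j L)) (n≢1+n i) i≢k
                     ▸ D-cong j (XDˡ i (D j L) ▸ ⊕-cong (D-cong i (XDˡ j L) ▸ D-⊕ i _ _) ≈-refl)
                     ▸ D-⊕ j _ _ ▸ ⊕-cong (D-⊕ j _ _) (DD j L)))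
     ▸ braid-cancel₁ _ _ _ _ (DD i L))
  mv₂ : ∀ L → Σ Fn λ M → X j (T L) ≈ T M
  mv₂ L = X j L ,
    (X-⊕⊖ _ _ _ ▸ ⊕-cong (XDʳ i (D j (D i L)) ▸ ⊕-cong (D-cong i (XD-far i j (D i L) (n≢1+n i) i≢k ▸ D-cong j (XDˡ i L) ▸ D-⊕ j _ _) ▸ D-⊕ i _ _) ≈-refl)
            (⊖-cong (XDˡ j (D i (D j L)) ▸ ⊕-cong (D-cong j (XD-far k i (D j L) (i≢k ∘ sym) (n≢1+n j ∘ sym) ▸ D-cong i (XDʳ j L) ▸ D-⊕ i _ _ ▸ ⊕-cong ≈-refl (D-⊖ i L)) ▸ D-⊕ j _ _ ▸ ⊕-cong ≈-refl (D-⊖ j _)) ≈-refl))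
     ▸ braid-cancel₂ _ _ _ _)
  mv₃ : ∀ L → Σ Fn λ M → X k (T L) ≈ T M
  mv₃ L = X i L ,
    (X-⊕⊖ _ _ _ ▸ ⊕-cong (XD-far k i (D j (D i L)) (i≢k ∘ sym) (n≢1+n j ∘ sym)
               ▸ D-cong i (XDʳ j (D i L) ▸ ⊕-cong (D-cong j (XDʳ i L) ▸ D-⊕ j _ _ ▸ ⊕-cong ≈-refl (D-⊖ j L)) ≈-refl)
               ▸ D-⊕ i _ _ ▸ ⊕-cong (D-⊕ i _ _ ▸ ⊕-cong ≈-refl (D-⊖ i _)) (D-⊖ i _))
            (⊖-cong (XDʳ j (D i (D j L)) ▸ ⊕-cong (D-cong j (XDʳ i (D j L) ▸ ⊕-cong (D-cong i (XD-far i j L (n≢1+n i) i≢k)) ≈-refl) ▸ D-⊕ j _ _ ▸ ⊕-cong ≈-refl (D-⊖ j _)) ≈-refl))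
     ▸ braid-cancel₃ _ _ _ _ _ (DD i L) (DD j L))

-- Divided differences indexed by permutations

s : ℕ → ℕ → ℕ
s zero    zero          = 1
s zero    (suc zero)    = 0
s zero    (suc (suc i)) = suc (suc i)
s (suc j) zero          = zero
s (suc j) (suc i)       = suc (s j i)

s-j : ∀ j → s j j ≡ suc j
s-j zero    = refl
s-j (suc j) = cong suc (s-j j)

s-sj : ∀ j → s j (suc j) ≡ j
s-sj zero    = refl
s-sj (suc j) = cong suc (s-sj j)

s-other : ∀ j {i} → i ≢ j → i ≢ suc j → s j i ≡ i
s-other zero    {zero}        p q = ⊥-elim (p refl)
s-other zero    {suc zero}    p q = ⊥-elim (q refl)
s-other zero    {suc (suc i)} p q = refl
s-other (suc j) {zero}        p q = refl
s-other (suc j) {suc i}       p q = cong suc (s-other j (p ∘ cong suc) (q ∘ cong suc))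

s-inv : ∀ j i → s j (s j i) ≡ i
s-inv zero    zero          = refl
s-inv zero    (suc zero)    = refl
s-inv zero    (suc (suc i)) = refl
s-inv (suc j) zero          = refl
s-inv (suc j) (suc i)       = cong suc (s-inv j i)

s-injective : ∀ j {x y} → s j x ≡ s j y → x ≡ y
s-injective j {x} {y} p = trans (sym (s-inv j x)) (trans (cong (s j) p) (s-inv j y))

s-comm : ∀ i j → suc i < j → ∀ x → s i (s j x) ≡ s j (s i x)
s-comm zero    (suc (suc j)) p zero          = refl
s-comm zero    (suc (suc j)) p (suc zero)    = refl
s-comm zero    (suc (suc j)) p (suc (suc x)) = refl
s-comm zero    (suc zero)    (s≤s ()) x
s-comm (suc i) (suc j) p       zero    = refl
s-comm (suc i) (suc j) (s≤s p) (suc x) = cong suc (s-comm i j p x)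

s-braid : ∀ i x → s i (s (suc i) (s i x)) ≡ s (suc i) (s i (s (suc i) x))
s-braid zero    zero                = refl
s-braid zero    (suc zero)          = refl
s-braid zero    (suc (suc zero))    = refl
s-braid zero    (suc (suc (suc x))) = refl
s-braid (suc i) zero    = refl
s-braid (suc i) (suc x) = cong suc (s-braid i x)

s-< : ∀ {n} j {i} → suc j < n → i < n → s j i < n
s-< j {i} sj<n i<n with i ≟ j | i ≟ suc j
... | yes refl | _        = subst (_< _) (sym (s-j i)) sj<n
... | no _     | yes refl = subst (_< _) (sym (s-sj j)) (<⇒≤ i<n)
... | no p     | no q     = subst (_< _) (sym (s-other j p q)) i<n

s-≥ : ∀ {k j x} → k ≤ j → k ≤ x → k ≤ s j x
s-≥ {k} {j} {x} k≤j p with x ≟ j | x ≟ suc j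
... | yes refl | _        = subst (k ≤_) (sym (s-j j)) (m≤n⇒m≤1+n k≤j)
... | no _     | yes refl = subst (k ≤_) (sym (s-sj j)) k≤j
... | no a     | no b     = subst (k ≤_) (sym (s-other j a b)) p

ε′ : ℕ → Exp → ℤ
ε′ zero    e = 1ℤ
ε′ (suc n) e with e zero
... | zero  = ε′ n (e ∘ suc)
... | suc _ = 0ℤ

ε′-cong : ∀ n {e e′} → e ≗ e′ → ε′ n e ≡ ε′ n e′
ε′-cong zero    p = refl
ε′-cong (suc n) {e} {e′} p with e zero | e′ zero | p zero
... | zero  | .zero    | refl = ε′-cong n (p ∘ suc)
... | suc a | .(suc a) | refl = refl

ε′-inc : ∀ n b e → b < n → ε′ n (inc b e) ≡ 0ℤ
ε′-inc (suc n) zero    e p = refl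
ε′-inc (suc n) (suc b) e (s≤s p) with e zero
... | zero  = ε′-inc n b (e ∘ suc) p
... | suc _ = refl

ε′-0 : ∀ n e → (∀ i → e i ≡ 0) → ε′ n e ≡ 1ℤ
ε′-0 zero    e p = refl
ε′-0 (suc n) e p with e zero | p zero
... | zero | refl = ε′-0 n (e ∘ suc) (p ∘ suc)

ε′-≥ : ∀ n b e → n ≤ b → ε′ n (inc b e) ≡ ε′ n e
ε′-≥ zero    b       e p = refl
ε′-≥ (suc n) (suc b) e (s≤s p) with e zero
... | zero  = ε′-≥ n b (e ∘ suc) p
... | suc _ = refl

-- A termination measure: weights decrease from left to right, so sorting a descent lowers the sum.
μ : ℕ → (ℕ → ℕ) → ℕ
μ zero    V = 0
μ (suc n) V = suc n * V zero + μ n (V ∘ suc)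

private
  μ-lem : ∀ n a b r → (suc (suc n) * a + (suc n * b + r)) + b ≡ (suc (suc n) * b + (suc n * a + r)) + a
  μ-lem = ℕ-Solver.solve-∀

μ-desc : ∀ n j V → suc j < n → V (suc j) < V j → μ n (V ∘ s j) < μ n V
μ-desc (suc zero)    zero    V (s≤s ()) q
μ-desc (suc (suc n)) zero    V p q =
  ℕₚ.+-cancelʳ-< (V 0) _ _ (subst (_< μ (suc (suc n)) V + V 0) (sym (μ-lem n (V 1) (V 0) (μ n (V ∘ suc ∘ suc)))) (+-monoʳ-< (μ (suc (suc n)) V) q))
μ-desc (suc n)       (suc j) V (s≤s p) q = +-monoʳ-< (suc n * V 0) (μ-desc n j (V ∘ suc) p q)

search : ∀ n (V : ℕ → ℕ) → (Σ ℕ λ j → suc j < n × V (suc j) < V j) ⊎ (∀ i → suc i < n → V i ≤ V (suc i))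
search zero V = inj₂ (λ i ())
search (suc zero) V = inj₂ (λ { i (s≤s ()) })
search (suc (suc n)) V with V 1 <? V 0 | search (suc n) (V ∘ suc)
... | yes p | _                  = inj₁ (0 , s≤s (s≤s z≤n) , p)
... | no _  | inj₁ (j , p , q)   = inj₁ (suc j , s≤s p , q)
... | no p  | inj₂ f             = inj₂ λ { zero _ → ≮⇒≥ p ; (suc i) (s≤s q) → f i q }

module Sem (N : ℕ) where

  infix 4 _≐_
  _≐_ : (ℕ → ℕ) → (ℕ → ℕ) → Set
  V ≐ W = ∀ i → i < N → V i ≡ W i

  ≐-refl : ∀ {V} → V ≐ V
  ≐-refl i _ = refl

  ≐-sym : ∀ {V W} → V ≐ W → W ≐ V
  ≐-sym p i q = sym (p i q)

  ≐-trans : ∀ {V W U} → V ≐ W → W ≐ U → V ≐ U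
  ≐-trans p q i r = trans (p i r) (q i r)

  ≐-s : ∀ {V W} j → suc j < N → V ≐ W → V ∘ s j ≐ W ∘ s j
  ≐-s j p q i r = q (s j i) (s-< j p r)

  opaque
    ε : Fn
    ε = fn (ε′ N) (ε′-cong N)

    ε-inc : ∀ b → b < N → X b ε ≈ 𝟘
    ε-inc b p = mk λ e → trans (at-X b ε e) (trans (ε′-inc N b e p) (sym (at-𝟘 e)))

    ε-≥ : ∀ b → N ≤ b → X b ε ≈ ε
    ε-≥ b p = mk λ e → trans (at-X b ε e) (ε′-≥ N b e p)

    ε-0 : ∀ e → (∀ i → e i ≡ 0) → at ε e ≡ 1ℤ
    ε-0 = ε′-0 N

  -- ⟦ V ⟧ is the functional f ↦ constant term of ∂_V f, where only x₀, …, x_{N-1} are set to 0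
  -- (the remaining variables are set to 1).  It extracts the coefficient of 𝔖_V.
  data Red (V : ℕ → ℕ) : Set where
    incr : (∀ i → suc i < N → V i ≤ V (suc i)) → Red V
    desc : ∀ j → suc j < N → V (suc j) < V j → Red (V ∘ s j) → Red V

  sem : ∀ {V} → Red V → Fn
  sem (incr _)       = ε
  sem (desc j _ _ r) = D j (sem r)

  red′ : ∀ n V → μ N V < n → Red V
  red′ (suc n) V (s≤s p) with search N V
  ... | inj₁ (j , q , r) = desc j q r (red′ n (V ∘ s j) (<-≤-trans (μ-desc N j V q r) p))
  ... | inj₂ f           = incr f

  red : ∀ V → Red V
  red V = red′ (suc (μ N V)) V ≤-refl

  private
    desc-≐ : ∀ {V W} j → suc j < N → V ≐ W → V (suc j) < V j → W (suc j) < W j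
    desc-≐ j p q = subst₂ _<_ (q (suc j) p) (q j (<⇒≤ p))

  -- Independence of the reduced word, as a diamond argument with induction on `μ`. Two first
  -- descents that differ can be joined after further steps: by commutation if they are far apart,
  -- by the braid relation if they are adjacent.
  uniq : ∀ n {V W} → μ N V < n → V ≐ W → (r : Red V) (r′ : Red W) → sem r ≈ sem r′
  uniq-far : ∀ n {V W} i j → μ N V < suc n → V ≐ W → suc i < j →
    (p : suc i < N) (q : V (suc i) < V i) (r : Red (V ∘ s i)) →
    (p′ : suc j < N) (q′ : W (suc j) < W j) (r′ : Red (W ∘ s j)) → D i (sem r) ≈ D j (sem r′)
  uniq-adj : ∀ n {V W} i → μ N V < suc n → V ≐ W →
    (p : suc i < N) (q : V (suc i) < V i) (r : Red (V ∘ s i)) →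
    (p′ : suc (suc i) < N) (q′ : W (suc (suc i)) < W (suc i)) (r′ : Red (W ∘ s (suc i))) →
    D i (sem r) ≈ D (suc i) (sem r′)

  μ-≐ : ∀ n {V W} → (∀ i → i < n → V i ≡ W i) → μ n V ≡ μ n W
  μ-≐ zero    p = refl
  μ-≐ (suc n) p = cong₂ _+_ (cong (suc n *_) (p 0 (s≤s z≤n))) (μ-≐ n (λ i q → p (suc i) (s≤s q)))

  uniq (suc n) lt eq (incr f) (incr g) = ≈-refl
  uniq (suc n) lt eq (incr f) (desc j p q r) = ⊥-elim (≤⇒≯ (f j p) (desc-≐ j p (≐-sym eq) q))
  uniq (suc n) lt eq (desc j p q r) (incr f) = ⊥-elim (≤⇒≯ (f j p) (desc-≐ j p eq q))
  uniq (suc n) {V} {W} (s≤s lt) eq (desc i p q r) (desc j p′ q′ r′) with <-cmp i j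
  ... | tri≈ _ refl _ = D-cong i (uniq n (<-≤-trans (μ-desc N i V p q) lt) (≐-s i p eq) r r′)
  ... | tri< i<j _ _ with suc i ≟ j
  ...   | yes refl = uniq-adj n i (s≤s lt) eq p q r p′ q′ r′
  ...   | no si≢j  = uniq-far n i j (s≤s lt) eq (≤∧≢⇒< i<j si≢j) p q r p′ q′ r′
  uniq (suc n) {V} {W} (s≤s lt) eq (desc i p q r) (desc j p′ q′ r′) | tri> _ _ j<i with suc j ≟ i
  ...   | yes refl = ≈-sym (uniq-adj n j (s≤s (subst (_≤ n) (μ-≐ N eq) lt)) (≐-sym eq) p′ q′ r′ p q r)
  ...   | no sj≢i  = ≈-sym (uniq-far n j i (s≤s (subst (_≤ n) (μ-≐ N eq) lt)) (≐-sym eq) (≤∧≢⇒< j<i sj≢i) p′ q′ r′ p q r)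

  uniq-far n {V} {W} i j (s≤s lt) eq i<j p q r p′ q′ r′ =
    D-cong i (uniq n μi ≐-refl r (desc j p′ dij (red _)))
    ▸ DD-far i j _ i<j
    ▸ D-cong j (D-cong i (uniq n μij eq′ (red (V ∘ s i ∘ s j)) (red (W ∘ s j ∘ s i)))
    ▸ ≈-sym (uniq n μj ≐-refl r′ (desc i p dji (red _))))
    where
    i≢j : i ≢ j
    i≢j = <⇒≢ (<⇒≤ i<j)
    i≢sj : i ≢ suc j
    i≢sj = <⇒≢ (<-trans (<⇒≤ i<j) (n<1+n j))
    si≢j : suc i ≢ j
    si≢j = <⇒≢ i<j
    si≢sj : suc i ≢ suc j
    si≢sj = i≢j ∘ suc-injective
    Vj : V (suc j) < V j
    Vj = desc-≐ j p′ (≐-sym eq) q′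
    Wi : W (suc i) < W i
    Wi = desc-≐ i p eq q
    dij : V (s i (suc j)) < V (s i j)
    dij = subst₂ _<_ (cong V (sym (s-other i (i≢sj ∘ sym) (si≢sj ∘ sym)))) (cong V (sym (s-other i (i≢j ∘ sym) (si≢j ∘ sym)))) Vj
    dji : W (s j (suc i)) < W (s j i)
    dji = subst₂ _<_ (cong W (sym (s-other j si≢j si≢sj))) (cong W (sym (s-other j i≢j i≢sj))) Wi
    μi : μ N (V ∘ s i) < n
    μi = <-≤-trans (μ-desc N i V p q) lt
    μj : μ N (W ∘ s j) < n
    μj = <-≤-trans (μ-desc N j W p′ q′) (subst (_≤ n) (μ-≐ N eq) lt)
    μij : μ N (V ∘ s i ∘ s j) < n
    μij = <-trans (μ-desc N j (V ∘ s i) p′ dij) μi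
    eq′ : V ∘ s i ∘ s j ≐ W ∘ s j ∘ s i
    eq′ x x<N = trans (eq (s i (s j x)) (s-< i p (s-< j p′ x<N))) (cong W (s-comm i j i<j x))

  uniq-adj n {V} {W} i (s≤s lt) eq p q r p′ q′ r′ =
    D-cong i (uniq n μi ≐-refl r (desc j p′ d₁ (desc i p d₂ (red _))))
    ▸ DDD i _
    ▸ D-cong j (D-cong i (D-cong j (uniq n μ₃ eq′ (red (V ∘ s i ∘ s j ∘ s i)) (red (W ∘ s j ∘ s i ∘ s j))))
    ▸ ≈-sym (uniq n μj ≐-refl r′ (desc i p d₃ (desc j p′ d₄ (red _)))))
    where
    j = suc i
    i≢ : i ≢ suc j
    i≢ = <⇒≢ (<⇒≤ (n<1+n j))
    Vj : V (suc j) < V j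
    Vj = desc-≐ j p′ (≐-sym eq) q′
    Wi : W j < W i
    Wi = desc-≐ i p eq q
    e₁ : s i (suc j) ≡ suc j
    e₁ = s-other i (i≢ ∘ sym) (n≢1+n j ∘ sym)
    e₂ : s j i ≡ i
    e₂ = s-other j (n≢1+n i) i≢
    d₁ : V (s i (suc j)) < V (s i j)
    d₁ = subst₂ _<_ (cong V (sym e₁)) (cong V (sym (s-sj i))) (<-trans Vj q)
    d₂ : V (s i (s j (suc i))) < V (s i (s j i))
    d₂ = subst₂ _<_ (cong V (sym (trans (cong (s i) (s-j j)) e₁))) (cong V (sym (trans (cong (s i) e₂) (s-j i)))) Vj
    d₃ : W (s j (suc i)) < W (s j i)
    d₃ = subst₂ _<_ (cong W (sym (s-j j))) (cong W (sym e₂)) (<-trans q′ Wi)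
    d₄ : W (s j (s i (suc j))) < W (s j (s i j))
    d₄ = subst₂ _<_ (cong W (sym (trans (cong (s j) e₁) (s-sj j)))) (cong W (sym (trans (cong (s j) (s-sj i)) e₂))) Wi
    μi : μ N (V ∘ s i) < n
    μi = <-≤-trans (μ-desc N i V p q) lt
    μj : μ N (W ∘ s j) < n
    μj = <-≤-trans (μ-desc N j W p′ q′) (subst (_≤ n) (μ-≐ N eq) lt)
    μ₃ : μ N (V ∘ s i ∘ s j ∘ s i) < n
    μ₃ = <-trans (μ-desc N i (V ∘ s i ∘ s j) p d₂) (<-trans (μ-desc N j (V ∘ s i) p′ d₁) μi)
    eq′ : V ∘ s i ∘ s j ∘ s i ≐ W ∘ s j ∘ s i ∘ s j
    eq′ x x<N = trans (eq _ (s-< i p (s-< j p′ (s-< i p x<N)))) (cong W (s-braid i x))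

  opaque
    ⟦_⟧ : (ℕ → ℕ) → Fn
    ⟦ V ⟧ = sem (red V)

    ⟦⟧-sem : ∀ {V} (r : Red V) → sem r ≈ ⟦ V ⟧
    ⟦⟧-sem {V} r = uniq (suc (μ N V)) ≤-refl ≐-refl r (red V)

    ⟦⟧-cong : ∀ {V W} → V ≐ W → ⟦ V ⟧ ≈ ⟦ W ⟧
    ⟦⟧-cong {V} {W} p = uniq (suc (μ N V)) ≤-refl p (red V) (red W)

    ⟦⟧-desc : ∀ {V} j → suc j < N → V (suc j) < V j → ⟦ V ⟧ ≈ D j ⟦ V ∘ s j ⟧
    ⟦⟧-desc {V} j p q = ≈-sym (⟦⟧-sem (desc j p q (red _)))

    ⟦⟧-incr : ∀ {V} → (∀ i → suc i < N → V i ≤ V (suc i)) → ⟦ V ⟧ ≈ ε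
    ⟦⟧-incr f = ≈-sym (⟦⟧-sem (incr f))

  ⟦⟧-asc : ∀ {V} j → suc j < N → V j < V (suc j) → D j ⟦ V ⟧ ≈ ⟦ V ∘ s j ⟧
  ⟦⟧-asc {V} j p q = D-cong j (⟦⟧-cong (λ i _ → cong V (sym (s-inv j i))))
    ▸ ≈-sym (⟦⟧-desc j p (subst₂ _<_ (cong V (sym (s-sj j))) (cong V (sym (s-j j))) q))

  ⟦⟧-desc-0 : ∀ {V} j → suc j < N → V (suc j) < V j → D j ⟦ V ⟧ ≈ 𝟘
  ⟦⟧-desc-0 j p q = D-cong j (⟦⟧-desc j p q) ▸ DD j _

  ⟦⟧-ind : (P : (ℕ → ℕ) → Set) →
    (∀ V → (∀ i → suc i < N → V i ≤ V (suc i)) → P V) →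
    (∀ V j → suc j < N → V (suc j) < V j → P (V ∘ s j) → P V) → ∀ V → P V
  ⟦⟧-ind P b st V = go (red V)
    where
    go : ∀ {V} → Red V → P V
    go {V} (incr f)       = b V f
    go {V} (desc j p q r) = st V j p q (go r)

-- Monk's rule

≡⇒≈ : ∀ {A B : Fn} → A ≡ B → A ≈ B
≡⇒≈ refl = ≈-refl

opaque
  tr : ℕ → ℕ → ℕ → ℕ
  tr p q i with i ≟ p | i ≟ q
  ... | yes _ | _     = q
  ... | no _  | yes _ = p
  ... | no _  | no _  = i

  tr-l : ∀ p q → tr p q p ≡ q
  tr-l p q with p ≟ p
  ... | yes _ = refl
  ... | no r  = ⊥-elim (r refl)

  tr-r : ∀ p q → tr p q q ≡ p
  tr-r p q with q ≟ p | q ≟ q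
  ... | yes r | _     = r
  ... | no _  | yes _ = refl
  ... | no _  | no r  = ⊥-elim (r refl)

  tr-o : ∀ p q {i} → i ≢ p → i ≢ q → tr p q i ≡ i
  tr-o p q {i} a b with i ≟ p | i ≟ q
  ... | yes r | _     = ⊥-elim (a r)
  ... | no _  | yes r = ⊥-elim (b r)
  ... | no _  | no _  = refl

  tr-inv : ∀ p q i → tr p q (tr p q i) ≡ i
  tr-inv p q i with i ≟ p | i ≟ q
  ... | yes refl | _        = tr-r i q
  ... | no _     | yes refl = tr-l p i
  ... | no a     | no b     = tr-o p q a b

  tr-injective : ∀ p q {x y} → tr p q x ≡ tr p q y → x ≡ y
  tr-injective p q {x} {y} e = trans (sym (tr-inv p q x)) (trans (cong (tr p q) e) (tr-inv p q y))

  tr-conj : ∀ (f : ℕ → ℕ) → (∀ {x y} → f x ≡ f y → x ≡ y) → ∀ p q i → f (tr p q i) ≡ tr (f p) (f q) (f i)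
  tr-conj f inj p q i with i ≟ p | i ≟ q
  ... | yes refl | _        = sym (tr-l (f i) (f q))
  ... | no _     | yes refl = sym (tr-r (f p) (f i))
  ... | no a     | no b     = sym (tr-o (f p) (f q) (a ∘ inj) (b ∘ inj))

  tr-adj : ∀ j i → tr j (suc j) i ≡ s j i
  tr-adj j i with i ≟ j | i ≟ suc j
  ... | yes refl | _        = sym (s-j i)
  ... | no _     | yes refl = sym (s-sj j)
  ... | no a     | no b     = sym (s-other j a b)

  tr-< : ∀ {n p q i} → p < n → q < n → i < n → tr p q i < n
  tr-< {n} {p} {q} {i} a b c with i ≟ p | i ≟ q
  ... | yes _ | _     = b
  ... | no _  | yes _ = a
  ... | no _  | no _  = c

s-mono : ∀ i {p q} → p < q → (p ≡ i → q ≢ suc i) → s i p < s i q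
s-mono zero {zero}        {suc zero}    lt h = ⊥-elim (h refl refl)
s-mono zero {zero}        {suc (suc q)} lt h = s≤s (s≤s z≤n)
s-mono zero {suc zero}    {suc (suc q)} lt h = s≤s z≤n
s-mono zero {suc (suc p)} {suc (suc q)} lt h = lt
s-mono zero {suc p}       {suc zero}    (s≤s ()) h
s-mono (suc i) {zero}  {suc q} lt h = s≤s z≤n
s-mono (suc i) {suc p} {suc q} (s≤s lt) h = s≤s (s-mono i lt λ a b → h (cong suc a) (cong suc b))

-- For p < q: V ∘ tr p q is covered by V in Bruhat order.
Cov : (ℕ → ℕ) → ℕ → ℕ → Set
Cov V p q = V q < V p × (∀ c → p < c → c < q → ¬ (V q < V c × V c < V p))

opaque
  cov? : ∀ V p q → Dec (Cov V p q)
  cov? V p q = (V q <? V p) ×-dec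
    map′ (λ f c a b → f b a) (λ f {c} b a → f c a b)
      (allUpTo? (λ c → (p <? c) →-dec ¬? ((V q <? V c) ×-dec (V c <? V p))) q)

Inj : ℕ → (ℕ → ℕ) → Set
Inj n V = ∀ {a b} → a < n → b < n → V a ≡ V b → a ≡ b

Inj-s : ∀ {n V} j → suc j < n → Inj n V → Inj n (V ∘ s j)
Inj-s j p inj a b e = s-injective j (inj (s-< j p a) (s-< j p b) e)

Inj-tr : ∀ {n V p q} → p < n → q < n → Inj n V → Inj n (V ∘ tr p q)
Inj-tr {p = p} {q} a b inj c d e = tr-injective p q (inj (tr-< a b c) (tr-< a b d) e)

module _ {N : ℕ} {V : ℕ → ℕ} (inj : Inj N V) {i : ℕ} (i<N : suc i < N) (dsc : V (suc i) < V i)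
         {p q : ℕ} (p<q : p < q) (q<N : q < N) (ne : p ≡ i → q ≢ suc i) where
  private
    V′ : ℕ → ℕ
    V′ = V ∘ s i
    p<N : p < N
    p<N = <-trans p<q q<N
    V′s : ∀ c → V′ (s i c) ≡ V c
    V′s c = cong V (s-inv i c)
    ≤⇒< : ∀ {a b} → a < N → b < N → a ≢ b → ¬ (V b < V a) → V a < V b
    ≤⇒< a b a≢b h = ≤∧≢⇒< (≮⇒≥ h) (a≢b ∘ inj a b)

  -- Conjugation by s_i moves only the entries at i and i+1, so only these can enter or leave the
  -- interval between p and q, and the descent of V at i controls them. With `cov-from`: apart from
  -- (i, i+1), the covers of V correspond to those covers of `V ∘ s i` for which `V ∘ tr p q` still
  -- descends at i.
  cov-to : Cov V p q → Cov V′ (s i p) (s i q) × V (tr p q (suc i)) < V (tr p q i)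
  cov-to (lt , nb) = (subst₂ _<_ (sym (V′s q)) (sym (V′s p)) lt , nb′) , dsc′
    where
    nb′ : ∀ c → s i p < c → c < s i q → ¬ (V′ (s i q) < V′ c × V′ c < V′ (s i p))
    nb′ c a b (x , y) =
      nb (s i c) (subst (_< s i c) (s-inv i p) (s-mono i a h₁)) (subst (s i c <_) (s-inv i q) (s-mono i b h₂))
         (subst (_< V′ c) (V′s q) x , subst (V′ c <_) (V′s p) y)
      where
      h₁ : s i p ≡ i → c ≢ suc i
      h₁ e refl =
        <-asym (subst₂ _<_ (cong V (s-sj i)) (V′s p) y) (subst (λ z → V z < V i) (trans (sym (s-j i)) (trans (cong (s i) (sym e)) (s-inv i p))) dsc)
      h₂ : c ≡ i → s i q ≢ suc i
      h₂ refl e =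
        <-asym (subst₂ _<_ (V′s q) (cong V (s-j i)) x) (subst (λ z → V (suc i) < V z) (trans (sym (s-sj i)) (trans (cong (s i) (sym e)) (s-inv i q))) dsc)
    dsc′ : V (tr p q (suc i)) < V (tr p q i)
    dsc′ with p ≟ i | p ≟ suc i | q ≟ i | q ≟ suc i
    ... | yes refl | _ | _ | _ = subst₂ (λ a b → V a < V b) (sym (tr-o p q (n≢1+n i ∘ sym) (ne refl ∘ sym))) (sym (tr-l p q))
          (≤⇒< i<N q<N (ne refl ∘ sym) λ x → nb (suc p) ≤-refl (≤∧≢⇒< p<q (ne refl ∘ sym)) (x , dsc))
    ... | no a | yes refl | _ | _ = subst₂ (λ a b → V a < V b) (sym (tr-l p q)) (sym (tr-o p q (a ∘ sym) (<⇒≢ (<⇒≤ p<q))))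
          (<-trans lt dsc)
    ... | no a | no b | yes refl | _ = subst₂ (λ a b → V a < V b) (sym (tr-o p q (b ∘ sym) (n≢1+n q ∘ sym))) (sym (tr-r p q))
          (<-trans dsc lt)
    ... | no a | no b | no c | yes refl = subst₂ (λ a b → V a < V b) (sym (tr-r p q)) (sym (tr-o p q (a ∘ sym) (c ∘ sym)))
          (≤⇒< p<N (<⇒≤ q<N) a λ x → nb i (≤∧≢⇒< (≤-pred p<q) a) ≤-refl (dsc , x))
    ... | no a | no b | no c | no d = subst₂ (λ a b → V a < V b) (sym (tr-o p q (b ∘ sym) (d ∘ sym))) (sym (tr-o p q (a ∘ sym) (c ∘ sym))) dsc

  cov-from : Cov V′ (s i p) (s i q) → V (tr p q (suc i)) < V (tr p q i) → Cov V p q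
  cov-from (lt , nb) dsc′ = subst₂ _<_ (V′s q) (V′s p) lt , nb′
    where
    nb′ : ∀ c → p < c → c < q → ¬ (V q < V c × V c < V p)
    nb′ c a b (x , y) = nb (s i c) (s-mono i a h₁) (s-mono i b h₂)
        (subst₂ _<_ (sym (V′s q)) (sym (V′s c)) x , subst₂ _<_ (sym (V′s c)) (sym (V′s p)) y)
      where
      h₁ : p ≡ i → c ≢ suc i
      h₁ refl refl = <-asym x (subst₂ (λ a b → V a < V b) (tr-o p q (n≢1+n i ∘ sym) (ne refl ∘ sym)) (tr-l p q) dsc′)
      h₂ : c ≡ i → q ≢ suc i
      h₂ refl refl = <-asym y (subst₂ (λ a b → V a < V b) (tr-r p q) (tr-o p q (<⇒≢ a ∘ sym) (n≢1+n i)) dsc′)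

ΣF : ℕ → (ℕ → Fn) → Fn
ΣF zero    f = 𝟘
ΣF (suc n) f = ΣF n f ⊕ f n

ΣF-cong : ∀ n {f g} → (∀ l → l < n → f l ≈ g l) → ΣF n f ≈ ΣF n g
ΣF-cong zero    p = ≈-refl
ΣF-cong (suc n) p = ⊕-cong (ΣF-cong n (λ l q → p l (m<n⇒m<1+n q))) (p n ≤-refl)

opaque
  unfolding X
  ⊕-identityʳ : ∀ A → A ⊕ 𝟘 ≈ A
  ⊕-identityʳ A = mk λ e → ℤₚ.+-identityʳ (at A e)

  ⊕-identityˡ : ∀ A → 𝟘 ⊕ A ≈ A
  ⊕-identityˡ A = mk λ e → ℤₚ.+-identityˡ (at A e)

  ⊕-swapʳ : ∀ A B C → A ⊕ B ⊕ C ≈ A ⊕ C ⊕ B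
  ⊕-swapʳ A B C = mk λ e → lem (at A e) (at B e) (at C e)
    where
    lem : ∀ a b c → a ℤ.+ b ℤ.+ c ≡ a ℤ.+ c ℤ.+ b
    lem = ℤ-Solver.solve-∀

  ⊕-assoc : ∀ A B C → A ⊕ B ⊕ C ≈ A ⊕ (B ⊕ C)
  ⊕-assoc A B C = mk λ e → ℤₚ.+-assoc (at A e) (at B e) (at C e)

  ⊖-𝟘 : ⊖ 𝟘 ≈ 𝟘
  ⊖-𝟘 = ≈-refl

ΣF-𝟘 : ∀ n {f} → (∀ l → l < n → f l ≈ 𝟘) → ΣF n f ≈ 𝟘
ΣF-𝟘 zero    p = ≈-refl
ΣF-𝟘 (suc n) p = ⊕-cong (ΣF-𝟘 n (λ l q → p l (m<n⇒m<1+n q))) (p n ≤-refl) ▸ ⊕-identityʳ 𝟘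

D-ΣF : ∀ j n f → D j (ΣF n f) ≈ ΣF n (λ l → D j (f l))
D-ΣF j zero    f = D-𝟘 j
D-ΣF j (suc n) f = D-⊕ j _ _ ▸ ⊕-cong (D-ΣF j n f) ≈-refl

ΣF-s : ∀ n j f → suc j < n → ΣF n f ≈ ΣF n (f ∘ s j)
ΣF-s (suc n) j f (s≤s p) with m≤n⇒m<n∨m≡n p
... | inj₁ q = ⊕-cong (ΣF-s n j f q)
                 (≡⇒≈ (cong f (sym (s-other j (>⇒≢ (<⇒≤ q)) (>⇒≢ q)))))
... | inj₂ refl = ⊕-swapʳ _ _ _ ▸ ⊕-cong (⊕-cong (ΣF-cong j λ l q → ≡⇒≈ (cong f (sym (s-other j (<⇒≢ q) (<⇒≢ (m<n⇒m<1+n q))))))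
                    (≡⇒≈ (cong f (sym (s-j j))))) (≡⇒≈ (cong f (sym (s-sj j))))

ΣF-update : ∀ n {f g} l₀ K → l₀ < n → (∀ l → l < n → l ≢ l₀ → f l ≈ g l) → f l₀ ≈ g l₀ ⊕ K →
  ΣF n f ≈ ΣF n g ⊕ K
ΣF-update (suc n) {f} {g} l₀ K (s≤s p) h h₀ with m≤n⇒m<n∨m≡n p
... | inj₁ q    = ⊕-cong (ΣF-update n l₀ K q (λ l a → h l (m<n⇒m<1+n a)) h₀) (h n ≤-refl (>⇒≢ q)) ▸ ⊕-swapʳ _ _ _
... | inj₂ refl = ⊕-cong (ΣF-cong n (λ l a → h l (m<n⇒m<1+n a) (<⇒≢ a))) h₀ ▸ ≈-sym (⊕-assoc _ _ _)

module Monk (N : ℕ) where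
  open Sem N

  ⟦⟧-mono : ∀ {V : ℕ → ℕ} → (∀ i → suc i < N → V i ≤ V (suc i)) → ∀ {i j} → i ≤ j → j < N → V i ≤ V j
  ⟦⟧-mono {V} f {i} {j} p q with m≤n⇒m<n∨m≡n p
  ... | inj₂ refl = ≤-refl
  ⟦⟧-mono {V} f {i} {suc j} p q | inj₁ (s≤s r) = ≤-trans (⟦⟧-mono f r (<⇒≤ q)) (f j q)

  cv : (ℕ → ℕ) → ℕ → ℕ → Fn
  cv V p q with cov? V p q
  ... | yes _ = ⟦ V ∘ tr p q ⟧
  ... | no _  = 𝟘

  cv-yes : ∀ {V p q} → Cov V p q → cv V p q ≈ ⟦ V ∘ tr p q ⟧
  cv-yes {V} {p} {q} c with cov? V p q
  ... | yes _ = ≈-refl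
  ... | no n  = ⊥-elim (n c)

  cv-no : ∀ {V p q} → ¬ Cov V p q → cv V p q ≈ 𝟘
  cv-no {V} {p} {q} n with cov? V p q
  ... | yes c = ⊥-elim (n c)
  ... | no _  = ≈-refl

  -- A cover of `V ∘ s i` that does not come from a cover of V leads to a permutation with a descent
  -- at i, and `D i` kills its functional.
  cv-step : ∀ {V} → Inj N V → ∀ i → suc i < N → V (suc i) < V i → ∀ {p q} → p < q → q < N → (p ≡ i → q ≢ suc i) →
    cv V p q ≈ D i (cv (V ∘ s i) (s i p) (s i q))
  cv-step {V} inj i i<N dsc {p} {q} p<q q<N ne with cov? V p q | cov? (V ∘ s i) (s i p) (s i q)
  ... | yes c | yes _  = ≈-sym (D-cong i (⟦⟧-cong eq) ▸ ⟦⟧-asc i i<N asc ▸ ⟦⟧-cong λ x _ → cong (V ∘ tr p q) (s-inv i x))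
    where
    eq : V ∘ s i ∘ tr (s i p) (s i q) ≐ V ∘ tr p q ∘ s i
    eq x _ = cong V (trans (tr-conj (s i) (s-injective i) (s i p) (s i q) x) (cong₂ (λ a b → tr a b (s i x)) (s-inv i p) (s-inv i q)))
    asc : V (tr p q (s i i)) < V (tr p q (s i (suc i)))
    asc = subst₂ (λ a b → V (tr p q a) < V (tr p q b)) (sym (s-j i)) (sym (s-sj i)) (proj₂ (cov-to inj i<N dsc p<q q<N ne c))
  ... | yes c | no n′  = ⊥-elim (n′ (proj₁ (cov-to inj i<N dsc p<q q<N ne c)))
  ... | no n  | no _   = ≈-sym (D-𝟘 i)
  ... | no n  | yes c′ = ≈-sym (D-cong i (⟦⟧-cong eq) ▸ ⟦⟧-desc-0 i i<N dsc′)
    where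
    eq : V ∘ s i ∘ tr (s i p) (s i q) ≐ V ∘ tr p q ∘ s i
    eq x _ = cong V (trans (tr-conj (s i) (s-injective i) (s i p) (s i q) x) (cong₂ (λ a b → tr a b (s i x)) (s-inv i p) (s-inv i q)))
    p<N : p < N
    p<N = <-trans p<q q<N
    dsc′ : V (tr p q (s i (suc i))) < V (tr p q (s i i))
    dsc′ = subst₂ (λ a b → V (tr p q a) < V (tr p q b)) (sym (s-sj i)) (sym (s-j i))
      (≤∧≢⇒< (≮⇒≥ (n ∘ cov-from inj i<N dsc p<q q<N ne c′))
        (λ e → n≢1+n i (Inj-tr p<N q<N inj (<⇒≤ i<N) i<N e)))

  mterm : (ℕ → ℕ) → ℕ → ℕ → Fn
  mterm V b l with <-cmp b l
  ... | tri< _ _ _ = cv V b l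
  ... | tri≈ _ _ _ = 𝟘
  ... | tri> _ _ _ = ⊖ cv V l b

  mterm-< : ∀ V {b l} → b < l → mterm V b l ≈ cv V b l
  mterm-< V {b} {l} p with <-cmp b l
  ... | tri< _ _ _ = ≈-refl
  ... | tri≈ n _ _ = ⊥-elim (n p)
  ... | tri> n _ _ = ⊥-elim (n p)

  mterm-> : ∀ V {b l} → l < b → mterm V b l ≈ ⊖ cv V l b
  mterm-> V {b} {l} p with <-cmp b l
  ... | tri< _ _ n = ⊥-elim (n p)
  ... | tri≈ _ _ n = ⊥-elim (n p)
  ... | tri> _ _ _ = ≈-refl

  mterm-≡ : ∀ V b → mterm V b b ≈ 𝟘
  mterm-≡ V b with <-cmp b b
  ... | tri< p _ _ = ⊥-elim (<-irrefl refl p)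
  ... | tri≈ _ _ _ = ≈-refl
  ... | tri> _ _ p = ⊥-elim (<-irrefl refl p)

  mterm-step : ∀ {V} → Inj N V → ∀ i → suc i < N → V (suc i) < V i → ∀ {b l} → b < N → l < N →
    (b ≡ i → l ≢ suc i) → (l ≡ i → b ≢ suc i) →
    mterm V b l ≈ D i (mterm (V ∘ s i) (s i b) (s i l))
  mterm-step {V} inj i i<N dsc {b} {l} b<N l<N h h′ with <-cmp b l
  ... | tri< p _ _ = cv-step inj i i<N dsc p l<N h ▸ D-cong i (≈-sym (mterm-< (V ∘ s i) (s-mono i p h)))
  ... | tri≈ _ refl _ = ≈-sym (D-cong i (mterm-≡ (V ∘ s i) (s i b)) ▸ D-𝟘 i)
  ... | tri> _ _ p = ⊖-cong (cv-step inj i i<N dsc p b<N h′) ▸ ≈-sym (D-⊖ i _) ▸ D-cong i (≈-sym (mterm-> (V ∘ s i) (s-mono i p h′)))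

  -- Induction along a reduced word: x_b is moved past the outermost ∂_i by Leibniz, and the terms
  -- of the shorter word are conjugated by s_i.
  monk : ∀ V → Inj N V → ∀ b → b < N → X b ⟦ V ⟧ ≈ ΣF N (mterm V b)
  monk = ⟦⟧-ind (λ V → Inj N V → ∀ b → b < N → X b ⟦ V ⟧ ≈ ΣF N (mterm V b)) base step
    where
    base : ∀ V → (∀ i → suc i < N → V i ≤ V (suc i)) → Inj N V → ∀ b → b < N → X b ⟦ V ⟧ ≈ ΣF N (mterm V b)
    base V f _ b b<N = X-cong b (⟦⟧-incr f) ▸ ε-inc b b<N ▸ ≈-sym (ΣF-𝟘 N z)
      where
      z : ∀ l → l < N → mterm V b l ≈ 𝟘
      z l l<N with <-cmp b l
      ... | tri< p _ _ = cv-no {V} λ c → ≤⇒≯ (⟦⟧-mono f (<⇒≤ p) l<N) (proj₁ c)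
      ... | tri≈ _ _ _ = ≈-refl
      ... | tri> _ _ p = ⊖-cong (cv-no {V} λ c → ≤⇒≯ (⟦⟧-mono f (<⇒≤ p) b<N) (proj₁ c)) ▸ ⊖-𝟘
    step : ∀ V i → suc i < N → V (suc i) < V i →
      (Inj N (V ∘ s i) → ∀ b → b < N → X b ⟦ V ∘ s i ⟧ ≈ ΣF N (mterm (V ∘ s i) b)) →
      Inj N V → ∀ b → b < N → X b ⟦ V ⟧ ≈ ΣF N (mterm V b)
    step V i i<N dsc ih inj b b<N = X-cong b (⟦⟧-desc i i<N dsc) ▸ main
      where
      V′ : ℕ → ℕ
      V′ = V ∘ s i
      covV : Cov V i (suc i)
      covV = dsc , λ c a b → ⊥-elim (≤⇒≯ a b)
      ncovV′ : ¬ Cov V′ i (suc i)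
      ncovV′ (lt , _) = <-asym dsc (subst₂ (λ a b → V a < V b) (s-sj i) (s-j i) lt)
      ihs : ∀ c → c < N → D i (X c ⟦ V′ ⟧) ≈ ΣF N (λ l → D i (mterm V′ c (s i l)))
      ihs c c<N = D-cong i (ih (Inj-s i i<N inj) c c<N) ▸ D-ΣF i N _ ▸ ΣF-s N i _ i<N
      cvV : cv V i (suc i) ≈ ⟦ V′ ⟧
      cvV = cv-yes covV ▸ ⟦⟧-cong (λ x _ → cong V (tr-adj i x))
      𝟘⊕ : ∀ {A B} → B ≈ 𝟘 → A ≈ B ⊕ A
      𝟘⊕ {A} p = ≈-sym (⊕-cong p ≈-refl ▸ ⊕-identityˡ A)
      main : X b (D i ⟦ V′ ⟧) ≈ ΣF N (mterm V b)
      main with b ≟ i | b ≟ suc i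
      -- The pair (i, i+1) is a cover of V but not of `V ∘ s i`. The two sums thus differ in one
      -- term only, which is the Leibniz correction; the next case is the same with the opposite
      -- sign.
      ... | yes refl | _ = XDˡ i _ ▸ ⊕-cong (ihs (suc i) i<N) ≈-refl
            ▸ ≈-sym (ΣF-update N (suc i) ⟦ V′ ⟧ i<N
                (λ l l<N l≢ → mterm-step inj i i<N dsc b<N l<N (λ _ → l≢) (λ _ → n≢1+n i)
                   ▸ D-cong i (≡⇒≈ (cong (λ z → mterm V′ z (s i l)) (s-j i))))
                (mterm-< V (n<1+n i) ▸ cvV ▸ 𝟘⊕ (D-cong i (≡⇒≈ (cong (mterm V′ (suc i)) (s-sj i)) ▸ mterm-> V′ (n<1+n i) ▸ ⊖-cong (cv-no ncovV′) ▸ ⊖-𝟘) ▸ D-𝟘 i)))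
      ... | no b≢i | yes refl = XDʳ i _ ▸ ⊕-cong (ihs i (<⇒≤ i<N)) ≈-refl
            ▸ ≈-sym (ΣF-update N i (⊖ ⟦ V′ ⟧) (<⇒≤ i<N)
                (λ l l<N l≢ → mterm-step inj i i<N dsc b<N l<N (λ e → ⊥-elim (b≢i e)) (λ e → ⊥-elim (l≢ e))
                   ▸ D-cong i (≡⇒≈ (cong (λ z → mterm V′ z (s i l)) (s-sj i))))
                (mterm-> V (n<1+n i) ▸ ⊖-cong cvV ▸ 𝟘⊕ (D-cong i (≡⇒≈ (cong (mterm V′ i) (s-j i)) ▸ mterm-< V′ (n<1+n i) ▸ cv-no ncovV′) ▸ D-𝟘 i)))
      ... | no b≢i | no b≢si = XD-far b i _ b≢i b≢si ▸ ihs b b<N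
            ▸ ≈-sym (ΣF-cong N λ l l<N → mterm-step inj i i<N dsc b<N l<N (λ e → ⊥-elim (b≢i e)) (λ _ → b≢si)
                   ▸ D-cong i (≡⇒≈ (cong (λ z → mterm V′ z (s i l)) (s-other i b≢i b≢si))))

-- Schubert polynomials as dual basis

ΣZ : ℕ → (ℕ → ℤ) → ℤ
ΣZ zero    f = 0ℤ
ΣZ (suc n) f = ΣZ n f ℤ.+ f n

ΣZ-cong : ∀ n {f g} → (∀ l → l < n → f l ≡ g l) → ΣZ n f ≡ ΣZ n g
ΣZ-cong zero    p = refl
ΣZ-cong (suc n) p = cong₂ ℤ._+_ (ΣZ-cong n (λ l q → p l (m<n⇒m<1+n q))) (p n ≤-refl)

ΣZ-0 : ∀ n {f} → (∀ l → l < n → f l ≡ 0ℤ) → ΣZ n f ≡ 0ℤ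
ΣZ-0 zero    p = refl
ΣZ-0 (suc n) p = cong₂ ℤ._+_ (ΣZ-0 n (λ l q → p l (m<n⇒m<1+n q))) (p n ≤-refl)

ΣZ-single : ∀ n {f} l₀ → l₀ < n → (∀ l → l < n → l ≢ l₀ → f l ≡ 0ℤ) → ΣZ n f ≡ f l₀
ΣZ-single (suc n) {f} l₀ (s≤s p) h with m≤n⇒m<n∨m≡n p
... | inj₁ q    = trans (cong₂ ℤ._+_ (ΣZ-single n l₀ q (λ l a → h l (m<n⇒m<1+n a))) (h n ≤-refl (>⇒≢ q))) (ℤₚ.+-identityʳ _)
... | inj₂ refl = trans (cong (ℤ._+ f n) (ΣZ-0 n (λ l a → h l (m<n⇒m<1+n a) (<⇒≢ a)))) (ℤₚ.+-identityˡ _)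

ΣZ-trunc : ∀ n {f} b → b ≤ n → (∀ l → b ≤ l → l < n → f l ≡ 0ℤ) → ΣZ n f ≡ ΣZ b f
ΣZ-trunc n b p h with m≤n⇒m<n∨m≡n p
... | inj₂ refl = refl
ΣZ-trunc (suc n) {f} b p h | inj₁ (s≤s q) =
  trans (cong₂ ℤ._+_ (ΣZ-trunc n b q (λ l a c → h l a (m<n⇒m<1+n c))) (h n q ≤-refl)) (ℤₚ.+-identityʳ _)

ΣZ-neg : ∀ n f → ΣZ n (λ l → ℤ.- f l) ≡ ℤ.- ΣZ n f
ΣZ-neg zero    f = refl
ΣZ-neg (suc n) f = trans (cong (ℤ._+ (ℤ.- f n)) (ΣZ-neg n f)) (sym (ℤₚ.neg-distrib-+ (ΣZ n f) (f n)))

-- A polynomial seen through its pairing with functionals, that is, an element of the bidual.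
-- `φ ∘D j` and `φ ∘X b` play the role of ∂_j φ and x_b φ.
record Point : Set where
  field
    ap   : Fn → ℤ
    resp : ∀ {L M} → L ≈ M → ap L ≡ ap M
    add  : ∀ L M → ap (L ⊕ M) ≡ ap L ℤ.+ ap M
    neg  : ∀ L → ap (⊖ L) ≡ ℤ.- ap L
    zer  : ap 𝟘 ≡ 0ℤ
open Point public

evalAt : Exp → Point
evalAt e = record { ap = λ L → at L e ; resp = λ p → un p e ; add = λ L M → at-⊕ L M e ; neg = λ L → at-⊖ L e ; zer = at-𝟘 e }

_∘D_ : Point → ℕ → Point
φ ∘D j = record
  { ap   = λ L → ap φ (D j L)
  ; resp = λ p → resp φ (D-cong j p)
  ; add  = λ L M → trans (resp φ (D-⊕ j L M)) (add φ _ _)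
  ; neg  = λ L → trans (resp φ (D-⊖ j L)) (neg φ _)
  ; zer  = trans (resp φ (D-𝟘 j)) (zer φ) }

_∘X_ : Point → ℕ → Point
φ ∘X b = record
  { ap   = λ L → ap φ (X b L)
  ; resp = λ p → resp φ (X-cong b p)
  ; add  = λ L M → trans (resp φ (X-⊕ b L M)) (add φ _ _)
  ; neg  = λ L → trans (resp φ (X-⊖ b L)) (neg φ _)
  ; zer  = trans (resp φ (X-𝟘 b)) (zer φ) }

0ᴾ : Point
0ᴾ = record { ap = λ _ → 0ℤ ; resp = λ _ → refl ; add = λ _ _ → refl ; neg = λ _ → refl ; zer = refl }

_+ᴾ_ : Point → Point → Point
φ +ᴾ ψ = record
  { ap   = λ L → ap φ L ℤ.+ ap ψ L
  ; resp = λ p → cong₂ ℤ._+_ (resp φ p) (resp ψ p)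
  ; add  = λ L M → trans (cong₂ ℤ._+_ (add φ L M) (add ψ L M)) (lem (ap φ L) (ap φ M) (ap ψ L) (ap ψ M))
  ; neg  = λ L → trans (cong₂ ℤ._+_ (neg φ L) (neg ψ L)) (sym (ℤₚ.neg-distrib-+ (ap φ L) (ap ψ L)))
  ; zer  = cong₂ ℤ._+_ (zer φ) (zer ψ) }
  where
  lem : ∀ a b c d → (a ℤ.+ b) ℤ.+ (c ℤ.+ d) ≡ (a ℤ.+ c) ℤ.+ (b ℤ.+ d)
  lem = ℤ-Solver.solve-∀

-ᴾ_ : Point → Point
-ᴾ φ = record
  { ap   = λ L → ℤ.- ap φ L
  ; resp = λ p → cong ℤ.-_ (resp φ p)
  ; add  = λ L M → trans (cong ℤ.-_ (add φ L M)) (ℤₚ.neg-distrib-+ (ap φ L) (ap φ M))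
  ; neg  = λ L → cong ℤ.-_ (neg φ L)
  ; zer  = cong ℤ.-_ (zer φ) }

Σᴾ : ℕ → (ℕ → Point) → Point
Σᴾ zero    f = 0ᴾ
Σᴾ (suc n) f = Σᴾ n f +ᴾ f n

ap-Σᴾ : ∀ n f L → ap (Σᴾ n f) L ≡ ΣZ n (λ l → ap (f l) L)
ap-Σᴾ zero    f L = refl
ap-Σᴾ (suc n) f L = cong (ℤ._+ ap (f n) L) (ap-Σᴾ n f L)

ap-ΣF : ∀ φ n f → ap φ (ΣF n f) ≡ ΣZ n (λ l → ap φ (f l))
ap-ΣF φ zero    f = zer φ
ap-ΣF φ (suc n) f = trans (add φ _ _) (cong (ℤ._+ ap φ (f n)) (ap-ΣF φ n f))

-- For p < q: W is covered by W ∘ tr p q in Bruhat order.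
UCov : (ℕ → ℕ) → ℕ → ℕ → Set
UCov W p q = W p < W q × (∀ c → p < c → c < q → ¬ (W p < W c × W c < W q))

opaque
  ucov? : ∀ W p q → Dec (UCov W p q)
  ucov? W p q = (W p <? W q) ×-dec
    map′ (λ f c a b → f b a) (λ f {c} b a → f c a b)
      (allUpTo? (λ c → (p <? c) →-dec ¬? ((W p <? W c) ×-dec (W c <? W q))) q)

-- The opposite of `μ`: weights increase from left to right, so exchanging an ascent lowers the sum.
ν : ℕ → ℕ → (ℕ → ℕ) → ℕ
ν c zero    V = 0
ν c (suc n) V = c * V zero + ν (suc c) n (V ∘ suc)

ν-asc : ∀ c n j V → suc j < n → V j < V (suc j) → ν c n (V ∘ s j) < ν c n V
ν-asc c (suc zero)    zero V (s≤s ()) q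
ν-asc c (suc (suc n)) zero V p q =
  ℕₚ.+-cancelʳ-< (V 1) _ _ (subst (_< ν c (suc (suc n)) V + V 1) (sym (lem c (V 1) (V 0) (ν (suc (suc c)) n (V ∘ suc ∘ suc)))) (+-monoʳ-< (ν c (suc (suc n)) V) q))
  where
  lem : ∀ c a b r → (c * a + (suc c * b + r)) + a ≡ (c * b + (suc c * a + r)) + b
  lem = ℕ-Solver.solve-∀
ν-asc c (suc n) (suc j) V (s≤s p) q = +-monoʳ-< (c * V 0) (ν-asc (suc c) n j (V ∘ suc) p q)

searchAsc : ∀ n (V : ℕ → ℕ) → (Σ ℕ λ j → suc j < n × V j < V (suc j)) ⊎ (∀ i → suc i < n → V (suc i) ≤ V i)
searchAsc zero V = inj₂ (λ i ())
searchAsc (suc zero) V = inj₂ (λ { i (s≤s ()) })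
searchAsc (suc (suc n)) V with V 0 <? V 1 | searchAsc (suc n) (V ∘ suc)
... | yes p | _                  = inj₁ (0 , s≤s (s≤s z≤n) , p)
... | no _  | inj₁ (j , p , q)   = inj₁ (suc j , s≤s p , q)
... | no p  | inj₂ f             = inj₂ λ { zero _ → ≮⇒≥ p ; (suc i) (s≤s q) → f i q }

module Schubert (N : ℕ) where
  open Sem N public
  open Monk N public

  record Perm (V : ℕ → ℕ) : Set where
    field
      bnd  : ∀ {i} → i < N → V i < N
      inj  : Inj N V
      inv  : ℕ → ℕ
      inv< : ∀ {i} → i < N → inv i < N
      Vinv : ∀ {i} → i < N → V (inv i) ≡ i
  open Perm public

  Perm-tr : ∀ {V} p q → p < N → q < N → Perm V → Perm (V ∘ tr p q)
  Perm-tr {V} p q a b P = record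
    { bnd  = λ c → bnd P (tr-< a b c)
    ; inj  = Inj-tr a b (inj P)
    ; inv  = tr p q ∘ inv P
    ; inv< = λ c → tr-< a b (inv< P c)
    ; Vinv = λ c → trans (cong V (tr-inv p q _)) (Vinv P c) }

  Perm-up : ∀ {V l b} → l < b → b < N → Perm V → Perm (V ∘ tr l b)
  Perm-up l<b b<N = Perm-tr _ _ (<-trans l<b b<N) b<N

  Perm-s : ∀ {V} j → suc j < N → Perm V → Perm (V ∘ s j)
  Perm-s {V} j a P = record
    { bnd  = λ c → bnd P (s-< j a c)
    ; inj  = Inj-s j a (inj P)
    ; inv  = s j ∘ inv P
    ; inv< = λ c → s-< j a (inv< P c)
    ; Vinv = λ c → trans (cong V (s-inv j _)) (Vinv P c) }

  ≐-tr : ∀ {V W} p q → p < N → q < N → V ≐ W → V ∘ tr p q ≐ W ∘ tr p q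
  ≐-tr p q a b e i c = e (tr p q i) (tr-< a b c)

  ≐? : ∀ U X → Dec (U ≐ X)
  ≐? U X = map′ (λ f i p → f p) (λ f {i} p → f i p) (allUpTo? (λ i → U i ≟ X i) N)

  opaque
    δ : (ℕ → ℕ) → (ℕ → ℕ) → ℤ
    δ U X with ≐? U X
    ... | yes _ = 1ℤ
    ... | no _  = 0ℤ

    δ-yes : ∀ {U X} → U ≐ X → δ U X ≡ 1ℤ
    δ-yes {U} {X} p with ≐? U X
    ... | yes _ = refl
    ... | no n  = ⊥-elim (n p)

    δ-no : ∀ {U X} → ¬ (U ≐ X) → δ U X ≡ 0ℤ
    δ-no {U} {X} p with ≐? U X
    ... | yes e = ⊥-elim (p e)
    ... | no _  = refl

    δ-iff : ∀ {U X U′ X′} → (U ≐ X → U′ ≐ X′) → (U′ ≐ X′ → U ≐ X) → δ U X ≡ δ U′ X′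
    δ-iff {U} {X} {U′} {X′} f g with ≐? U X
    ... | yes e = sym (δ-yes (f e))
    ... | no n  = sym (δ-no (n ∘ g))

  δ-refl : ∀ {U} → δ U U ≡ 1ℤ
  δ-refl = δ-yes ≐-refl

  -- φ agrees with evaluation at 𝔖_Y on all functionals ⟦ U ⟧.
  Sch : (ℕ → ℕ) → Point → Set
  Sch Y φ = ∀ U → Perm U → ap φ ⟦ U ⟧ ≡ δ U Y

  Sch-≐ : ∀ {Y Z} φ → Y ≐ Z → Sch Y φ → Sch Z φ
  Sch-≐ φ e h U P = trans (h U P) (δ-iff (λ f → ≐-trans f e) (λ f → ≐-trans f (≐-sym e)))

  -- Pairing ⟦U⟧ with ∂_j φ means pairing `D j ⟦ U ⟧` with φ. This functional is that of `U ∘ s j`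
  -- when U ascends at j, and zero when U descends there.
  Sch-D : ∀ {Y} φ j → suc j < N → Y (suc j) < Y j → Sch Y φ → Sch (Y ∘ s j) (φ ∘D j)
  Sch-D {Y} φ j p dsc h U P with <-cmp (U j) (U (suc j))
  ... | tri< a _ _ = trans (resp φ (⟦⟧-asc j p a)) (trans (h (U ∘ s j) (Perm-s j p P))
          (δ-iff (λ e i q → trans (cong U (sym (s-inv j i))) (e (s j i) (s-< j p q)))
                 (λ e i q → trans (e (s j i) (s-< j p q)) (cong Y (s-inv j i)))))
  ... | tri≈ _ e _ = ⊥-elim (n≢1+n j (inj P (<⇒≤ p) p e))
  ... | tri> _ _ a = trans (resp φ (⟦⟧-desc-0 j p a)) (trans (zer φ) (sym (δ-no λ e →
          <-asym dsc (subst₂ _<_ (trans (e (suc j) p) (cong Y (s-sj j))) (trans (e j (<⇒≤ p)) (cong Y (s-j j))) a))))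

  Cov⇒UCov : ∀ {U W p q} → p < q → q < N → U ≐ W ∘ tr p q → Cov U p q → UCov W p q
  Cov⇒UCov {U} {W} {p} {q} p<q q<N e (lt , nb) = subst₂ _<_ Uq Up lt ,
      λ c a b (x , y) → nb c a b (subst₂ _<_ (sym Uq) (sym (Uc a b)) x , subst₂ _<_ (sym (Uc a b)) (sym Up) y)
    where
    Up : U p ≡ W q
    Up = trans (e p (<-trans p<q q<N)) (cong W (tr-l p q))
    Uq : U q ≡ W p
    Uq = trans (e q q<N) (cong W (tr-r p q))
    Uc : ∀ {c} → p < c → c < q → U c ≡ W c
    Uc a b = trans (e _ (<-trans b q<N)) (cong W (tr-o p q (>⇒≢ a) (<⇒≢ b)))

  UCov⇒Cov : ∀ {U W p q} → p < q → q < N → U ≐ W ∘ tr p q → UCov W p q → Cov U p q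
  UCov⇒Cov {U} {W} {p} {q} p<q q<N e (lt , nb) = subst₂ _<_ (sym Uq) (sym Up) lt ,
      λ c a b (x , y) → nb c a b (subst₂ _<_ Uq (Uc a b) x , subst₂ _<_ (Uc a b) Up y)
    where
    Up : U p ≡ W q
    Up = trans (e p (<-trans p<q q<N)) (cong W (tr-l p q))
    Uq : U q ≡ W p
    Uq = trans (e q q<N) (cong W (tr-r p q))
    Uc : ∀ {c} → p < c → c < q → U c ≡ W c
    Uc a b = trans (e _ (<-trans b q<N)) (cong W (tr-o p q (>⇒≢ a) (<⇒≢ b)))

  tr-flip : ∀ {U W} p q → p < N → q < N → U ∘ tr p q ≐ W → U ≐ W ∘ tr p q
  tr-flip {U} p q a b e i c = trans (cong U (sym (tr-inv p q i))) (e (tr p q i) (tr-< a b c))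

  tr-flip′ : ∀ {U W} p q → p < N → q < N → U ≐ W ∘ tr p q → U ∘ tr p q ≐ W
  tr-flip′ {U} {W} p q a b e i c = trans (e (tr p q i) (tr-< a b c)) (cong W (tr-inv p q i))

  cv-UCov : ∀ {W} φ → Sch W φ → ∀ {p q} → p < q → q < N → UCov W p q →
    ∀ U → Perm U → ap φ (cv U p q) ≡ δ U (W ∘ tr p q)
  cv-UCov {W} φ h {p} {q} p<q q<N uc U P with cov? U p q
  ... | yes c = trans (h _ (Perm-tr p q p<N q<N P)) (δ-iff (tr-flip p q p<N q<N) (tr-flip′ p q p<N q<N))
    where p<N = <-trans p<q q<N
  ... | no n  = trans (zer φ) (sym (δ-no λ e → n (UCov⇒Cov p<q q<N e uc)))

  cv-¬UCov : ∀ {W} φ → Sch W φ → ∀ {p q} → p < q → q < N → ¬ UCov W p q →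
    ∀ U → Perm U → ap φ (cv U p q) ≡ 0ℤ
  cv-¬UCov {W} φ h {p} {q} p<q q<N nuc U P with cov? U p q
  ... | yes c = trans (h _ (Perm-tr p q p<N q<N P)) (δ-no λ e → nuc (Cov⇒UCov p<q q<N (tr-flip p q p<N q<N e) c))
    where p<N = <-trans p<q q<N
  ... | no n  = zer φ

  -- The case in which Monk's rule has a single term; it builds the monomial of a dominant
  -- permutation one factor at a time.
  Sch-X : ∀ {Y} φ b l → b < l → l < N → UCov Y b l →
    (∀ c → b < c → c < N → UCov Y b c → c ≡ l) → (∀ c → c < b → ¬ UCov Y c b) →
    Sch Y φ → Sch (Y ∘ tr b l) (φ ∘X b)
  Sch-X {Y} φ b l b<l l<N uc only none h U P =
    trans (resp φ (monk U (inj P) b (<-trans b<l l<N))) (trans (ap-ΣF φ N _)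
      (trans (ΣZ-single N l l<N other) (trans (resp φ (mterm-< U b<l)) (cv-UCov φ h b<l l<N uc U P))))
    where
    other : ∀ c → c < N → c ≢ l → ap φ (mterm U b c) ≡ 0ℤ
    other c c<N c≢l with <-cmp b c
    ... | tri< a _ _ = cv-¬UCov φ h a c<N (λ u → c≢l (only c a c<N u)) U P
    ... | tri≈ _ _ _ = zer φ
    ... | tri> _ _ a = trans (neg φ _) (cong ℤ.-_ (cv-¬UCov φ h a (<-trans b<l l<N) (none c a) U P))

  -- At the first disagreement, the smaller of the two entries must occur further right in the other
  -- permutation, against the increase there.
  asc-unique : ∀ {Y Z} → Perm Y → Perm Z → ∀ k → (∀ i → i < k → i < N → Y i ≡ Z i) →
    (∀ {a c} → k ≤ a → a < c → c < N → Y a < Y c) → (∀ {a c} → k ≤ a → a < c → c < N → Z a < Z c) → Y ≐ Z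
  asc-unique {Y} {Z} PY PZ k agree ascY ascZ i i<N = go (suc i) i ≤-refl i<N
    where
    half : ∀ {Y Z} → Perm Y → Perm Z → (∀ {a c} → k ≤ a → a < c → c < N → Z a < Z c) →
      ∀ i → k ≤ i → i < N → (∀ j → j < i → Y j ≡ Z j) → ¬ (Y i < Z i)
    half {Y} {Z} PY PZ ascZ i k≤i i<N ih lt with <-cmp (inv PZ (Y i)) i
    ... | tri< a _ _ = <⇒≢ a (inj PY (<-trans a i<N) i<N (trans (ih _ a) (Vinv PZ (bnd PY i<N))))
    ... | tri≈ _ e _ = <⇒≢ lt (trans (sym (Vinv PZ (bnd PY i<N))) (cong Z e))
    ... | tri> _ _ a = <-asym lt (subst (Z i <_) (Vinv PZ (bnd PY i<N)) (ascZ k≤i a (inv< PZ (bnd PY i<N))))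
    go : ∀ n i → i < n → i < N → Y i ≡ Z i
    go (suc n) i (s≤s i≤n) i<N with i <? k
    ... | yes i<k = agree i i<k i<N
    ... | no i≮k with <-cmp (Y i) (Z i)
    ...   | tri< a _ _ = ⊥-elim (half PY PZ ascZ i (≮⇒≥ i≮k) i<N (λ j j<i → go n j (<-≤-trans j<i i≤n) (<-trans j<i i<N)) a)
    ...   | tri≈ _ e _ = e
    ...   | tri> _ _ a = ⊥-elim (half PZ PY ascY i (≮⇒≥ i≮k) i<N (λ j j<i → sym (go n j (<-≤-trans j<i i≤n) (<-trans j<i i<N))) a)

  strict : ∀ {V} → Perm V → (∀ i → suc i < N → V i ≤ V (suc i)) → ∀ {a c} → a < c → c < N → V a < V c
  strict P f a<c c<N = ≤∧≢⇒< (⟦⟧-mono f (<⇒≤ a<c) c<N) (λ e → <⇒≢ a<c (inj P (<-trans a<c c<N) c<N e))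

  Dom₀ : ∀ {Y} → Perm Y → (∀ {a c} → a < c → c < N → Y a < Y c) → ∀ e → (∀ j → e j ≡ 0) → Sch Y (evalAt e)
  Dom₀ {Y} PY asc e e0 U P with search N U
  ... | inj₁ (j , p , dsc) = trans (un (⟦⟧-desc j p dsc) e) (trans (D-at-0 j _ e (e0 j) (e0 (suc j)))
          (sym (δ-no λ q → <-asym dsc (subst₂ _<_ (sym (q j (<⇒≤ p))) (sym (q (suc j) p)) (asc (n<1+n j) p)))))
  ... | inj₂ f = trans (un (⟦⟧-incr f) e) (trans (ε-0 e e0) (sym (δ-yes
          (asc-unique P PY 0 (λ _ ()) (λ _ → strict P f) (λ _ → asc)))))

  -- The Schubert polynomial of a dominant permutation is the monomial of its code;
  -- when Y decreases on [0,i) and increases afterwards, entry j < i of the code is Y j.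
  Dom : ∀ i {Y} → i ≤ N → Perm Y → (∀ {a c} → a < c → c < i → Y c < Y a) →
    (∀ {a c} → i ≤ a → a < c → c < N → Y a < Y c) →
    ∀ e → (∀ j → j < i → e j ≡ Y j) → (∀ j → i ≤ j → e j ≡ 0) → Sch Y (evalAt e)
  -- Induction on the last entry v of the decreasing part. If v is 0, position i joins the
  -- increasing part. Otherwise v - 1 sits to the right of i; exchanging it with v gives Z, and x_i
  -- 𝔖_Z has Y as its only term.
  Dom′ : ∀ i v {Y} → i < N → Perm Y → Y i ≡ v → (∀ {a c} → a < c → c < suc i → Y c < Y a) →
    (∀ {a c} → suc i ≤ a → a < c → c < N → Y a < Y c) →
    ∀ e → (∀ j → j < suc i → e j ≡ Y j) → (∀ j → suc i ≤ j → e j ≡ 0) → Sch Y (evalAt e)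
  Dom zero    i≤N P dsc asc e e< e≥ = Dom₀ P (asc z≤n) e (λ j → e≥ j z≤n)
  Dom (suc i) i≤N P dsc asc e e< e≥ = Dom′ i _ i≤N P refl dsc asc e e< e≥
  Dom′ i zero {Y} i<N P Yi dsc asc e e< e≥ =
    Dom i (<⇒≤ i<N) P (λ a c → dsc a (m<n⇒m<1+n c)) asc′ e (λ j p → e< j (m<n⇒m<1+n p)) e≥′
    where
    asc′ : ∀ {a c} → i ≤ a → a < c → c < N → Y a < Y c
    asc′ {a} {c} i≤a a<c c<N with m≤n⇒m<n∨m≡n i≤a
    ... | inj₁ i<a  = asc i<a a<c c<N
    ... | inj₂ refl = subst (_< Y c) (sym Yi) (ℕₚ.n≢0⇒n>0 λ q → <⇒≢ a<c (inj P i<N c<N (trans Yi (sym q))))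
    e≥′ : ∀ j → i ≤ j → e j ≡ 0
    e≥′ j p with m≤n⇒m<n∨m≡n p
    ... | inj₁ q    = e≥ j q
    ... | inj₂ refl = trans (e< i ≤-refl) Yi
  Dom′ i (suc v) {Y} i<N P Yi dsc asc e e< e≥ U PU =
    trans (ext ⟦ U ⟧ (inc-dec i e (trans (e< i ≤-refl) Yi))) (trans (sym (at-X i ⟦ U ⟧ (dec i e)))
      (Sch-≐ (evalAt (dec i e) ∘X i) (λ x x<N → cong Y (tr-inv i l x)) schZ U PU))
    where
    v<N : v < N
    v<N = <-trans (n<1+n v) (subst (_< N) Yi (bnd P i<N))
    l : ℕ
    l = inv P v
    l<N : l < N
    l<N = inv< P v<N
    Yl : Y l ≡ v
    Yl = Vinv P v<N
    i<l : i < l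
    i<l with <-cmp i l
    ... | tri< a _ _ = a
    ... | tri≈ _ q _ = ⊥-elim (n≢1+n v (trans (sym Yl) (trans (cong Y (sym q)) Yi)))
    ... | tri> _ _ a = ⊥-elim (<-asym (dsc a ≤-refl) (subst₂ _<_ (sym Yl) (sym Yi) ≤-refl))
    Z : ℕ → ℕ
    Z = Y ∘ tr i l
    Zi : Z i ≡ v
    Zi = trans (cong Y (tr-l i l)) Yl
    Zl : Z l ≡ suc v
    Zl = trans (cong Y (tr-r i l)) Yi
    Zo : ∀ {c} → c ≢ i → c ≢ l → Z c ≡ Y c
    Zo a b = cong Y (tr-o i l a b)
    Zdsc : ∀ {a c} → a < c → c < suc i → Z c < Z a
    Zdsc {a} {c} a<c (s≤s c≤i) with m≤n⇒m<n∨m≡n c≤i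
    ... | inj₁ c<i = subst₂ _<_ (sym (Zo (<⇒≢ c<i) (<⇒≢ (<-trans c<i i<l)))) (sym (Zo (<⇒≢ (<-trans a<c c<i)) (<⇒≢ (<-trans a<c (<-trans c<i i<l)))))
                       (dsc a<c (m<n⇒m<1+n c<i))
    ... | inj₂ refl = subst₂ _<_ (sym Zi) (sym (Zo (<⇒≢ a<c) (<⇒≢ (<-trans a<c i<l)))) (<-trans (n<1+n v) (subst (_< Y a) Yi (dsc a<c ≤-refl)))
    Zasc : ∀ {a c} → suc i ≤ a → a < c → c < N → Z a < Z c
    Zasc {a} {c} i<a a<c c<N with a ≟ l | c ≟ l
    ... | yes refl | _ = subst₂ _<_ (sym Zl) (sym (Zo (>⇒≢ (<-trans i<l a<c)) (>⇒≢ a<c)))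
            (≤∧≢⇒< (subst (_< Y c) Yl (asc i<a a<c c<N)) (λ q → <⇒≢ (<-trans i<l a<c) (inj P i<N c<N (trans Yi q))))
    ... | no a≢l | yes refl = subst₂ _<_ (sym (Zo (>⇒≢ i<a) a≢l)) (sym Zl) (<-trans (subst (Y a <_) Yl (asc i<a a<c c<N)) (n<1+n v))
    ... | no a≢l | no c≢l = subst₂ _<_ (sym (Zo (>⇒≢ i<a) a≢l)) (sym (Zo (>⇒≢ (<-trans i<a a<c)) c≢l)) (asc i<a a<c c<N)
    schZ : Sch (Z ∘ tr i l) (evalAt (dec i e) ∘X i)
    schZ = Sch-X (evalAt (dec i e)) i l i<l l<N uc only none
      (Dom′ i v i<N (Perm-tr i l i<N l<N P) Zi Zdsc Zasc (dec i e) de< de≥)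
      where
      uc : UCov Z i l
      uc = subst₂ _<_ (sym Zi) (sym Zl) ≤-refl , λ c _ _ (x , y) → ≤⇒≯ (≤-pred (subst (Z c <_) Zl y)) (subst (_< Z c) Zi x)
      only : ∀ c → i < c → c < N → UCov Z i c → c ≡ l
      only c i<c c<N (lt , nb) with <-cmp c l
      ... | tri< a _ _ = ⊥-elim (≤⇒≯ (≤-pred (subst (Z c <_) Zl (Zasc i<c a l<N))) (subst (_< Z c) Zi lt))
      ... | tri≈ _ q _ = q
      ... | tri> _ _ a = ⊥-elim (nb l i<l a (subst₂ _<_ (sym Zi) (sym Zl) ≤-refl , Zasc i<l a c<N))
      none : ∀ c → c < i → ¬ UCov Z c i
      none c c<i (lt , _) = <-asym lt (Zdsc c<i ≤-refl)
      de< : ∀ j → j < suc i → dec i e j ≡ Z j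
      de< j (s≤s j≤i) with m≤n⇒m<n∨m≡n j≤i
      ... | inj₁ j<i  = trans (dec-other i e (<⇒≢ j<i)) (trans (e< j (m<n⇒m<1+n j<i)) (sym (Zo (<⇒≢ j<i) (<⇒≢ (<-trans j<i i<l)))))
      ... | inj₂ refl = trans (dec-same i e) (trans (cong pred (trans (e< i ≤-refl) Yi)) (sym Zi))
      de≥ : ∀ j → suc i ≤ j → dec i e j ≡ 0
      de≥ j p = trans (dec-other i e (>⇒≢ p)) (e≥ j p)

  trim : (ℕ → ℕ) → Exp
  trim W j with j <? N
  ... | yes _ = W j
  ... | no _  = 0

  trim-< : ∀ W j → j < N → trim W j ≡ W j
  trim-< W j p with j <? N
  ... | yes _ = refl
  ... | no n  = ⊥-elim (n p)

  trim-≥ : ∀ W j → N ≤ j → trim W j ≡ 0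
  trim-≥ W j p with j <? N
  ... | yes q = ⊥-elim (≤⇒≯ p q)
  ... | no _  = refl

  antitone : ∀ {V : ℕ → ℕ} → (∀ i → suc i < N → V (suc i) ≤ V i) → ∀ {i j} → i ≤ j → j < N → V j ≤ V i
  antitone f {i} {j} p q with m≤n⇒m<n∨m≡n p
  ... | inj₂ refl = ≤-refl
  antitone f {i} {suc j} p q | inj₁ (s≤s r) = ≤-trans (f j q) (antitone f r (<⇒≤ q))

  -- Exchanging ascents leads to the decreasing permutation, which is dominant; the divided
  -- differences lead back. Thus each W gets a point without reference to polynomials as lists.
  pt′ : ∀ (n : ℕ) (W : ℕ → ℕ) → Point
  pt′ zero    W = 0ᴾ
  pt′ (suc n) W with searchAsc N W
  ... | inj₁ (j , _ , _) = pt′ n (W ∘ s j) ∘D j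
  ... | inj₂ _           = evalAt (trim W)

  pt′-Sch : ∀ n W → ν 0 N W < n → Perm W → Sch W (pt′ n W)
  pt′-Sch (suc n) W (s≤s p) P with searchAsc N W
  ... | inj₁ (j , q , r) = Sch-≐ (pt′ n (W ∘ s j) ∘D j) (λ i _ → cong W (s-inv j i)) (Sch-D (pt′ n (W ∘ s j)) j q
          (subst₂ _<_ (cong W (sym (s-sj j))) (cong W (sym (s-j j))) r)
          (pt′-Sch n (W ∘ s j) (<-≤-trans (ν-asc 0 N j W q r) p) (Perm-s j q P)))
  ... | inj₂ f = Dom N ≤-refl P dsc (λ a b c → ⊥-elim (≤⇒≯ a (<-trans b c))) (trim W) (trim-< W) (trim-≥ W)
    where
    dsc : ∀ {a c} → a < c → c < N → W c < W a
    dsc a<c c<N = ≤∧≢⇒< (antitone f (<⇒≤ a<c) c<N) (λ q → <⇒≢ a<c (inj P (<-trans a<c c<N) c<N (sym q)))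

  opaque
    pt : (ℕ → ℕ) → Point
    pt W = pt′ (suc (ν 0 N W)) W

    pt-Sch : ∀ {W} → Perm W → Sch W (pt W)
    pt-Sch P = pt′-Sch _ _ ≤-refl P

  -- `Sch` fixes a point only on the functionals ⟦U⟧. Points are compared on this span, which is
  -- closed under all multiplications that occur.
  data Span : Fn → Set where
    gen   : ∀ {U} → Perm U → Span ⟦ U ⟧
    zeroˢ : Span 𝟘
    addˢ   : ∀ {L M} → Span L → Span M → Span (L ⊕ M)
    negˢ   : ∀ {L} → Span L → Span (⊖ L)
    respˢ  : ∀ {L M} → L ≈ M → Span L → Span M

  span-ext : ∀ (φ ψ : Point) → (∀ U → Perm U → ap φ ⟦ U ⟧ ≡ ap ψ ⟦ U ⟧) → ∀ {L} → Span L → ap φ L ≡ ap ψ L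
  span-ext φ ψ h (gen P)    = h _ P
  span-ext φ ψ h zeroˢ      = trans (zer φ) (sym (zer ψ))
  span-ext φ ψ h (addˢ a b)  = trans (add φ _ _) (trans (cong₂ ℤ._+_ (span-ext φ ψ h a) (span-ext φ ψ h b)) (sym (add ψ _ _)))
  span-ext φ ψ h (negˢ a)    = trans (neg φ _) (trans (cong ℤ.-_ (span-ext φ ψ h a)) (sym (neg ψ _)))
  span-ext φ ψ h (respˢ e a) = trans (sym (resp φ e)) (trans (span-ext φ ψ h a) (resp ψ e))

  Sch-span : ∀ {W} φ ψ → Sch W φ → Sch W ψ → ∀ {L} → Span L → ap φ L ≡ ap ψ L
  Sch-span φ ψ h k = span-ext φ ψ (λ U P → trans (h U P) (sym (k U P)))

  Span-ΣF : ∀ n {f} → (∀ l → l < n → Span (f l)) → Span (ΣF n f)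
  Span-ΣF zero    h = zeroˢ
  Span-ΣF (suc n) h = addˢ (Span-ΣF n (λ l p → h l (m<n⇒m<1+n p))) (h n ≤-refl)

  -- For b < N this is Monk's rule. A variable x_b with b ≥ N is set to 1 in ⟦U⟧, so multiplication
  -- by it acts trivially.
  Span-X : ∀ b {L} → Span L → Span (X b L)
  Span-X b (gen {U} P) with b <? N
  ... | yes b<N = respˢ (≈-sym (monk U (inj P) b b<N)) (Span-ΣF N tm)
    where
    cvS : ∀ {p q} → p < q → q < N → Span (cv U p q)
    cvS {p} {q} p<q q<N with cov? U p q
    ... | yes _ = gen (Perm-tr p q (<-trans p<q q<N) q<N P)
    ... | no _  = zeroˢ
    tm : ∀ l → l < N → Span (mterm U b l)
    tm l l<N with <-cmp b l
    ... | tri< a _ _ = cvS a l<N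
    ... | tri≈ _ _ _ = zeroˢ
    ... | tri> _ _ a = negˢ (cvS a b<N)
  ... | no b≮N = respˢ (≈-sym (⟦⟧-ind (λ V → X b ⟦ V ⟧ ≈ ⟦ V ⟧)
      (λ V f → X-cong b (⟦⟧-incr f) ▸ ε-≥ b (≮⇒≥ b≮N) ▸ ≈-sym (⟦⟧-incr f))
      (λ V j p q ih → X-cong b (⟦⟧-desc j p q) ▸ XD-far b j _ (>⇒≢ (<-trans (n<1+n j) (<-≤-trans p (≮⇒≥ b≮N)))) (>⇒≢ (<-≤-trans p (≮⇒≥ b≮N)))
                      ▸ D-cong j ih ▸ ≈-sym (⟦⟧-desc j p q)) U)) (gen P)
  Span-X b zeroˢ      = respˢ (≈-sym (X-𝟘 b)) zeroˢ
  Span-X b (addˢ p q)  = respˢ (≈-sym (X-⊕ b _ _)) (addˢ (Span-X b p) (Span-X b q))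
  Span-X b (negˢ p)    = respˢ (≈-sym (X-⊖ b _)) (negˢ (Span-X b p))
  Span-X b (respˢ e p) = respˢ (X-cong b e) (Span-X b p)

  upᴾ : (ℕ → ℕ) → ℕ → ℕ → Point
  upᴾ W b l with ucov? W l b
  ... | yes _ = pt (W ∘ tr l b)
  ... | no _  = 0ᴾ

  -- Monk's rule for x_b · 𝔖_W when W b exceeds all later entries, so that only
  -- transpositions with earlier positions occur.
  column : ∀ {W} → Perm W → ∀ b → b < N → (∀ c → b < c → c < N → W c < W b) →
    ∀ {L} → Span L → ap (pt W) (X b L) ≡ ℤ.- ΣZ b (λ l → ap (upᴾ W b l) L)
  column {W} P b b<N mx {L} S = trans (span-ext (pt W ∘X b) (-ᴾ Σᴾ b (upᴾ W b)) on-gen S) (cong ℤ.-_ (ap-Σᴾ b _ L))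
    where
    h = pt-Sch P
    on-gen : ∀ U → Perm U → ap (pt W) (X b ⟦ U ⟧) ≡ ℤ.- ap (Σᴾ b (upᴾ W b)) ⟦ U ⟧
    on-gen U PU = trans (resp (pt W) (monk U (inj PU) b b<N)) (trans (ap-ΣF (pt W) N _)
      (trans (ΣZ-trunc N b (<⇒≤ b<N) hi) (trans (ΣZ-cong b lo) (trans (ΣZ-neg b _) (cong ℤ.-_ (sym (ap-Σᴾ b (upᴾ W b) ⟦ U ⟧)))))))
      where
      hi : ∀ l → b ≤ l → l < N → ap (pt W) (mterm U b l) ≡ 0ℤ
      hi l b≤l l<N with m≤n⇒m<n∨m≡n b≤l
      ... | inj₂ refl = trans (resp (pt W) (mterm-≡ U b)) (zer (pt W))
      ... | inj₁ a    = trans (resp (pt W) (mterm-< U a)) (cv-¬UCov (pt W) h a l<N (λ u → <-asym (proj₁ u) (mx l a l<N)) U PU)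
      lo : ∀ l → l < b → ap (pt W) (mterm U b l) ≡ ℤ.- ap (upᴾ W b l) ⟦ U ⟧
      lo l a = trans (resp (pt W) (mterm-> U a)) (trans (neg (pt W) _) (cong ℤ.-_ aux))
        where
        aux : ap (pt W) (cv U l b) ≡ ap (upᴾ W b l) ⟦ U ⟧
        aux with ucov? W l b
        ... | yes u = trans (cv-UCov (pt W) h a b<N u U PU) (sym (pt-Sch (Perm-tr l b (<-trans a b<N) b<N P) U PU))
        ... | no n  = cv-¬UCov (pt W) h a b<N n U PU

-- Complete homogeneous polynomials

-- H c n m L is the functional f ↦ L (h_m(x_c, …, x_{c+n-1}) f).
H : ℕ → ℕ → ℕ → Fn → Fn
H c n       zero    L = L
H c zero    (suc m) L = 𝟘
H c (suc n) (suc m) L = H c n (suc m) L ⊕ X (n + c) (H c (suc n) m L)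

H-cong : ∀ c n m {L M} → L ≈ M → H c n m L ≈ H c n m M
H-cong c n       zero    p = p
H-cong c zero    (suc m) p = ≈-refl
H-cong c (suc n) (suc m) p = ⊕-cong (H-cong c n (suc m) p) (X-cong (n + c) (H-cong c (suc n) m p))

opaque
  unfolding X
  ⊕-swap₄ : ∀ A B C E → (A ⊕ B) ⊕ (C ⊕ E) ≈ (A ⊕ C) ⊕ (B ⊕ E)
  ⊕-swap₄ A B C E = mk λ e → lem (at A e) (at B e) (at C e) (at E e)
    where lem : ∀ a b c d → (a ℤ.+ b) ℤ.+ (c ℤ.+ d) ≡ (a ℤ.+ c) ℤ.+ (b ℤ.+ d)
          lem = ℤ-Solver.solve-∀

  H-D-cancelᴮ : ∀ C A B K → C ⊕ (B ⊕ K) ≈ (C ⊕ A ⊕ B ⊕ ⊖ A) ⊕ K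
  H-D-cancelᴮ C A B K = mk λ e → lem (at C e) (at A e) (at B e) (at K e)
    where lem : ∀ c a b k → c ℤ.+ (b ℤ.+ k) ≡ (c ℤ.+ a ℤ.+ b ℤ.+ ℤ.- a) ℤ.+ k
          lem = ℤ-Solver.solve-∀

  H-D-cancelᴬ : ∀ P A M → (P ⊕ ⊖ A ⊕ M) ⊕ (A ⊕ ⊖ M) ≈ P
  H-D-cancelᴬ P A M = mk λ e → lem (at P e) (at A e) (at M e)
    where lem : ∀ p a m → (p ℤ.+ ℤ.- a ℤ.+ m) ℤ.+ (a ℤ.+ ℤ.- m) ≡ p
          lem = ℤ-Solver.solve-∀

  ⊕-comm : ∀ A B → A ⊕ B ≈ B ⊕ A
  ⊕-comm A B = mk λ e → ℤₚ.+-comm (at A e) (at B e)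

  ⊕-solveʳ : ∀ {A B C} → A ≈ B ⊕ C → B ≈ A ⊕ ⊖ C
  ⊕-solveʳ {A} {B} {C} p = mk λ e → trans (lem (at B e) (at C e)) (cong (ℤ._+ ℤ.- at C e) (sym (un p e)))
    where lem : ∀ b c → b ≡ (b ℤ.+ c) ℤ.+ ℤ.- c
          lem = ℤ-Solver.solve-∀

H-⊕ : ∀ c n m L M → H c n m (L ⊕ M) ≈ H c n m L ⊕ H c n m M
H-⊕ c n       zero    L M = ≈-refl
H-⊕ c zero    (suc m) L M = ≈-sym (⊕-identityʳ 𝟘)
H-⊕ c (suc n) (suc m) L M = ⊕-cong (H-⊕ c n (suc m) L M) (X-cong (n + c) (H-⊕ c (suc n) m L M) ▸ X-⊕ _ _ _) ▸ ⊕-swap₄ _ _ _ _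

H-𝟘 : ∀ c n m → H c n m 𝟘 ≈ 𝟘
H-𝟘 c n       zero    = ≈-refl
H-𝟘 c zero    (suc m) = ≈-refl
H-𝟘 c (suc n) (suc m) = ⊕-cong (H-𝟘 c n (suc m)) (X-cong (n + c) (H-𝟘 c (suc n) m) ▸ X-𝟘 _) ▸ ⊕-identityʳ 𝟘

H-X : ∀ c n m b L → H c n m (X b L) ≈ X b (H c n m L)
H-X c n       zero    b L = ≈-refl
H-X c zero    (suc m) b L = ≈-sym (X-𝟘 b)
H-X c (suc n) (suc m) b L = ⊕-cong (H-X c n (suc m) b L) (X-cong (n + c) (H-X c (suc n) m b L) ▸ XX (n + c) b _) ▸ ≈-sym (X-⊕ b _ _)

H-D-out : ∀ c n m j L → n + c ≤ j → H c n m (D j L) ≈ D j (H c n m L)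
H-D-out c n       zero    j L p = ≈-refl
H-D-out c zero    (suc m) j L p = ≈-sym (D-𝟘 j)
H-D-out c (suc n) (suc m) j L p =
  ⊕-cong (H-D-out c n (suc m) j L (<⇒≤ p))
         (X-cong (n + c) (H-D-out c (suc n) m j L p) ▸ XD-far (n + c) j _ (<⇒≢ p) (<⇒≢ (m<n⇒m<1+n p)))
  ▸ ≈-sym (D-⊕ j _ _)

-- Proved together with `H-D-B`, by induction on m. With j = n + c, the latter comes from
-- h_{m+1}(...,x_j) = h_{m+1}(...,x_{j+1}) - x_{j+1} h_m(...,x_{j+1}): the h's on the right are
-- symmetric in x_j and x_{j+1}, so Leibniz gives (h_{m+1} - x_j h_m) ∂_j f + h_m f.
H-D-A : ∀ c n m L → H c (suc (suc n)) m (D (n + c) L) ≈ D (n + c) (H c (suc (suc n)) m L)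
H-D-B : ∀ c n m L → H c (suc n) (suc m) (D (n + c) L) ≈
  D (n + c) (H c (suc (suc n)) (suc m) L ⊕ ⊖ X (n + c) (H c (suc (suc n)) m L)) ⊕ H c (suc (suc n)) m L
H-D-A c n zero    L = ≈-refl
H-D-A c n (suc m) L =
  ⊕-cong (H-D-B c n m L ▸ ⊕-cong (D-⊕ j _ _ ▸ ⊕-cong ≈-refl (D-⊖ j _)) ≈-refl)
         (X-cong (suc j) (H-D-A c n m L) ▸ XDʳ j _)
  ▸ H-D-cancelᴬ _ _ _
  where j = n + c
H-D-B c n zero L =
  ⊕-cong (H-D-out c n 1 j L ≤-refl) (XDˡ j L)
  ▸ H-D-cancelᴮ _ (D j (X j L)) _ _
  ▸ ⊕-cong (≈-sym (D-⊕ j _ _ ▸ ⊕-cong (D-⊕ j _ _ ▸ ⊕-cong (D-⊕ j _ _) ≈-refl) (D-⊖ j _))) ≈-refl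
  where j = n + c
H-D-B c n (suc m) L =
  ⊕-cong (H-D-out c n (suc (suc m)) j L ≤-refl)
         (X-cong j (H-D-B c n m L) ▸ X-⊕ j _ _ ▸ ⊕-cong (XDˡ j P) ≈-refl ▸ ⊕-assoc _ _ _)
  ▸ ≈-sym (⊕-assoc _ _ _)
  ▸ ⊕-cong (≈-sym (D-⊕ j _ _) ▸ D-cong j poly) (cancel⊖⊕ _ _)
  where
  j = n + c
  a₁ a₀ P : Fn
  a₁ = H c (suc (suc n)) (suc m) L
  a₀ = H c (suc (suc n)) m L
  P  = a₁ ⊕ ⊖ X j a₀
  poly : H c n (suc (suc m)) L ⊕ X (suc j) P ≈ H c (suc (suc n)) (suc (suc m)) L ⊕ ⊖ X j a₁
  poly = ≈-sym (⊕-cong ≈-refl (⊖-cong (X-⊕ j _ _)) ▸ lem _ _ _ _ ▸ ⊕-cong ≈-refl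
      (⊕-cong ≈-refl (⊖-cong (XX j (suc j) a₀)) ▸ ≈-sym (X-⊕⊖ (suc j) a₁ (X j a₀))))
    where
    opaque
      unfolding X
      lem : ∀ C B A E → (C ⊕ B) ⊕ A ⊕ ⊖ (B ⊕ E) ≈ C ⊕ (A ⊕ ⊖ E)
      lem C B A E = mk λ e → lem′ (at C e) (at B e) (at A e) (at E e)
        where lem′ : ∀ c b a d → (c ℤ.+ b) ℤ.+ a ℤ.+ ℤ.- (b ℤ.+ d) ≡ c ℤ.+ (a ℤ.+ ℤ.- d)
              lem′ = ℤ-Solver.solve-∀

H-D : ∀ c n m j L → c ≤ j → suc j < n + c → H c n m (D j L) ≈ D j (H c n m L)
H-D c zero    m       j L p q = ⊥-elim (≤⇒≯ p (<⇒≤ q))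
H-D c (suc n) zero    j L p q = ≈-refl
H-D c (suc n) (suc m) j L p (s≤s q) with m≤n⇒m<n∨m≡n q
... | inj₁ r = ⊕-cong (H-D c n (suc m) j L p r)
      (X-cong (n + c) (H-D c (suc n) m j L p (s≤s q)) ▸ XD-far (n + c) j _ (>⇒≢ (<⇒≤ r)) (>⇒≢ r))
    ▸ ≈-sym (D-⊕ j _ _)
H-D c (suc zero)    (suc m) j L p (s≤s q) | inj₂ r = ⊥-elim (≤⇒≯ p (subst (j <_) r (n<1+n j)))
H-D c (suc (suc n)) (suc m) j L p (s≤s q) | inj₂ refl = H-D-A c n (suc m) L

H-first : ∀ c n m L → H c (suc n) (suc m) L ≈ H (suc c) n (suc m) L ⊕ X c (H c (suc n) m L)
H-first c zero    m L = ≈-refl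
H-first c (suc n) m L = ⊕-cong (H-first c n m L) ≈-refl ▸ ⊕-assoc _ _ _ ▸ ⊕-cong ≈-refl (mid m)
    ▸ ≈-sym (⊕-assoc _ _ _) ▸ ⊕-cong (⊕-cong ≈-refl (≡⇒≈ (cong (λ z → X z (H (suc c) (suc n) m L)) (sym (+-suc n c))))) ≈-refl
  where
  z = suc (n + c)
  mid : ∀ m → X c (H c (suc n) m L) ⊕ X z (H c (suc (suc n)) m L) ≈ X z (H (suc c) (suc n) m L) ⊕ X c (H c (suc (suc n)) m L)
  mid zero    = ⊕-comm _ _
  mid (suc m) =
    ⊕-cong ≈-refl (X-cong z (H-first c (suc n) m L) ▸ X-⊕ z _ _)
    ▸ ≈-sym (⊕-assoc _ _ _) ▸ ⊕-cong (⊕-comm _ _) ≈-refl ▸ ⊕-assoc _ _ _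
    ▸ ⊕-cong ≈-refl (⊕-cong ≈-refl (XX z c _) ▸ ≈-sym (X-⊕ c _ _))

-- Chains of divided differences and the Jacobi-Trudi formula

Dchain : ℕ → ℕ → Fn → Fn
Dchain c zero    L = L
Dchain c (suc d) L = Dchain c d (D (d + c) L)

incn : ℕ → ℕ → Exp → Exp
incn c zero    e = e
incn c (suc n) e = incn c n (inc c e)

incn-other : ∀ c n e {i} → i ≢ c → incn c n e i ≡ e i
incn-other c zero    e p = refl
incn-other c (suc n) e p = trans (incn-other c n (inc c e) p) (inc-other c e p)

incn-same : ∀ c n e → incn c n e c ≡ n + e c
incn-same c zero    e = refl
incn-same c (suc n) e = trans (incn-same c n (inc c e)) (trans (cong (λ z → n + z) (inc-same c e)) (+-suc n (e c)))

Dchain-cong : ∀ c d {L M} → L ≈ M → Dchain c d L ≈ Dchain c d M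
Dchain-cong c zero    p = p
Dchain-cong c (suc d) p = Dchain-cong c d (D-cong (d + c) p)

H-Dchain : ∀ c n m c′ d L → c ≤ c′ → d + c′ < n + c → H c n m (Dchain c′ d L) ≈ Dchain c′ d (H c n m L)
H-Dchain c n m c′ zero    L p q = ≈-refl
H-Dchain c n m c′ (suc d) L p q = H-Dchain c n m c′ d _ p (<⇒≤ q)
  ▸ Dchain-cong c′ d (H-D c n m (d + c′) L (≤-trans p (m≤n+m c′ d)) q)

-- This is ∂_{c+d-1}⋯∂_c x_c^{d+m} = h_m(x_c, ..., x_{c+d}): each divided difference lowers the
-- degree by one and adds one variable. The other term of `H-D-B` vanishes because e involves none
-- of these variables.
Dchain-at : ∀ c d m L e → (∀ i → c ≤ i → i ≤ d + c → e i ≡ 0) →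
  at (Dchain c d L) (incn c (d + m) e) ≡ at (H c (suc d) m L) e
Dchain-at c zero    m L e _ = go m e
  where
  go : ∀ m e → at L (incn c m e) ≡ at (H c 1 m L) e
  go zero    e = refl
  go (suc m) e = trans (go m (inc c e)) (sym (trans (un (⊕-identityˡ _) e) (at-X c _ e)))
Dchain-at c (suc d) m L e z =
  trans (cong (λ x → at (Dchain c d (D (d + c) L)) (incn c x e)) (sym (+-suc d m)))
  (trans (Dchain-at c d (suc m) (D (d + c) L) e (λ i p q → z i p (m≤n⇒m≤1+n q)))
  (trans (un (H-D-B c d m L) e) (trans (at-⊕ _ _ e) (trans (cong (ℤ._+ at (H c (suc (suc d)) m L) e)
    (D-at-0 (d + c) _ e (z (d + c) (m≤n+m c d) (ℕₚ.n≤1+n _)) (z (suc (d + c)) (m≤n⇒m≤1+n (m≤n+m c d)) ≤-refl)))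
    (ℤₚ.+-identityˡ _)))))

-- Right multiplication by a cycle that carries the entry at c to position d + c; `rchain` is its
-- inverse and carries the entry at d + c back to c.
schain : (ℕ → ℕ) → ℕ → ℕ → ℕ → ℕ
schain V c zero    = V
schain V c (suc d) = schain V c d ∘ s (d + c)

rchain : (ℕ → ℕ) → ℕ → ℕ → ℕ → ℕ
rchain V c zero    = V
rchain V c (suc d) = rchain (V ∘ s (d + c)) c d

schain-rchain : ∀ V c d → schain (rchain V c d) c d ≗ V
schain-rchain V c zero    i = refl
schain-rchain V c (suc d) i = trans (schain-rchain (V ∘ s (d + c)) c d (s (d + c) i)) (cong V (s-inv (d + c) i))

schain-top : ∀ V c d → schain V c d (d + c) ≡ V c
schain-top V c zero    = refl
schain-top V c (suc d) = trans (cong (schain V c d) (s-sj (d + c))) (schain-top V c d)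

schain-hi : ∀ V c d {i} → d + c < i → schain V c d i ≡ V i
schain-hi V c zero    p = refl
schain-hi V c (suc d) {i} p = trans (cong (schain V c d) (s-other (d + c) (>⇒≢ (<⇒≤ p)) (>⇒≢ p))) (schain-hi V c d (<⇒≤ p))

rchain-bot : ∀ V c d → rchain V c d c ≡ V (d + c)
rchain-bot V c zero    = refl
rchain-bot V c (suc d) = trans (rchain-bot (V ∘ s (d + c)) c d) (cong V (s-j (d + c)))

rchain-hi : ∀ V c d {i} → d + c < i → rchain V c d i ≡ V i
rchain-hi V c zero    p = refl
rchain-hi V c (suc d) p = trans (rchain-hi (V ∘ s (d + c)) c d (<⇒≤ p)) (cong V (s-other (d + c) (>⇒≢ (<⇒≤ p)) (>⇒≢ p)))

rchain-lo : ∀ V c d {i} → i < c → rchain V c d i ≡ V i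
rchain-lo V c zero    p = refl
rchain-lo V c (suc d) p = trans (rchain-lo (V ∘ s (d + c)) c d p)
  (cong V (s-other (d + c) (<⇒≢ (<-≤-trans p (m≤n+m c d))) (<⇒≢ (<-≤-trans p (m≤n⇒m≤1+n (m≤n+m c d))))))

rchain-mid : ∀ V c d {i} → c ≤ i → i < d + c → rchain V c d (suc i) ≡ V i
rchain-mid V c zero    p q = ⊥-elim (≤⇒≯ p q)
rchain-mid V c (suc d) p (s≤s q) with m≤n⇒m<n∨m≡n q
... | inj₁ r    = trans (rchain-mid (V ∘ s (d + c)) c d p r) (cong V (s-other (d + c) (<⇒≢ r) (<⇒≢ (m<n⇒m<1+n r))))
... | inj₂ refl = trans (rchain-hi (V ∘ s (d + c)) c d ≤-refl) (cong V (s-sj (d + c)))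

module JacobiTrudi (N : ℕ) where
  open Schubert N public

  Perm-rchain : ∀ {V} c d → d + c < N → Perm V → Perm (rchain V c d)
  Perm-rchain c zero    p P = P
  Perm-rchain c (suc d) p P = Perm-rchain c d (<⇒≤ p) (Perm-s (d + c) p P)

  chainᴾ : Point → ℕ → ℕ → Point
  chainᴾ φ c zero    = φ
  chainᴾ φ c (suc d) = chainᴾ φ c d ∘D (d + c)

  ap-chainᴾ : ∀ φ c d L → ap (chainᴾ φ c d) L ≡ ap φ (Dchain c d L)
  ap-chainᴾ φ c zero    L = refl
  ap-chainᴾ φ c (suc d) L = ap-chainᴾ φ c d (D (d + c) L)

  Sch-chain : ∀ {Y} φ c d → d + c < N → (∀ i → c < i → i ≤ d + c → Y i < Y c) → Sch Y φ → Sch (schain Y c d) (chainᴾ φ c d)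
  Sch-chain φ c zero    p h S = S
  Sch-chain {Y} φ c (suc d) p h S = Sch-D (chainᴾ φ c d) (d + c) p
    (subst₂ _<_ (sym (schain-hi Y c d ≤-refl)) (sym (schain-top Y c d)) (h (suc (d + c)) (s≤s (m≤n+m c d)) ≤-refl))
    (Sch-chain φ c d (<⇒≤ p) (λ i a b → h i a (m≤n⇒m≤1+n b)) S)

  -- L evaluated at h_{m₁} h_{m₂+1} - h_{m₁+1} h_{m₂} in k variables.
  jt : ℕ → ℕ → ℕ → Fn → ℤ
  jt k m₁ m₂ L = at (H 0 k m₁ (H 0 k (suc m₂) L)) (λ _ → 0) ℤ.- at (H 0 k (suc m₁) (H 0 k m₂ L)) (λ _ → 0)

  -- Move the two largest entries of the dominant permutation (τ(k-1), τ(k-2), τ(0), …) to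
  -- positions k-1 and k-2: ∂_{k-2}⋯∂₀ ∂_{k-2}⋯∂₁ turns its monomial into the Jacobi–Trudi determinant.
  Grassmann : ∀ {τ} → Perm τ → ∀ k m₁ m₂ → suc (suc k) ≤ N →
    (∀ i → i < k → τ i ≡ i) → τ k ≡ k + suc m₂ → τ (suc k) ≡ suc k + m₁ → suc m₂ ≤ m₁ →
    (∀ {a c} → suc (suc k) ≤ a → a < c → c < N → τ a < τ c) →
    Σ Point λ φ → Sch τ φ × (∀ L → ap φ L ≡ jt (suc (suc k)) m₁ m₂ L)
  Grassmann {τ} P k m₁ m₂ k≤N τlo τk τsk m≤m asc =
    φ , Sch-≐ φ (λ i _ → sc i) schφ , val
    where
    Y Z : ℕ → ℕ
    Y = rchain τ 0 (suc k)
    Z = rchain Y 1 k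
    k+0 : ∀ n → n + 0 ≡ n
    k+0 = +-identityʳ
    k+1 : k + 1 ≡ suc k
    k+1 = trans (+-suc k 0) (cong suc (k+0 k))
    sk<N : suc k + 0 < N
    sk<N = subst (_< N) (sym (k+0 (suc k))) k≤N
    k1<N : k + 1 < N
    k1<N = subst (_< N) (sym k+1) k≤N
    PY : Perm Y
    PY = Perm-rchain 0 (suc k) sk<N P
    PZ : Perm Z
    PZ = Perm-rchain 1 k k1<N PY
    Y0 : Y 0 ≡ τ (suc k)
    Y0 = trans (rchain-bot τ 0 (suc k)) (cong τ (k+0 (suc k)))
    Ys : ∀ {i} → i < suc k → Y (suc i) ≡ τ i
    Ys {i} p = rchain-mid τ 0 (suc k) z≤n (subst (i <_) (sym (k+0 (suc k))) p)
    Yh : ∀ {i} → suc k < i → Y i ≡ τ i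
    Yh {i} p = rchain-hi τ 0 (suc k) (subst (_< i) (sym (k+0 (suc k))) p)
    Z0 : Z 0 ≡ τ (suc k)
    Z0 = trans (rchain-lo Y 1 k (s≤s z≤n)) Y0
    Z1 : Z 1 ≡ τ k
    Z1 = trans (rchain-bot Y 1 k) (trans (cong Y k+1) (Ys ≤-refl))
    Zs : ∀ {i} → i < k → Z (suc (suc i)) ≡ τ i
    Zs {i} p = trans (rchain-mid Y 1 k (s≤s z≤n) (subst (suc i <_) (sym k+1) (s≤s p))) (Ys (m<n⇒m<1+n p))
    Zh : ∀ {i} → suc k < i → Z i ≡ τ i
    Zh {i} p = trans (rchain-hi Y 1 k (subst (_< i) (sym k+1) p)) (Yh p)
    k<N : k < N
    k<N = <⇒≤ k≤N
    τk<τsk : τ k < τ (suc k)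
    τk<τsk = subst₂ _<_ (sym τk) (sym τsk) (subst (_≤ suc k + m₁) (+-suc k (suc m₂)) (≤-trans (ℕₚ.+-monoʳ-≤ k (s≤s m≤m)) (≤-reflexive (+-suc k m₁))))
    lo<hi : ∀ {i c} → i < k → suc (suc k) ≤ c → c < N → τ i < τ c
    lo<hi {i} {c} i<k p c<N with i <? τ c
    ... | yes q = subst (_< τ c) (sym (τlo i i<k)) q
    ... | no q  = ⊥-elim (<⇒≢ (<-≤-trans τc<k (<⇒≤ (<⇒≤ p))) (inj P (<-trans τc<k k<N) c<N (τlo (τ c) τc<k)))
      where τc<k : τ c < k
            τc<k = ≤-<-trans (≮⇒≥ q) i<k
    dscZ : ∀ {a c} → a < c → c < 2 → Z c < Z a
    dscZ {zero}  {suc zero} _ _ = subst₂ _<_ (sym Z1) (sym Z0) τk<τsk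
    dscZ {zero}  {suc (suc c)} _ (s≤s (s≤s ()))
    dscZ {suc a} {suc zero} (s≤s ()) _
    dscZ {suc a} {suc (suc c)} _ (s≤s (s≤s ()))
    ascZ : ∀ {a c} → 2 ≤ a → a < c → c < N → Z a < Z c
    ascZ {suc (suc a)} {suc (suc c)} _ (s≤s (s≤s a<c)) c<N with a <? k | c <? k
    ... | yes p | yes q = subst₂ _<_ (sym (trans (Zs p) (τlo a p))) (sym (trans (Zs q) (τlo c q))) a<c
    ... | yes p | no q  = subst₂ _<_ (sym (Zs p)) (sym (Zh (s≤s (s≤s (≮⇒≥ q))))) (lo<hi p (s≤s (s≤s (≮⇒≥ q))) c<N)
    ... | no p  | yes q = ⊥-elim (p (<-trans a<c q))
    ... | no p  | no q  = subst₂ _<_ (sym (Zh (s≤s (s≤s (≮⇒≥ p))))) (sym (Zh (s≤s (s≤s (≮⇒≥ q))))) (asc (s≤s (s≤s (≮⇒≥ p))) (s≤s (s≤s a<c)) c<N)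
    ascZ {suc zero} (s≤s ()) _ _
    ascZ {suc (suc a)} {suc zero} _ (s≤s ()) _
    e₀ e₁ e₂ : Exp
    e₀ _ = 0
    e₁ = incn 0 (suc k + m₁) e₀
    e₂ = incn 1 (k + suc m₂) e₁
    e₂< : ∀ j → j < 2 → e₂ j ≡ Z j
    e₂< zero       _ = trans (incn-other 1 (k + suc m₂) e₁ λ ()) (trans (incn-same 0 (suc k + m₁) e₀) (trans (k+0 _) (sym (trans Z0 τsk))))
    e₂< (suc zero) _ = trans (incn-same 1 (k + suc m₂) e₁) (trans (cong (λ z → k + suc m₂ + z) (incn-other 0 (suc k + m₁) e₀ λ ())) (trans (k+0 _) (sym (trans Z1 τk))))
    e₂< (suc (suc j)) (s≤s (s≤s ()))
    e₂≥ : ∀ j → 2 ≤ j → e₂ j ≡ 0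
    e₂≥ (suc (suc j)) _ = trans (incn-other 1 (k + suc m₂) e₁ λ ()) (incn-other 0 (suc k + m₁) e₀ λ ())
    e₂≥ (suc zero) (s≤s ())
    φ₀ φ₁ φ : Point
    φ₀ = evalAt e₂
    φ₁ = chainᴾ φ₀ 1 k
    φ  = chainᴾ φ₁ 0 (suc k)
    2≤N : 2 ≤ N
    2≤N = ≤-trans (s≤s (s≤s z≤n)) k≤N
    schZ : Sch Z φ₀
    schZ = Dom 2 2≤N PZ dscZ ascZ e₂ e₂< e₂≥
    τlo< : ∀ {i} → i < k → τ i < τ k
    τlo< {i} p = subst₂ _<_ (sym (τlo i p)) (sym τk) (<-≤-trans p (m≤m+n k _))
    sch₁ : Sch (schain Z 1 k) φ₁
    sch₁ = Sch-chain φ₀ 1 k k1<N (λ { (suc zero) (s≤s ()) _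
                                    ; (suc (suc i)) _ q → subst₂ _<_ (sym (Zs (≤-pred (subst (suc (suc i) ≤_) k+1 q)))) (sym Z1) (τlo< (≤-pred (subst (suc (suc i) ≤_) k+1 q))) }) schZ
    schφ : Sch (schain (schain Z 1 k) 0 (suc k)) φ
    schφ = Sch-chain φ₁ 0 (suc k) sk<N top sch₁
      where
      top : ∀ i → 0 < i → i ≤ suc k + 0 → schain Z 1 k i < schain Z 1 k 0
      top (suc i) _ q = subst₂ _<_ (sym (trans (schain-rchain Y 1 k (suc i)) (Ys i<sk))) (sym (trans (schain-rchain Y 1 k 0) Y0)) (le i<sk)
        where
        i<sk : i < suc k
        i<sk = subst (suc i ≤_) (k+0 (suc k)) q
        le : ∀ {i} → i < suc k → τ i < τ (suc k)
        le (s≤s p) with m≤n⇒m<n∨m≡n p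
        ... | inj₁ r    = <-trans (τlo< r) τk<τsk
        ... | inj₂ refl = τk<τsk
    sc : schain (schain Z 1 k) 0 (suc k) ≗ τ
    sc i = trans (schain-cong (schain-rchain Y 1 k) 0 (suc k) i) (schain-rchain τ 0 (suc k) i)
      where
      schain-cong : ∀ {V W : ℕ → ℕ} → V ≗ W → ∀ c d → schain V c d ≗ schain W c d
      schain-cong e c zero    i = e i
      schain-cong e c (suc d) i = schain-cong e c d (s (d + c) i)
    K = suc (suc k)
    val : ∀ L → ap φ L ≡ jt K m₁ m₂ L
    val L = begin
      ap φ L                                     ≡⟨ ap-chainᴾ φ₁ 0 (suc k) L ⟩
      ap φ₁ L′                                   ≡⟨ ap-chainᴾ φ₀ 1 k L′ ⟩
      at (Dchain 1 k L′) (incn 1 (k + suc m₂) e₁) ≡⟨ Dchain-at 1 k (suc m₂) L′ e₁ (λ { (suc i) _ _ → incn-other 0 (suc k + m₁) e₀ (λ ()) ; zero () _ }) ⟩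
      -- Passing from the variables x_1, ... to x_0, x_1, ... costs a term with a factor x_0. This
      -- factor raises the exponent of x_0 for the other chain by one, which produces the second
      -- product of the determinant.
      at (H 1 (suc k) (suc m₂) L′) e₁            ≡⟨ un (⊕-solveʳ (H-first 0 (suc k) m₂ L′)) e₁ ⟩
      at (H 0 K (suc m₂) L′ ⊕ ⊖ X 0 (H 0 K m₂ L′)) e₁ ≡⟨ trans (at-⊕ _ _ e₁) (cong (λ z → at (H 0 K (suc m₂) L′) e₁ ℤ.+ z) (trans (at-⊖ _ e₁) (cong ℤ.-_ (at-X 0 _ e₁)))) ⟩
      at (H 0 K (suc m₂) L′) e₁ ℤ.- at (H 0 K m₂ L′) (inc 0 e₁)
        ≡⟨ cong₂ ℤ._-_ (trans (un (H-Dchain 0 K (suc m₂) 0 (suc k) L z≤n lt) e₁) (Dchain-at 0 (suc k) m₁ _ e₀ (λ _ _ _ → refl)))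
                       (trans (un (H-Dchain 0 K m₂ 0 (suc k) L z≤n lt) (inc 0 e₁)) (trans (ext (Dchain 0 (suc k) _) e₃) (Dchain-at 0 (suc k) (suc m₁) _ e₀ (λ _ _ _ → refl)))) ⟩
      jt K m₁ m₂ L ∎
      where
      open ≡-Reasoning
      L′ = Dchain 0 (suc k) L
      lt : suc k + 0 < K + 0
      lt = ≤-refl
      e₃ : inc 0 e₁ ≗ incn 0 (suc k + suc m₁) e₀
      e₃ i = trans (shift (suc k + m₁) e₀ i) (cong (λ z → incn 0 z e₀ i) (sym (+-suc (suc k) m₁)))
        where
        shift : ∀ n e → inc 0 (incn 0 n e) ≗ incn 0 (suc n) e
        shift zero    e i = refl
        shift (suc n) e i = shift n (inc 0 e) i

-- Pieri chains

module Runs (N k : ℕ) where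
  open Schubert N

  Desc : ℕ → (ℕ → ℕ) → Set
  Desc b W = ∀ {a c} → b ≤ a → a < c → c < N → W c < W a

  Desc-suc : ∀ {b W} → Desc b W → Desc (suc b) W
  Desc-suc d p = d (<⇒≤ p)

  tr-hi : ∀ {W : ℕ → ℕ} {l b c} → l < b → b < c → (W ∘ tr l b) c ≡ W c
  tr-hi {W} {l} {b} p q = cong W (tr-o l b (>⇒≢ (<-trans p q)) (>⇒≢ q))

  Desc-tr : ∀ {b l W} → l < b → Desc b W → Desc (suc b) (W ∘ tr l b)
  Desc-tr {W = W} l<b d p q r = subst₂ _<_ (sym (tr-hi {W} l<b (<-trans p q))) (sym (tr-hi {W} l<b p)) (d (<⇒≤ p) q r)

  -- The terms of h_m(x_0,…,x_{k-1}) 𝔖_W, generated by applying `column` to positions b, b+1, ….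
  data PRun : ℕ → (ℕ → ℕ) → (ℕ → ℕ) → Set where
    stop : ∀ {b W} → PRun b W W
    skip : ∀ {b W u} → b < N → PRun (suc b) W u → PRun b W u
    swap : ∀ {b W u} l → b < N → l < b → UCov W l b → PRun (suc b) (W ∘ tr l b) u → PRun b W u

  PRun-Perm : ∀ {b W u} → PRun b W u → Perm W → Perm u
  PRun-Perm stop P = P
  PRun-Perm (skip _ r) P = PRun-Perm r P
  PRun-Perm (swap l b<N l<b _ r) P = PRun-Perm r (Perm-up l<b b<N P)

  -- Each exchange involves a label below γ and an entry smaller than that label.
  PRun-big : ∀ {b W u γ} → PRun b W u → Desc b W → (∀ c → b ≤ c → c < N → W c < γ) →
    ∀ s → s < N → γ ≤ W s → u s ≡ W s
  PRun-big stop d h s _ p = refl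
  PRun-big (skip _ r) d h s s<N p = PRun-big r (Desc-suc d) (λ c q → h c (<⇒≤ q)) s s<N p
  PRun-big {b} {W} {u} {γ} (swap l b<N l<b uc r) d h s s<N p =
    trans (PRun-big r (Desc-tr l<b d) (λ c q c<N → subst (_< γ) (sym (tr-hi {W} l<b q)) (h c (<⇒≤ q) c<N)) s s<N (subst (γ ≤_) (sym e) p)) e
    where
    e : (W ∘ tr l b) s ≡ W s
    e = cong W (tr-o l b (λ { refl → ≤⇒≯ p (<-trans (proj₁ uc) (h b ≤-refl b<N)) }) (λ { refl → ≤⇒≯ p (h b ≤-refl b<N) }))

  PRun-small : ∀ {b W u γ} → PRun b W u → Desc b W → (∀ c → b ≤ c → c < N → W c < γ) →
    ∀ s → s < N → W s < γ → u s < γ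
  PRun-small stop d h s _ p = p
  PRun-small (skip _ r) d h s s<N p = PRun-small r (Desc-suc d) (λ c q → h c (<⇒≤ q)) s s<N p
  PRun-small {b} {W} {u} {γ} (swap l b<N l<b uc r) d h s s<N p =
    PRun-small r (Desc-tr l<b d) (λ c q c<N → subst (_< γ) (sym (tr-hi {W} l<b q)) (h c (<⇒≤ q) c<N)) s s<N new
    where
    new : W (tr l b s) < γ
    new with s ≟ l | s ≟ b
    ... | yes refl | _        = subst (λ z → W z < γ) (sym (tr-l l b)) (h b ≤-refl b<N)
    ... | no _     | yes refl = subst (λ z → W z < γ) (sym (tr-r l b)) (<-trans (proj₁ uc) (h b ≤-refl b<N))
    ... | no x     | no y     = subst (λ z → W z < γ) (sym (tr-o l b x y)) p

  PRun-≤ : ∀ {b W u} → PRun b W u → ∀ s → s < b → W s ≤ u s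
  PRun-≤ stop s p = ≤-refl
  PRun-≤ (skip _ r) s p = PRun-≤ r s (m<n⇒m<1+n p)
  PRun-≤ {b} {W} {u} (swap l b<N l<b uc r) s p = ≤-trans new (PRun-≤ r s (m<n⇒m<1+n p))
    where
    new : W s ≤ W (tr l b s)
    new with s ≟ l
    ... | yes refl = subst (λ z → W s ≤ W z) (sym (tr-l l b)) (<⇒≤ (proj₁ uc))
    ... | no x     = ≤-reflexive (cong W (sym (tr-o l b x (<⇒≢ p))))

  -- An exchange at l′ with a label above x would not be a cover: x stays between l′ and the label.
  PRun-block : ∀ {b W u} → PRun b W u → Perm W → ∀ {l′ c x} → l′ < c → c < b → c < N → W c ≡ x → W l′ < x → u l′ < x
  PRun-block stop P a d c<N e lt = lt
  PRun-block (skip _ r) P a d c<N e lt = PRun-block r P a (m<n⇒m<1+n d) c<N e lt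
  PRun-block {b} {W} {u} (swap l b<N l<b uc r) P {l′} {c} {x} l′<c c<b c<N e lt with l ≟ l′ | l ≟ c
  ... | yes refl | _ = PRun-block r P′ l′<c (m<n⇒m<1+n c<b) c<N (trans (cong W (tr-o l b (>⇒≢ l′<c) (<⇒≢ c<b))) e)
        (subst (_< x) (cong W (sym (tr-l l b))) (≤∧≢⇒< (≮⇒≥ λ q → proj₂ uc c l′<c c<b (subst (W l <_) (sym e) lt , subst (_< W b) (sym e) q))
           (λ q → <⇒≢ c<b (inj P c<N b<N (trans e (sym q))))))
    where P′ = Perm-up l<b b<N P
  ... | no n | yes refl = PRun-block r P′ (<-trans l′<c c<b) ≤-refl b<N (trans (cong W (tr-r l b)) e)
        (subst (_< x) (cong W (sym (tr-o l b (n ∘ sym) (<⇒≢ (<-trans l′<c c<b))))) lt)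
    where P′ = Perm-up l<b b<N P
  ... | no n | no n′ = PRun-block r P′ l′<c (m<n⇒m<1+n c<b) c<N (trans (cong W (tr-o l b (n′ ∘ sym) (<⇒≢ c<b))) e)
        (subst (_< x) (cong W (sym (tr-o l b (n ∘ sym) (<⇒≢ (<-trans l′<c c<b))))) lt)
    where P′ = Perm-up l<b b<N P

  -- The same process indexed by values: label β at an active position b ∈ A is exchanged with a
  -- smaller entry at an inactive position l, after which b is inactive.
  data Run : ℕ → (ℕ → Set) → (ℕ → ℕ) → (ℕ → ℕ) → Set₁ where
    done : ∀ {A z V} → z ≐ V → Run 0 A z V
    skip : ∀ {β A z V} → Run β A z V → Run (suc β) A z V
    swap : ∀ {β A z V} l b → l < N → b < N → A b → ¬ A l → z b ≡ β → z l < β →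
      Run β (λ s → A s × s ≢ b) (z ∘ tr l b) V → Run (suc β) A z V

  Run-≐ : ∀ β {A z V} → z ≐ V → Run β A z V
  Run-≐ zero    e = done e
  Run-≐ (suc β) e = skip (Run-≐ β e)

  Run-up : ∀ {β β′ A z V} → β ≤ β′ → Run β A z V → Run β′ A z V
  Run-up {β} {β′} p r with m≤n⇒m<n∨m≡n p
  ... | inj₂ refl = r
  Run-up {β} {suc β′} p r | inj₁ (s≤s q) = skip (Run-up q r)

  Run-resp : ∀ {β A A′ z z′ V V′} → (∀ s → s < N → A s → A′ s) → (∀ s → s < N → A′ s → A s) →
    z ≐ z′ → V ≐ V′ → Run β A z V → Run β A′ z′ V′
  Run-resp f g e e′ (done h) = done (≐-trans (≐-sym e) (≐-trans h e′))
  Run-resp f g e e′ (skip r) = skip (Run-resp f g e e′ r)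
  Run-resp f g e e′ (swap l b l<N b<N Ab ¬Al zb zl r) =
    swap l b l<N b<N (f b b<N Ab) (¬Al ∘ g l l<N) (trans (sym (e b b<N)) zb) (subst (_< _) (e l l<N) zl)
      (Run-resp (λ s p (a , q) → f s p a , q) (λ s p (a , q) → g s p a , q) (≐-tr l b l<N b<N e) e′ r)

  -- Labels are values, so renaming positions does not disturb their order. This is what `PRun`
  -- lacks, whose covers depend on the order of positions, and it lets runs be carried back to
  -- permutations that are not sorted behind k.
  Run-s : ∀ {β A z V} j → suc j < N → Run β A z V → Run β (A ∘ s j) (z ∘ s j) (V ∘ s j)
  Run-s j p (done e) = done (≐-s j p e)
  Run-s j p (skip r) = skip (Run-s j p r)
  Run-s {A = A} {z} j p (swap l b l<N b<N Ab ¬Al zb zl r) =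
    swap (s j l) (s j b) (s-< j p l<N) (s-< j p b<N) (subst A (sym (s-inv j b)) Ab) (¬Al ∘ subst A (s-inv j l))
      (trans (cong z (s-inv j b)) zb) (subst (λ x → z x < _) (sym (s-inv j l)) zl)
      (Run-resp (λ x _ (a , q) → a , λ e → q (trans (cong (s j) e) (s-inv j b)))
                (λ x _ (a , q) → a , λ e → q (trans (sym (s-inv j x)) (cong (s j) e)))
                (λ x _ → cong z (sym (trans (tr-conj (s j) (s-injective j) (s j l) (s j b) x) (cong₂ (λ a c → tr a c (s j x)) (s-inv j l) (s-inv j b)))))
                ≐-refl (Run-s j p r))

  -- As W decreases from b on, visiting positions from left to right means visiting labels from
  -- large to small. An active position to the left of b holds an entry above all remaining labels,
  -- so it is never chosen as a partner.
  PRun⇒Run : ∀ {b W u V} → PRun b W u → u ≐ V → Desc b W → ∀ β (A : ℕ → Set) → (∀ c → b ≤ c → c < N → W c < β) →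
    (∀ s → b ≤ s → s < N → A s) → (∀ s → s < b → A s → ∀ c → b ≤ c → c < N → W c < W s) → Run β A W V
  PRun⇒Run stop e d β A h A₁ A₂ = Run-≐ β e
  PRun⇒Run {b} (skip _ r) e d β A h A₁ A₂ = PRun⇒Run r e (Desc-suc d) β A (λ c p → h c (<⇒≤ p)) (λ s p → A₁ s (<⇒≤ p)) A₂′
    where
    A₂′ : ∀ s → s < suc b → A s → ∀ c → suc b ≤ c → c < N → _ < _
    A₂′ s (s≤s p) a c q c<N with m≤n⇒m<n∨m≡n p
    ... | inj₁ s<b  = A₂ s s<b a c (<⇒≤ q) c<N
    ... | inj₂ refl = d ≤-refl q c<N
  PRun⇒Run {b} {W} (swap l b<N l<b uc r) e d β A h A₁ A₂ =
    Run-up (h b ≤-refl b<N) (swap l b (<-trans l<b b<N) b<N (A₁ b ≤-refl b<N) ¬Al refl (proj₁ uc)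
      (PRun⇒Run r e (Desc-tr l<b d) (W b) (λ s → A s × s ≢ b)
        (λ c p c<N → subst (_< W b) (sym (tr-hi {W} l<b p)) (d ≤-refl p c<N))
        (λ s p s<N → A₁ s (<⇒≤ p) s<N , >⇒≢ p) A₂′))
    where
    ¬Al : ¬ A l
    ¬Al a = <-asym (proj₁ uc) (A₂ l l<b a b ≤-refl b<N)
    A₂′ : ∀ s → s < suc b → A s × s ≢ b → ∀ c → suc b ≤ c → c < N → W (tr l b c) < W (tr l b s)
    A₂′ s (s≤s p) (a , s≢b) c q c<N = subst₂ _<_ (sym (tr-hi {W} l<b q)) (cong W (sym (tr-o l b (λ { refl → ¬Al a }) s≢b)))
      (A₂ s (≤∧≢⇒< p s≢b) a c (<⇒≤ q) c<N)

  Run-big : ∀ {β A z V} → Run β A z V → ∀ s → s < N → β ≤ z s → V s ≡ z s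
  Run-big (done e) s s<N p = sym (e s s<N)
  Run-big (skip r) s s<N p = Run-big r s s<N (<⇒≤ p)
  Run-big {z = z} (swap l b l<N b<N _ _ zb zl r) s s<N p = trans (Run-big r s s<N (subst (_ ≤_) (sym e) (<⇒≤ p))) e
    where
    e : z (tr l b s) ≡ z s
    e = cong z (tr-o l b (λ { refl → <-asym p zl }) (λ { refl → <⇒≢ p (sym zb) }))

  Run-small : ∀ {β A z V} → Inj N z → Run β A z V → ∀ s → s < N → z s < β → V s < β
  Run-small i (skip r) s s<N (s≤s p) with m≤n⇒m<n∨m≡n p
  ... | inj₁ q = m<n⇒m<1+n (Run-small i r s s<N q)
  ... | inj₂ q = s≤s (≤-reflexive (trans (Run-big r s s<N (≤-reflexive (sym q))) q))
  Run-small {suc β} {z = z} {V} i (swap l b l<N b<N _ _ zb zl r) s s<N (s≤s p) with s ≟ l | s ≟ b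
  ... | yes refl | _ = s≤s (≤-reflexive (trans (Run-big r s s<N (≤-reflexive (sym e))) e))
    where e : z (tr l b l) ≡ β
          e = trans (cong z (tr-l l b)) zb
  ... | no _ | yes refl = m<n⇒m<1+n (Run-small (Inj-tr l<N b<N i) r s s<N (subst (_< β) (cong z (sym (tr-r l b))) zl))
  ... | no x | no y = m<n⇒m<1+n (Run-small (Inj-tr l<N b<N i) r s s<N (subst (_< β) (cong z (sym (tr-o l b x y)))
                        (≤∧≢⇒< p (λ q → y (i s<N b<N (trans q (sym zb)))))))

  Run-inactive : ∀ {β A z V} → Run β A z V → ∀ s → s < N → ¬ A s → z s ≤ V s
  Run-inactive (done e) s s<N n = ≤-reflexive (e s s<N)
  Run-inactive (skip r) s s<N n = Run-inactive r s s<N n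
  Run-inactive {A = A} {z} {V} (swap l b l<N b<N Ab _ zb zl r) s s<N n with s ≟ l
  ... | yes refl = <⇒≤ (<-≤-trans (subst (z l <_) (sym (trans (cong z (tr-l l b)) zb)) zl) (Run-inactive r s s<N (n ∘ proj₁)))
  ... | no x     = subst (_≤ V s) (cong z (tr-o l b x (λ { refl → n Ab }))) (Run-inactive r s s<N (n ∘ proj₁))

  Run-active : ∀ {β A z V} → Inj N z → Run β A z V → ∀ s → s < N → A s → V s ≤ z s
  Run-active i (done e) s s<N a = ≤-reflexive (sym (e s s<N))
  Run-active i (skip r) s s<N a = Run-active i r s s<N a
  Run-active {A = A} {z} {V} i (swap l b l<N b<N _ ¬Al zb zl r) s s<N a with s ≟ b
  ... | yes refl = <⇒≤ (subst (V s <_) (sym zb) (Run-small (Inj-tr l<N b<N i) r s s<N (subst (_< _) (cong z (sym (tr-r l b))) zl)))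
  ... | no x     = subst (V s ≤_) (cong z (tr-o l b (λ { refl → ¬Al a }) x)) (Run-active (Inj-tr l<N b<N i) r s s<N (a , x))

  -- Two runs ending in V from states that agree above γ perform the same exchanges
  -- for all labels above γ; this compares where they put γ.
  parallel : ∀ {γ β A z z′ V} → Inj N z → Inj N z′ → Inj N V → Run β A z V → Run β A z′ V → γ < β →
    (∀ s → s < N → γ < z s → z′ s ≡ z s) → (∀ s → s < N → γ < z′ s → z s ≡ z′ s) →
    ∀ a a′ → a < N → a′ < N → z a ≡ γ → z′ a′ ≡ γ → ¬ A a′ →
    (A a → V a ≡ γ ⊎ z a′ ≤ V a) × (¬ A a → a ≡ a′)
  parallel {γ} i i′ iV (skip r) (skip r′) (s≤s p) f g a a′ a<N a′<N za za′ n with m≤n⇒m<n∨m≡n p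
  ... | inj₁ q    = parallel i i′ iV r r′ q f g a a′ a<N a′<N za za′ n
  ... | inj₂ refl = (λ _ → inj₁ Va) , (λ _ → iV a<N a′<N (trans Va (sym Va′)))
    where
    Va  = trans (Run-big r a a<N (≤-reflexive (sym za))) za
    Va′ = trans (Run-big r′ a′ a′<N (≤-reflexive (sym za′))) za′
  parallel {γ} {A = A} {z} {z′} {V} i i′ iV (swap {β} l b l<N b<N Ab ¬Al zb zl r) (skip r′) (s≤s p) f g a a′ a<N a′<N za za′ n
    with m≤n⇒m<n∨m≡n p
  -- If only one run exchanges β, then V takes the value β both at the inactive l and at the active
  -- b.
  ... | inj₁ q = ⊥-elim (¬Al (subst A (sym l≡b) Ab))
    where
    z′b : z′ b ≡ β
    z′b = trans (f b b<N (subst (γ <_) (sym zb) q)) zb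
    Vl : V l ≡ β
    Vl = trans (Run-big r l l<N (≤-reflexive (sym (trans (cong z (tr-l l b)) zb)))) (trans (cong z (tr-l l b)) zb)
    l≡b : l ≡ b
    l≡b = iV l<N b<N (trans Vl (sym (trans (Run-big r′ b b<N (≤-reflexive (sym z′b))) z′b)))
  -- Here the label is γ itself. Its target l is its place in V, which the other run shows to be a′;
  -- position a receives the entry of z at a′ and, being inactive from now on, can only increase.
  ... | inj₂ refl = (λ _ → inj₂ le) , (λ na → ⊥-elim (na (subst A b≡a Ab)))
    where
    b≡a : b ≡ a
    b≡a = i b<N a<N (trans zb (sym za))
    Vl : V l ≡ β
    Vl = trans (Run-big r l l<N (≤-reflexive (sym (trans (cong z (tr-l l b)) zb)))) (trans (cong z (tr-l l b)) zb)
    l≡a′ : l ≡ a′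
    l≡a′ = iV l<N a′<N (trans Vl (sym (trans (Run-big r′ a′ a′<N (≤-reflexive (sym za′))) za′)))
    le : z a′ ≤ V a
    le = subst₂ (λ x y → z x ≤ V y) l≡a′ b≡a (subst (_≤ V b) (cong z (tr-r l b)) (Run-inactive r b b<N (λ q → proj₂ q refl)))
  parallel {γ} {A = A} {z} {z′} {V} i i′ iV (skip r) (swap {β} l b l<N b<N Ab ¬Al zb zl r′) (s≤s p) f g a a′ a<N a′<N za za′ n
    with m≤n⇒m<n∨m≡n p
  ... | inj₁ q = ⊥-elim (¬Al (subst A (sym l≡b) Ab))
    where
    zb′ : z b ≡ β
    zb′ = trans (g b b<N (subst (γ <_) (sym zb) q)) zb
    Vl : V l ≡ β
    Vl = trans (Run-big r′ l l<N (≤-reflexive (sym (trans (cong z′ (tr-l l b)) zb)))) (trans (cong z′ (tr-l l b)) zb)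
    l≡b : l ≡ b
    l≡b = iV l<N b<N (trans Vl (sym (trans (Run-big r b b<N (≤-reflexive (sym zb′))) zb′)))
  ... | inj₂ refl = ⊥-elim (n (subst A (i′ b<N a′<N (trans zb (sym za′))) Ab))
  parallel {γ} {A = A} {z} {z′} {V} i i′ iV (swap {β} l b l<N b<N Ab ¬Al zb zl r) (swap l₂ b₂ l₂<N b₂<N Ab₂ ¬Al₂ zb₂ zl₂ r′) (s≤s p) f g a a′ a<N a′<N za za′ n
    with m≤n⇒m<n∨m≡n p
  ... | inj₂ refl = ⊥-elim (n (subst A (i′ b₂<N a′<N (trans zb₂ (sym za′))) Ab₂))
  -- Both runs exchange β. Its position agrees by assumption and its target is the place of β in V,
  -- so the same transposition is applied to both.
  ... | inj₁ q with i′ b<N b₂<N (trans (trans (f b b<N (subst (γ <_) (sym zb) q)) zb) (sym zb₂))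
  ...   | refl with iV l<N l₂<N (trans (trans (Run-big r l l<N (≤-reflexive (sym (trans (cong z (tr-l l b)) zb)))) (trans (cong z (tr-l l b)) zb))
                        (sym (trans (Run-big r′ l₂ l₂<N (≤-reflexive (sym (trans (cong z′ (tr-l l₂ b)) zb₂)))) (trans (cong z′ (tr-l l₂ b)) zb₂))))
  ...     | refl = act , λ na → tr-injective l b (proj₂ ih (λ q′ → inact na q′))
    where
    t : ℕ → ℕ
    t = tr l b
    A′ : ℕ → Set
    A′ s = A s × s ≢ b
    inact : ∀ {x} → ¬ A x → ¬ A′ (t x)
    inact {x} nx (q′ , q″) with x ≟ l | x ≟ b
    ... | yes refl | _        = q″ (tr-l l b)
    ... | no _     | yes refl = nx Ab
    ... | no u     | no v     = nx (subst A (tr-o l b u v) q′)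
    ih = parallel (Inj-tr l<N b<N i) (Inj-tr l<N b<N i′) iV r r′ q
           (λ s s<N → f (t s) (tr-< l<N b<N s<N)) (λ s s<N → g (t s) (tr-< l<N b<N s<N))
           (t a) (t a′) (tr-< l<N b<N a<N) (tr-< l<N b<N a′<N)
           (trans (cong z (tr-inv l b a)) za) (trans (cong z′ (tr-inv l b a′)) za′) (inact n)
    act : A a → V a ≡ γ ⊎ z a′ ≤ V a
    act Aa = subst₂ (λ x y → V x ≡ γ ⊎ z y ≤ V x) ta (tr-inv l b a′) (proj₁ ih (subst A (sym ta) Aa , λ e → a≢b (trans (sym ta) e)))
      where
      a≢b : a ≢ b
      a≢b refl = <⇒≢ q (trans (sym za) zb)
      ta : t a ≡ a
      ta = tr-o l b (λ { refl → ¬Al Aa }) a≢b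

  -- Used positions s < t whose entries are below a remaining label carry increasing entries.
  Inv : ℕ → (ℕ → ℕ) → Set
  Inv b W = ∀ {s t c} → k ≤ s → s < t → t < b → b ≤ c → c < N → W s < W c → W t < W c → W s < W t

  -- A skipped position keeps an entry above all remaining labels, so the condition says nothing
  -- about it.
  Inv-suc : ∀ {b W} → Desc b W → Inv b W → Inv (suc b) W
  Inv-suc d I {s} {t} k≤s s<t (s≤s t≤b) b<c c<N p q with m≤n⇒m<n∨m≡n t≤b
  ... | inj₁ t<b  = I k≤s s<t t<b (<⇒≤ b<c) c<N p q
  ... | inj₂ refl = ⊥-elim (<-asym q (d ≤-refl b<c c<N))

  -- Position l now exceeds all remaining labels, so only the new entry `W l` at b matters. It
  -- exceeds a relevant entry at s < b: by the old invariant if s < l, and because l was a cover if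
  -- l < s.
  Inv-tr : ∀ {b l W} → Perm W → b < N → l < b → UCov W l b → Desc b W → Inv b W → Inv (suc b) (W ∘ tr l b)
  Inv-tr {b} {l} {W} P b<N l<b uc d I {s} {t} {c} k≤s s<t (s≤s t≤b) b<c c<N p q
    with subst (W (tr l b s) <_) (tr-hi {W} l<b b<c) p | subst (W (tr l b t) <_) (tr-hi {W} l<b b<c) q
  ... | p′ | q′ with s ≟ l | m≤n⇒m<n∨m≡n t≤b
  ... | yes refl | _ = ⊥-elim (<-asym (subst (λ z → W z < W c) (tr-l l b) p′) (d ≤-refl b<c c<N))
  ... | no s≢l | inj₂ refl = subst₂ (λ x y → W x < W y) (sym (tr-o l b s≢l (<⇒≢ s<t))) (sym (tr-r l b)) Ws<Wl
    where
    Ws<Wb : W s < W b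
    Ws<Wb = <-trans (subst (λ z → W z < W c) (tr-o l b s≢l (<⇒≢ s<t)) p′) (d ≤-refl b<c c<N)
    Ws<Wl : W s < W l
    Ws<Wl with <-cmp s l
    ... | tri< s<l _ _ = I k≤s s<l l<b ≤-refl b<N Ws<Wb (proj₁ uc)
    ... | tri≈ _ e _   = ⊥-elim (s≢l e)
    ... | tri> _ _ l<s = ≤∧≢⇒< (≮⇒≥ λ x → proj₂ uc s l<s s<t (x , Ws<Wb)) (λ e → s≢l (inj P (<-trans s<t b<N) (<-trans l<b b<N) e))
  ... | no s≢l | inj₁ t<b with t ≟ l
  ...   | yes refl = ⊥-elim (<-asym (subst (λ z → W z < W c) (tr-l l b) q′) (d ≤-refl b<c c<N))
  ...   | no t≢l = subst₂ (λ x y → W x < W y) (sym es) (sym et)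
            (I k≤s s<t t<b (<⇒≤ b<c) c<N (subst (λ z → W z < W c) es p′) (subst (λ z → W z < W c) et q′))
    where es = tr-o l b s≢l (<⇒≢ (<-trans s<t t<b))
          et = tr-o l b t≢l (<⇒≢ t<b)

  -- Hence the permutations between W and V are determined by the set of positions that are used.
  unique-l : ∀ {b W V u u′ l l′} → Perm W → Inj N V → b < N → Desc b W → Inv b W →
    l < b → l′ < b → UCov W l b → UCov W l′ b →
    PRun (suc b) (W ∘ tr l b) u → PRun (suc b) (W ∘ tr l′ b) u′ →
    Run N (k ≤_) u V → Run N (k ≤_) u′ V → l ≡ l′
  unique-l {b} {W} {V} {u} {u′} {l} {l′} P iV b<N d I l<b l′<b uc uc′ r r′ R R′ = rest (k ≤? l) (k ≤? l′)
    where
    γ = W b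
    labels : ∀ {l} → l < b → ∀ c → suc b ≤ c → c < N → W (tr l b c) < γ
    labels l<b c q c<N = subst (_< γ) (sym (tr-hi {W} l<b q)) (d ≤-refl q c<N)
    top : ∀ {l u} → l < b → PRun (suc b) (W ∘ tr l b) u → u l ≡ γ
    top {l} l<b r = trans (PRun-big r (Desc-tr l<b d) (labels l<b) l (<-trans l<b b<N) (≤-reflexive (cong W (sym (tr-l l b))))) (cong W (tr-l l b))
    above : ∀ {l u} → l < b → UCov W l b → PRun (suc b) (W ∘ tr l b) u → ∀ s → s < N → γ < u s → γ < W s × u s ≡ W s
    above {l} {u} l<b uc r s s<N lt = subst (γ <_) e lt , e
      where
      big : γ ≤ W (tr l b s)
      big = ≮⇒≥ λ q → <-asym lt (PRun-small r (Desc-tr l<b d) (labels l<b) s s<N q)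
      us : u s ≡ W (tr l b s)
      us = PRun-big r (Desc-tr l<b d) (labels l<b) s s<N big
      e : u s ≡ W s
      e = trans us (cong W (tr-o l b (λ { refl → <⇒≢ lt (sym (trans us (cong W (tr-l s b)))) })
                                     (λ { refl → <-asym (proj₁ uc) (subst (W b <_) (trans us (cong W (tr-r l s))) lt) })))
    below : ∀ {l u} → l < b → UCov W l b → PRun (suc b) (W ∘ tr l b) u → ∀ s → s < N → γ < W s → u s ≡ W s
    below {l} l<b uc r s s<N lt = trans (PRun-big r (Desc-tr l<b d) (labels l<b) s s<N (subst (γ ≤_) (sym e) (<⇒≤ lt))) e
      where e : W (tr l b s) ≡ W s
            e = cong W (tr-o l b (λ { refl → <-asym (proj₁ uc) lt }) (λ { refl → <-irrefl refl lt }))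
    agree : ∀ {l l′ u u′} → l < b → l′ < b → UCov W l b → UCov W l′ b → PRun (suc b) (W ∘ tr l b) u → PRun (suc b) (W ∘ tr l′ b) u′ →
      ∀ s → s < N → γ < u s → u′ s ≡ u s
    agree l<b l′<b uc uc′ r r′ s s<N lt with above l<b uc r s s<N lt
    ... | lt′ , e = trans (below l′<b uc′ r′ s s<N lt′) (sym e)
    injOf : ∀ {l u} → l < b → PRun (suc b) (W ∘ tr l b) u → Inj N u
    injOf {l} l<b r = inj (PRun-Perm r (Perm-up l<b b<N P))
    -- The cover at l forces `W l′ < W l`, and `PRun-block` with `Run-active` keeps the entry of V
    -- at l′ below `W l`. But `parallel` says that this entry is γ, which exceeds `W l`, or at least
    -- `u′ l`, which is at least `W l`.
    mixed : ∀ {l l′ u u′} → l < b → l′ < b → UCov W l b → UCov W l′ b → PRun (suc b) (W ∘ tr l b) u → PRun (suc b) (W ∘ tr l′ b) u′ →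
      Run N (k ≤_) u V → Run N (k ≤_) u′ V → ¬ (k ≤ l) → k ≤ l′ → ⊥
    mixed {l} {l′} {u} {u′} l<b l′<b uc uc′ r r′ R R′ k≰l k≤l′ = contra (proj₁ (parallel (injOf l′<b r′) (injOf l<b r) iV R′ R (bnd P b<N)
        (agree l′<b l<b uc′ uc r′ r) (agree l<b l′<b uc uc′ r r′) l′ l (<-trans l′<b b<N) (<-trans l<b b<N) (top l′<b r′) (top l<b r) k≰l) k≤l′)
      where
      l<l′ : l < l′
      l<l′ = <-≤-trans (≰⇒> k≰l) k≤l′
      Wl′<Wl : W l′ < W l
      Wl′<Wl = ≤∧≢⇒< (≮⇒≥ λ q → proj₂ uc l′ l<l′ l′<b (q , proj₁ uc′)) (λ e → >⇒≢ l<l′ (inj P (<-trans l′<b b<N) (<-trans l<b b<N) e))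
      Vl′ : V l′ < W l
      Vl′ = ≤-<-trans (Run-active (injOf l<b r) R l′ (<-trans l′<b b<N) k≤l′)
              (PRun-block r (Perm-up l<b b<N P) l′<b ≤-refl b<N (cong W (tr-r l b))
                (subst (λ z → W z < W l) (sym (tr-o l b (>⇒≢ l<l′) (<⇒≢ l′<b))) Wl′<Wl))
      contra : V l′ ≡ γ ⊎ u′ l ≤ V l′ → ⊥
      contra (inj₁ e) = <-asym (proj₁ uc) (subst (_< W l) e Vl′)
      contra (inj₂ q) = <-irrefl refl (≤-<-trans (≤-trans (≤-trans (≤-reflexive (cong W (sym (tr-o l′ b (<⇒≢ l<l′) (<⇒≢ l<b))))) (PRun-≤ r′ l (m<n⇒m<1+n l<b))) q) Vl′)
    -- Two partners behind k: by `Inv` the right one carries the larger entry and so obstructs the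
    -- cover at the left one. Two partners before k: γ is inactive in both second runs, and
    -- `parallel` equates its positions.
    rest : Dec (k ≤ l) → Dec (k ≤ l′) → l ≡ l′
    rest (yes p) (yes q) with <-cmp l l′
    ... | tri< a _ _ = ⊥-elim (proj₂ uc l′ a l′<b (I p a l′<b ≤-refl b<N (proj₁ uc) (proj₁ uc′) , proj₁ uc′))
    ... | tri≈ _ e _ = e
    ... | tri> _ _ a = ⊥-elim (proj₂ uc′ l a l<b (I q a l<b ≤-refl b<N (proj₁ uc′) (proj₁ uc) , proj₁ uc))
    rest (no p) (no q) = proj₂ (parallel (injOf l<b r) (injOf l′<b r′) iV R R′ (bnd P b<N)
      (agree l<b l′<b uc uc′ r r′) (agree l′<b l<b uc′ uc r′ r) l l′ (<-trans l<b b<N) (<-trans l′<b b<N) (top l<b r) (top l′<b r′) q) p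
    rest (no p) (yes q) = ⊥-elim (mixed l<b l′<b uc uc′ r r′ R R′ p q)
    rest (yes p) (no q) = ⊥-elim (mixed l′<b l<b uc′ uc r′ r R′ R q p)

-- Counting

ΣZ-≢0 : ∀ n f → ΣZ n f ≢ 0ℤ → Σ ℕ λ l → l < n × f l ≢ 0ℤ
ΣZ-≢0 zero    f h = ⊥-elim (h refl)
ΣZ-≢0 (suc n) f h with f n ℤ.≟ 0ℤ
... | no p  = n , ≤-refl , p
... | yes p with ΣZ-≢0 n f (λ q → h (cong₂ ℤ._+_ q p))
...   | l , l<n , q = l , m<n⇒m<1+n l<n , q

ΣZ-nonneg : ∀ n f → (∀ l → l < n → 0ℤ ℤ.≤ f l) → 0ℤ ℤ.≤ ΣZ n f
ΣZ-nonneg zero    f h = ℤₚ.≤-refl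
ΣZ-nonneg (suc n) f h = ℤₚ.+-mono-≤ (ΣZ-nonneg n f (λ l p → h l (m<n⇒m<1+n p))) (h n ≤-refl)

ΣZ-one : ∀ n f B → (∀ l → l < n → f l ℤ.≤ + B) → (∀ l l′ → l < n → l′ < n → f l ≢ 0ℤ → f l′ ≢ 0ℤ → l ≡ l′) →
  ΣZ n f ℤ.≤ + B
ΣZ-one n f B h u with ΣZ n f ℤ.≟ 0ℤ
... | yes p = subst (ℤ._≤ + B) (sym p) (+≤+ z≤n)
... | no p with ΣZ-≢0 n f p
...   | l , l<n , q = subst (ℤ._≤ + B) (sym (ΣZ-single n l l<n other)) (h l l<n)
  where
  other : ∀ l′ → l′ < n → l′ ≢ l → f l′ ≡ 0ℤ
  other l′ l′<n ne with f l′ ℤ.≟ 0ℤ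
  ... | yes e = e
  ... | no e  = ⊥-elim (ne (u l′ l l′<n l<n e q))

bin : ℕ → ℕ → ℕ
bin n       zero    = 1
bin zero    (suc m) = 0
bin (suc n) (suc m) = bin n (suc m) + bin n m

binsum : ℕ → ℕ → ℕ
binsum n zero    = 1
binsum n (suc m) = bin n (suc m) + binsum n m

binsum-suc : ∀ n m → binsum (suc n) (suc m) ≡ binsum n (suc m) + binsum n m
binsum-suc n zero    = refl
binsum-suc n (suc m) = trans (cong (λ z → bin n (suc (suc m)) + bin n (suc m) + z) (binsum-suc n m))
                             (lem (bin n (suc (suc m))) (bin n (suc m)) (binsum n (suc m)) (binsum n m))
  where
  lem : ∀ a b c d → (a + b) + (c + d) ≡ (a + c) + (b + d)
  lem = ℕ-Solver.solve-∀

binsum≤ : ∀ n m → binsum n m ≤ 2 ^ n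
binsum≤ zero    zero    = ≤-refl
binsum≤ zero    (suc m) = binsum≤ zero m
binsum≤ (suc n) zero    = ≤-trans (binsum≤ n zero) (m≤m+n _ _)
binsum≤ (suc n) (suc m) = subst₂ _≤_ (sym (binsum-suc n m)) (cong (λ z → 2 ^ n + z) (sym (+-identityʳ _))) (ℕₚ.+-mono-≤ (binsum≤ n (suc m)) (binsum≤ n m))

-- Bounds for the number of sets of m positions among q + r, where of the first q positions all
-- (forced) or a final segment (free) are used.
forced : ℕ → ℕ → ℕ → ℕ
forced r zero    m       = bin r m
forced r (suc q) zero    = 0
forced r (suc q) (suc m) = forced r q m

free : ℕ → ℕ → ℕ → ℕ
free r zero    m       = bin r m
free r (suc q) zero    = free r q zero
free r (suc q) (suc m) = free r q (suc m) + forced r q m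

-- The same sets sorted differently: the final segment is empty, or it contains the last position,
-- whose removal leaves a final segment of q positions.
free-suc : ∀ r q m → free r (suc q) (suc m) ≡ bin r (suc m) + free r q m
free-suc r zero    m       = refl
free-suc r (suc q) zero    = trans (+-identityʳ _) (free-suc r q zero)
free-suc r (suc q) (suc m) = trans (cong (_+ forced r q m) (free-suc r q (suc m))) (ℕₚ.+-assoc (bin r (suc (suc m))) _ _)

free≤ : ∀ r q m → free r q m ≤ binsum r m
free≤ r zero    zero    = ≤-refl
free≤ r zero    (suc m) = m≤m+n _ _
free≤ r (suc q) zero    = free≤ r q zero
free≤ r (suc q) (suc m) = subst (_≤ binsum r (suc m)) (sym (free-suc r q m)) (ℕₚ.+-monoʳ-≤ (bin r (suc m)) (free≤ r q m))

free-0 : ∀ r q → free r q 0 ≡ 1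
free-0 r zero    = refl
free-0 r (suc q) = free-0 r q

H-H : ∀ c n m c′ n′ m′ L → H c n m (H c′ n′ m′ L) ≈ H c′ n′ m′ (H c n m L)
H-H c n m c′ n′       zero     L = ≈-refl
H-H c n m c′ zero     (suc m′) L = H-𝟘 c n m
H-H c n m c′ (suc n′) (suc m′) L = H-⊕ c n m _ _ ▸ ⊕-cong (H-H c n m c′ n′ (suc m′) L) (H-X c n m (n′ + c′) _ ▸ X-cong (n′ + c′) (H-H c n m c′ (suc n′) m′ L))

+-shift : ∀ b {n N} → b + suc n ≡ N → suc b + n ≡ N
+-shift b {n} e = trans (sym (+-suc b n)) e

+-bound : ∀ b {n N} → suc b + n ≡ N → b < N
+-bound b {n} e = subst (b <_) e (s≤s (m≤m+n b n))

-- Coefficients in products with complete homogeneous polynomials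

module Count (N k : ℕ) (k≤N : k ≤ N) where
  open JacobiTrudi N
  open Runs N k

  Span-H : ∀ c n m {L} → Span L → Span (H c n m L)
  Span-H c n       zero    S = S
  Span-H c zero    (suc m) S = zeroˢ
  Span-H c (suc n) (suc m) S = addˢ (Span-H c n (suc m) S) (Span-X (n + c) (Span-H c (suc n) m S))

  h-suc : ∀ b m L → H 0 (suc b) (suc m) L ≈ H 0 b (suc m) L ⊕ X b (H 0 (suc b) m L)
  h-suc b m L = ⊕-cong ≈-refl (≡⇒≈ (cong (λ z → X z (H 0 (suc b) m L)) (+-identityʳ b)))

  H-ε : ∀ n m → n ≤ N → H 0 n (suc m) ε ≈ 𝟘
  H-ε zero    m p = ≈-refl
  H-ε (suc n) m p = h-suc n m ε ▸ ⊕-cong (H-ε n m (<⇒≤ p)) (≈-sym (H-X 0 (suc n) m n ε) ▸ H-cong 0 (suc n) m (ε-inc n p) ▸ H-𝟘 0 (suc n) m) ▸ ⊕-identityʳ 𝟘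

  -- Symmetric in all N variables, the polynomial h_{m+1} commutes with every ∂_j in ⟦V⟧, and it has
  -- no constant term. This is where the recursion over positions stops.
  H-dead : ∀ m V → H 0 N (suc m) ⟦ V ⟧ ≈ 𝟘
  H-dead m = ⟦⟧-ind (λ V → H 0 N (suc m) ⟦ V ⟧ ≈ 𝟘)
    (λ V f → H-cong 0 N (suc m) (⟦⟧-incr f) ▸ H-ε N m ≤-refl)
    (λ V j p q ih → H-cong 0 N (suc m) (⟦⟧-desc j p q) ▸ H-D 0 N (suc m) j _ z≤n (subst (suc j <_) (sym (+-identityʳ N)) p) ▸ D-cong j ih ▸ D-𝟘 j)

  -- Abstracts multiplication by a product of h's in the first k variables, so that one recursion
  -- serves for one factor and for two.
  record Op : Set where
    field
      op     : Fn → Fn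
      op-≈   : ∀ {L M} → L ≈ M → op L ≈ op M
      op-𝟘   : op 𝟘 ≈ 𝟘
      op-D   : ∀ j → k ≤ j → ∀ L → op (D j L) ≈ D j (op L)
      op-H   : ∀ c n m L → H c n m (op L) ≈ op (H c n m L)
      op-span : ∀ {L} → Span L → Span (op L)
  open Op

  idO : Op
  idO = record { op = λ L → L ; op-≈ = λ p → p ; op-𝟘 = ≈-refl ; op-D = λ _ _ _ → ≈-refl ; op-H = λ _ _ _ _ → ≈-refl ; op-span = λ s → s }

  hO : ℕ → Op → Op
  hO m Q = record
    { op      = λ L → H 0 k m (op Q L)
    ; op-≈    = λ p → H-cong 0 k m (op-≈ Q p)
    ; op-𝟘    = H-cong 0 k m (op-𝟘 Q) ▸ H-𝟘 0 k m
    ; op-D    = λ j p L → H-cong 0 k m (op-D Q j p L) ▸ H-D-out 0 k m j _ (subst (_≤ j) (sym (+-identityʳ k)) p)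
    ; op-H    = λ c n m′ L → H-H c n m′ 0 k m _ ▸ H-cong 0 k m (op-H Q c n m′ L)
    ; op-span = λ S → Span-H 0 k m (op-span Q S) }

  -- Since 𝔖_W = ∂_j 𝔖_{W s_j} and ∂_j commutes with `op Q`, it can be passed on to ⟦V⟧, where it
  -- either lengthens V or gives zero.
  sort-step : ∀ Q {V W} → Perm V → Perm W → ∀ j → k ≤ j → suc j < N → W j < W (suc j) →
    (V j < V (suc j) × ap (pt W) (op Q ⟦ V ⟧) ≡ ap (pt (W ∘ s j)) (op Q ⟦ V ∘ s j ⟧)) ⊎
    (V (suc j) < V j × ap (pt W) (op Q ⟦ V ⟧) ≡ 0ℤ)
  sort-step Q {V} {W} PV PW j k≤j j<N asc = go
    where
    PW′ = Perm-s j j<N PW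
    e : ap (pt W) (op Q ⟦ V ⟧) ≡ ap (pt (W ∘ s j)) (op Q (D j ⟦ V ⟧))
    e = trans (Sch-span (pt W) (pt (W ∘ s j) ∘D j) (pt-Sch PW)
                (Sch-≐ (pt (W ∘ s j) ∘D j) (λ i _ → cong W (s-inv j i))
                  (Sch-D (pt (W ∘ s j)) j j<N (subst₂ _<_ (cong W (sym (s-sj j))) (cong W (sym (s-j j))) asc) (pt-Sch PW′)))
                (op-span Q (gen PV)))
              (resp (pt (W ∘ s j)) (≈-sym (op-D Q j k≤j ⟦ V ⟧)))
    go : _
    go with <-cmp (V j) (V (suc j))
    ... | tri< a _ _ = inj₁ (a , trans e (resp (pt (W ∘ s j)) (op-≈ Q (⟦⟧-asc j j<N a))))
    ... | tri≈ _ q _ = ⊥-elim (n≢1+n j (inj PV (<⇒≤ j<N) j<N q))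
    ... | tri> _ _ a = inj₂ (a , trans e (trans (resp (pt (W ∘ s j)) (op-≈ Q (⟦⟧-desc-0 j j<N a) ▸ op-𝟘 Q)) (zer (pt (W ∘ s j)))))

  -- Reduces a claim about coefficients to permutations W that decrease behind k. The claim must be
  -- stable under simultaneous exchanges in V and W and hold for the coefficient 0.
  sort-ind : ∀ Q {ℓ} (R : (ℕ → ℕ) → (ℕ → ℕ) → ℤ → Set ℓ) →
    (∀ {V W} → Perm V → Perm W → Desc k W → R V W (ap (pt W) (op Q ⟦ V ⟧))) →
    (∀ {V W x} j → k ≤ j → suc j < N → W j < W (suc j) → V j < V (suc j) → R (V ∘ s j) (W ∘ s j) x → R V W x) →
    (∀ V W → R V W 0ℤ) →
    ∀ {V W} → Perm V → Perm W → R V W (ap (pt W) (op Q ⟦ V ⟧))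
  sort-ind Q R base step nil {V} {W} = go (suc (ν 0 N W)) V W ≤-refl
    where
    strictD : ∀ {W} → Perm W → (∀ i → suc i < N ∸ k → W (suc i + k) ≤ W (i + k)) → Desc k W
    strictD {W} P f {a} {c} k≤a a<c c<N = ≤∧≢⇒< (weak a<c) (λ q → >⇒≢ a<c (inj P c<N (<-trans a<c c<N) q))
      where
      adj : ∀ i → k ≤ i → suc i < N → W (suc i) ≤ W i
      adj i k≤i i<N = subst (λ z → W (suc z) ≤ W z) (m∸n+n≡m k≤i)
        (f (i ∸ k) (subst (_≤ N ∸ k) (ℕₚ.+-∸-assoc 2 k≤i) (ℕₚ.∸-monoˡ-≤ k i<N)))
      mono : ∀ a n → k ≤ a → n + a < N → W (n + a) ≤ W a
      mono a zero    p q = ≤-refl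
      mono a (suc n) p q = ≤-trans (adj (n + a) (≤-trans p (m≤n+m a n)) q) (mono a n p (<⇒≤ q))
      weak : a < c → W c ≤ W a
      weak lt = subst (λ z → W z ≤ W a) (m∸n+n≡m (<⇒≤ lt)) (mono a (c ∸ a) k≤a (subst (_< N) (sym (m∸n+n≡m (<⇒≤ lt))) c<N))
    go : ∀ n V W → ν 0 N W < n → Perm V → Perm W → R V W (ap (pt W) (op Q ⟦ V ⟧))
    go (suc n) V W (s≤s p) PV PW with searchAsc (N ∸ k) (λ i → W (i + k))
    ... | inj₂ f = base PV PW (strictD PW f)
    ... | inj₁ (i , q , asc) with sort-step Q PV PW (i + k) (m≤n+m k i) (≤-trans (ℕₚ.+-monoˡ-≤ k q) (≤-reflexive (m∸n+n≡m k≤N))) asc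
    ...   | inj₂ (_ , e) = subst (R V W) (sym e) (nil V W)
    ...   | inj₁ (a , e) = subst (R V W) (sym e) (step (i + k) (m≤n+m k i) j<N asc a
              (go n (V ∘ s (i + k)) (W ∘ s (i + k)) (<-≤-trans (ν-asc 0 N (i + k) W j<N asc) p) (Perm-s (i + k) j<N PV) (Perm-s (i + k) j<N PW)))
      where j<N : suc (i + k) < N
            j<N = ≤-trans (ℕₚ.+-monoˡ-≤ k q) (≤-reflexive (m∸n+n≡m k≤N))

  module Rec (Q : Op) {V : ℕ → ℕ} (PV : Perm V) where
    L : Fn
    L = op Q ⟦ V ⟧

    SL : Span L
    SL = op-span Q (gen PV)

    -- The coefficient of 𝔖_V in h_m(x_0, ..., x_{b-1}) times the polynomial of Q times 𝔖_W.
    C : ℕ → ℕ → (ℕ → ℕ) → ℤ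
    C b m W = ap (pt W) (H 0 b m L)

    up : (ℕ → ℕ) → ℕ → ℕ → ℕ → ℤ
    up W b m l = ap (upᴾ W b l) (H 0 (suc b) m L)

    up-≢0 : ∀ {W b m l} → up W b m l ≢ 0ℤ → UCov W l b × up W b m l ≡ C (suc b) m (W ∘ tr l b)
    up-≢0 {W} {b} {m} {l} h with ucov? W l b
    ... | yes u = u , refl
    ... | no _  = ⊥-elim (h refl)

    up-all : ∀ {ℓ} (R : ℤ → Set ℓ) {W b m l} → R 0ℤ → (UCov W l b → R (C (suc b) m (W ∘ tr l b))) → R (up W b m l)
    up-all R {W} {b} {m} {l} z f with ucov? W l b
    ... | yes u = f u
    ... | no _  = z

    -- h_{m+1}(X_b) = h_{m+1}(X_{b+1}) - x_b h_m(X_{b+1}), and by `column` multiplication by x_b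
    -- produces only negative terms: the signs cancel. This is the source of positivity.
    C-suc : ∀ {W} → Perm W → ∀ b m → b < N → Desc b W →
      C b (suc m) W ≡ C (suc b) (suc m) W ℤ.+ ΣZ b (up W b m)
    C-suc {W} P b m b<N d = sym (trans (cong (ℤ._+ S) (trans (resp (pt W) (h-suc b m L)) (trans (add (pt W) _ _)
        (cong (λ z → C b (suc m) W ℤ.+ z) (column P b b<N (λ c p q → d ≤-refl p q) (Span-H 0 (suc b) m SL)))))) (lem (C b (suc m) W) S))
      where
      S = ΣZ b (up W b m)
      lem : ∀ a b → a ℤ.+ ℤ.- b ℤ.+ b ≡ a
      lem = ℤ-Solver.solve-∀

    C-end : ∀ m W → C N (suc m) W ≡ 0ℤ
    C-end m W = trans (resp (pt W) (op-H Q 0 N (suc m) ⟦ V ⟧ ▸ op-≈ Q (H-dead m V) ▸ op-𝟘 Q)) (zer (pt W))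

    C-end′ : ∀ {b} m W → b + 0 ≡ N → C b (suc m) W ≡ 0ℤ
    C-end′ {b} m W e = subst (λ z → C z (suc m) W ≡ 0ℤ) (trans (sym e) (+-identityʳ b)) (C-end m W)

    C-run : ∀ n b m {W} → b + n ≡ N → Perm W → Desc b W → C b m W ≢ 0ℤ → Σ (ℕ → ℕ) λ u → PRun b W u × ap (pt u) L ≢ 0ℤ
    C-run n       b zero    {W} e P d h = W , stop , h
    C-run zero    b (suc m) {W} e P d h = ⊥-elim (h (C-end′ m W e))
    C-run (suc n) b (suc m) {W} e P d h with C (suc b) (suc m) W ℤ.≟ 0ℤ
    ... | no p with C-run n (suc b) (suc m) (+-shift b e) P (Desc-suc d) p
    ...   | u , r , q = u , skip b<N r , q
      where b<N = +-bound b (+-shift b e)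
    C-run (suc n) b (suc m) {W} e P d h | yes p with ΣZ-≢0 b (up W b m) (λ q → h (trans (C-suc P b m b<N d) (cong₂ ℤ._+_ p q)))
      where b<N = +-bound b (+-shift b e)
    ... | l , l<b , q with up-≢0 {W} {b} {m} {l} q
    ...   | uc , eq with C-run n (suc b) m (+-shift b e) (Perm-up l<b b<N P) (Desc-tr l<b d) (λ z → q (trans eq z))
      where b<N = +-bound b (+-shift b e)
    ...     | u , r , q′ = u , swap l b<N l<b uc r , q′
      where b<N = +-bound b (+-shift b e)

    C-nonneg : (∀ {u} → Perm u → 0ℤ ℤ.≤ ap (pt u) L) → ∀ n b m {W} → b + n ≡ N → Perm W → Desc b W → 0ℤ ℤ.≤ C b m W
    C-nonneg h n       b zero    e P d = h P
    C-nonneg h zero    b (suc m) {W} e P d = ℤₚ.≤-reflexive (sym (C-end′ m W e))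
    C-nonneg h (suc n) b (suc m) {W} e P d = subst (0ℤ ℤ.≤_) (sym (C-suc P b m b<N d))
      (ℤₚ.+-mono-≤ (C-nonneg h n (suc b) (suc m) e′ P (Desc-suc d))
        (ΣZ-nonneg b _ λ l l<b → up-all (0ℤ ℤ.≤_) {W} {b} {m} {l} ℤₚ.≤-refl λ _ →
          C-nonneg h n (suc b) m e′ (Perm-up l<b b<N P) (Desc-tr l<b d)))
      where
      e′ = +-shift b e
      b<N : b < N
      b<N = +-bound b e′

  nonneg₀ : ∀ {V W} → Perm V → Perm W → 0ℤ ℤ.≤ ap (pt W) ⟦ V ⟧
  nonneg₀ {V} {W} PV PW with ≐? V W
  ... | yes e = ℤₚ.≤-trans (+≤+ z≤n) (ℤₚ.≤-reflexive (sym (trans (pt-Sch PW V PV) (δ-yes e))))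
  ... | no n  = ℤₚ.≤-reflexive (sym (trans (pt-Sch PW V PV) (δ-no n)))

  nonneg-step : ∀ Q m → (∀ {V W} → Perm V → Perm W → 0ℤ ℤ.≤ ap (pt W) (op Q ⟦ V ⟧)) →
    ∀ {V W} → Perm V → Perm W → 0ℤ ℤ.≤ ap (pt W) (H 0 k m (op Q ⟦ V ⟧))
  nonneg-step Q m h = sort-ind (hO m Q) (λ _ _ x → 0ℤ ℤ.≤ x)
    (λ PV PW d → Rec.C-nonneg Q PV (h PV) (N ∸ k) k m (m+[n∸m]≡n k≤N) PW d) (λ _ _ _ _ _ p → p) (λ _ _ → ℤₚ.≤-refl)

  second-run : ∀ m {V u} → Perm V → Perm u → ap (pt u) (H 0 k m ⟦ V ⟧) ≢ 0ℤ → Run N (k ≤_) u V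
  second-run m = sort-ind (hO m idO) (λ V u x → x ≢ 0ℤ → Run N (k ≤_) u V) base step (λ _ _ h → ⊥-elim (h refl))
    where
    base : ∀ {V W} → Perm V → Perm W → Desc k W → ap (pt W) (H 0 k m ⟦ V ⟧) ≢ 0ℤ → Run N (k ≤_) W V
    base {V} {W} PV PW d h with Rec.C-run idO PV (N ∸ k) k m (m+[n∸m]≡n k≤N) PW d h
    ... | u , r , q = PRun⇒Run r u≐V d N (k ≤_) (λ c _ c<N → bnd PW c<N) (λ _ p _ → p) (λ s s<k k≤s → ⊥-elim (≤⇒≯ k≤s s<k))
      where
      Pu = PRun-Perm r PW
      u≐V : u ≐ V
      u≐V with ≐? V u
      ... | yes e = ≐-sym e
      ... | no n  = ⊥-elim (q (trans (pt-Sch Pu V PV) (δ-no n)))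
    step : ∀ {V W x} j → k ≤ j → suc j < N → W j < W (suc j) → V j < V (suc j) →
      (x ≢ 0ℤ → Run N (k ≤_) (W ∘ s j) (V ∘ s j)) → x ≢ 0ℤ → Run N (k ≤_) W V
    step {V} {W} j k≤j j<N _ _ ih h = Run-resp (λ x x<N p → subst (k ≤_) (s-inv j x) (s-≥ k≤j p)) (λ x x<N p → s-≥ k≤j p)
        (λ x _ → cong W (s-inv j x)) (λ x _ → cong V (s-inv j x)) (Run-s j j<N (ih h))

  -- V tells which branch of the recursion is taken: it has the label at b again if b is skipped,
  -- and at l if b is exchanged with l. So at most one branch is nonzero at each step.
  second-≤1 : ∀ m {V u} → Perm V → Perm u → ap (pt u) (H 0 k m ⟦ V ⟧) ℤ.≤ 1ℤ
  second-≤1 m = sort-ind (hO m idO) (λ _ _ x → x ℤ.≤ 1ℤ)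
    (λ PV PW d → bound PV (N ∸ k) k m (m+[n∸m]≡n k≤N) PW d) (λ _ _ _ _ _ p → p) (λ _ _ → +≤+ z≤n)
    where
    module _ {V : ℕ → ℕ} (PV : Perm V) where
      open Rec idO PV
      run-end : ∀ n b m {W} → b + n ≡ N → Perm W → Desc b W → C b m W ≢ 0ℤ → Σ (ℕ → ℕ) λ u → PRun b W u × u ≐ V
      run-end n b m e P d h with C-run n b m e P d h
      ... | u , r , q with ≐? V u
      ...   | yes eq = u , r , ≐-sym eq
      ...   | no ne  = ⊥-elim (q (trans (pt-Sch (PRun-Perm r P) V PV) (δ-no ne)))
      topval : ∀ {b W x} γ m n → suc b + n ≡ N → Perm W → Desc (suc b) W → x < N → (∀ c → suc b ≤ c → c < N → W c < γ) → W x ≡ γ →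
        C (suc b) m W ≢ 0ℤ → V x ≡ γ
      topval {b} {W} {x} γ m n e P d x<N lab eq h with run-end n (suc b) m e P d h
      ... | u , r , u≐V = trans (sym (u≐V x x<N)) (trans (PRun-big r d lab x x<N (≤-reflexive (sym eq))) eq)
      bound : ∀ n b m {W} → b + n ≡ N → Perm W → Desc b W → C b m W ℤ.≤ 1ℤ
      bound n b zero {W} e P d = subst (ℤ._≤ 1ℤ) (sym (pt-Sch P V PV)) δ≤1
        where
        δ≤1 : δ V W ℤ.≤ 1ℤ
        δ≤1 with ≐? V W
        ... | yes q = ℤₚ.≤-reflexive (δ-yes q)
        ... | no q  = subst (ℤ._≤ 1ℤ) (sym (δ-no q)) (+≤+ z≤n)
      bound zero b (suc m) {W} e P d = subst (ℤ._≤ 1ℤ) (sym (C-end′ m W e)) (+≤+ z≤n)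
      bound (suc n) b (suc m) {W} e P d = subst (ℤ._≤ 1ℤ) (sym (C-suc P b m b<N d)) total
        where
        e′ = +-shift b e
        b<N : b < N
        b<N = +-bound b e′
        S = ΣZ b (up W b m)
        Vl : ∀ l → l < b → up W b m l ≢ 0ℤ → V l ≡ W b
        Vl l l<b h with up-≢0 {W} {b} {m} {l} h
        ... | uc , eq = topval (W b) m n e′ (Perm-up l<b b<N P) (Desc-tr l<b d) (<-trans l<b b<N)
                (λ c p c<N → subst (_< W b) (sym (tr-hi {W} l<b p)) (d ≤-refl p c<N)) (cong W (tr-l l b)) (λ z → h (trans eq z))
        S≤1 : S ℤ.≤ 1ℤ
        S≤1 = ΣZ-one b _ 1 (λ l l<b → up-all (ℤ._≤ 1ℤ) {W} {b} {m} {l} (+≤+ z≤n) λ _ → bound n (suc b) m e′ (Perm-up l<b b<N P) (Desc-tr l<b d))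
          (λ l l′ l<b l′<b p q → inj PV (<-trans l<b b<N) (<-trans l′<b b<N) (trans (Vl l l<b p) (sym (Vl l′ l′<b q))))
        total : C (suc b) (suc m) W ℤ.+ S ℤ.≤ 1ℤ
        total with C (suc b) (suc m) W ℤ.≟ 0ℤ | S ℤ.≟ 0ℤ
        ... | yes p | _     = subst (λ z → z ℤ.+ S ℤ.≤ 1ℤ) (sym p) (subst (ℤ._≤ 1ℤ) (sym (ℤₚ.+-identityˡ S)) S≤1)
        ... | no p  | yes q = subst (λ z → C (suc b) (suc m) W ℤ.+ z ℤ.≤ 1ℤ) (sym q)
                (subst (ℤ._≤ 1ℤ) (sym (ℤₚ.+-identityʳ (C (suc b) (suc m) W))) (bound n (suc b) (suc m) e′ P (Desc-suc d)))
        -- If skipping and exchanging both contributed, V would take the value `W b` at two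
        -- positions.
        ... | no p  | no q with ΣZ-≢0 b (up W b m) q
        ...   | l , l<b , h = ⊥-elim (<⇒≢ l<b (inj PV (<-trans l<b b<N) b<N (trans (Vl l l<b h)
                  (sym (topval (W b) (suc m) n e′ P (Desc-suc d) b<N (λ c a c<N → d ≤-refl a c<N) refl p)))))

  module Main (m₂ : ℕ) {V : ℕ → ℕ} (PV : Perm V) where
    open Rec (hO m₂ idO) PV

    -- Two nonzero terms would each come with a run to some u and a second run from there to V;
    -- `unique-l` then identifies the partners.
    Σ-bound : ∀ {W} n b m B → suc b + n ≡ N → Perm W → Desc b W → Inv b W →
      (∀ l → l < b → UCov W l b → C (suc b) m (W ∘ tr l b) ℤ.≤ + B) → ΣZ b (up W b m) ℤ.≤ + B
    Σ-bound {W} n b m B e P d I h = ΣZ-one b _ B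
      (λ l l<b → up-all (ℤ._≤ + B) {W} {b} {m} {l} (+≤+ z≤n) (h l l<b)) one
      where
      b<N : b < N
      b<N = +-bound b e
      one : ∀ l l′ → l < b → l′ < b → up W b m l ≢ 0ℤ → up W b m l′ ≢ 0ℤ → l ≡ l′
      one l l′ l<b l′<b p q with up-≢0 {W} {b} {m} {l} p | up-≢0 {W} {b} {m} {l′} q
      ... | uc , e₁ | uc′ , e₂
        with C-run n (suc b) m e (Perm-up l<b b<N P) (Desc-tr l<b d) (λ z → p (trans e₁ z))
           | C-run n (suc b) m e (Perm-up l′<b b<N P) (Desc-tr l′<b d) (λ z → q (trans e₂ z))
      ... | u , r , x | u′ , r′ , x′ = unique-l P (inj PV) b<N d I l<b l′<b uc uc′ r r′
            (second-run m₂ PV (PRun-Perm r (Perm-up l<b b<N P)) x)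
            (second-run m₂ PV (PRun-Perm r′ (Perm-up l′<b b<N P)) x′)

    -- Pascal's recursion: position b is skipped, or exchanged with its only possible partner.
    small : ∀ n b m {W} → b + n ≡ N → Perm W → Desc b W → Inv b W → C b m W ℤ.≤ + bin n m
    small n b zero e P d I = second-≤1 m₂ PV P
    small zero b (suc m) {W} e P d I = ℤₚ.≤-reflexive (C-end′ m W e)
    small (suc n) b (suc m) {W} e P d I = subst₂ ℤ._≤_ (sym (C-suc P b m b<N d)) (sym (ℤₚ.pos-+ (bin n (suc m)) (bin n m)))
      (ℤₚ.+-mono-≤ (small n (suc b) (suc m) e′ P (Desc-suc d) (Inv-suc d I))
        (Σ-bound n b m (bin n m) e′ P d I λ l l<b uc → small n (suc b) m e′ (Perm-up l<b b<N P) (Desc-tr l<b d) (Inv-tr P b<N l<b uc d I)))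
      where
      e′ = +-shift b e
      b<N : b < N
      b<N = +-bound b e′

    module Big (E r : ℕ) (E+r : E + r ≡ N) (dscV : ∀ c → k ≤ c → suc c < E → V (suc c) < V c) where

      Consec : ℕ → (ℕ → ℕ) → Set
      Consec b W = ∀ c → b ≤ c → suc c < E → W c ≡ suc (W (suc c))

      -- By `sort-step`, a nonzero coefficient requires V to ascend wherever u ascends behind k.
      ap-asc-desc : ∀ {u} → Perm u → ∀ c → k ≤ c → suc c < E → u c < u (suc c) → ap (pt u) L ≡ 0ℤ
      ap-asc-desc Pu c k≤c c<E asc with sort-step (hO m₂ idO) PV Pu c k≤c (<-≤-trans c<E (subst (E ≤_) E+r (m≤m+n E r))) asc
      ... | inj₁ (a , _) = ⊥-elim (<-asym a (dscV c k≤c c<E))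
      ... | inj₂ (_ , e) = e

      -- Position b has been used, so its entry lies below the next one. Skipping `suc b` would
      -- leave that ascent in u, against the descent of V. Hence `suc b` is used too; its new entry
      -- is below the one after it, since the values in the block are consecutive.
      started : ∀ q b m {W} → suc b + q ≡ E → k ≤ b → (0 < q → W b < W (suc b)) → Perm W → Desc (suc b) W → Inv (suc b) W → Consec (suc b) W →
        C (suc b) m W ℤ.≤ + forced r q m
      started zero b m e k≤b asc P d I cs = small r (suc b) m (trans (cong (_+ r) (trans (sym (+-identityʳ (suc b))) e)) E+r) P d I
      started (suc q) b zero e k≤b asc P d I cs =
        -- No exchange is left, so the ascent at b remains and the coefficient is zero, as `forced`
        -- predicts.
        ℤₚ.≤-reflexive (ap-asc-desc P b k≤b (+-bound (suc b) (+-shift (suc b) e)) (asc (s≤s z≤n)))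
      started (suc q) b (suc m) {W} e k≤b asc P d I cs = subst (ℤ._≤ + forced r q m) (sym (trans (C-suc P (suc b) m b<N d) (trans (cong (ℤ._+ ΣZ (suc b) (up W (suc b) m)) zero′) (ℤₚ.+-identityˡ _))))
        (Σ-bound (q + r) (suc b) m (forced r q m) e″ P d I λ l l<b uc →
          started q (suc b) m e′ (m≤n⇒m≤1+n k≤b) (asc′ l l<b uc) (Perm-up l<b b<N P) (Desc-tr l<b d) (Inv-tr P b<N l<b uc d I)
            (λ c p c<E → trans (tr-hi {W} l<b p) (trans (cs c (<⇒≤ p) c<E) (cong suc (sym (tr-hi {W} l<b (m<n⇒m<1+n p)))))))
        where
        e′ : suc (suc b) + q ≡ E
        e′ = +-shift (suc b) e
        e″ : suc (suc b) + (q + r) ≡ N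
        e″ = trans (sym (ℕₚ.+-assoc (suc (suc b)) q r)) (trans (cong (_+ r) e′) E+r)
        sb<E : suc b < E
        sb<E = +-bound (suc b) e′
        b<N : suc b < N
        b<N = +-bound (suc b) e″
        zero′ : C (suc (suc b)) (suc m) W ≡ 0ℤ
        zero′ with C (suc (suc b)) (suc m) W ℤ.≟ 0ℤ
        ... | yes p = p
        ... | no p with C-run (q + r) (suc (suc b)) (suc m) e″ P (Desc-suc d) p
        ...   | u , rr , x = ⊥-elim (x (ap-asc-desc (PRun-Perm rr P) b k≤b sb<E
                  (subst (u b <_) (sym (PRun-big rr (Desc-suc d) lab (suc b) b<N ≤-refl)) (PRun-small rr (Desc-suc d) lab b (<⇒≤ b<N) (asc (s≤s z≤n))))))
          where lab : ∀ c → suc (suc b) ≤ c → c < N → W c < W (suc b)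
                lab c p c<N = d ≤-refl p c<N
        asc′ : ∀ l → l < suc b → UCov W l (suc b) → 0 < q → W (tr l (suc b) (suc b)) < W (tr l (suc b) (suc (suc b)))
        asc′ l l<b uc 0<q = subst₂ _<_ (cong W (sym (tr-r l (suc b)))) (sym (tr-hi {W} l<b ≤-refl))
          (≤∧≢⇒< (≤-pred (subst (W l <_) (cs (suc b) ≤-refl ssb<E) (proj₁ uc)))
                 (λ z → <⇒≢ (<-trans l<b ≤-refl) (inj P (<-trans l<b b<N) (<-≤-trans ssb<E E≤N) z)))
          where
          ssb<E : suc (suc b) < E
          ssb<E = subst (suc (suc b) <_) e′ (ℕₚ.m<m+n (suc (suc b)) 0<q)
          E≤N : E ≤ N
          E≤N = subst (E ≤_) E+r (m≤m+n E r)

      unstarted : ∀ q b m {W} → b + q ≡ E → k ≤ b → Perm W → Desc b W → Inv b W → Consec b W → C b m W ℤ.≤ + free r q m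
      unstarted zero b m e k≤b P d I cs = small r b m (trans (cong (_+ r) (trans (sym (+-identityʳ b)) e)) E+r) P d I
      unstarted (suc q) b zero e k≤b P d I cs = ℤₚ.≤-trans (second-≤1 m₂ PV P) (ℤₚ.≤-reflexive (cong +_ (sym (free-0 r q))))
      unstarted (suc q) b (suc m) {W} e k≤b P d I cs = subst₂ ℤ._≤_ (sym (C-suc P b m b<N d)) (sym (ℤₚ.pos-+ (free r q (suc m)) (forced r q m)))
        (ℤₚ.+-mono-≤ (unstarted q (suc b) (suc m) e′ (m≤n⇒m≤1+n k≤b) P (Desc-suc d) (Inv-suc d I) (λ c p → cs c (<⇒≤ p)))
          (Σ-bound (q + r) b m (forced r q m) e″ P d I λ l l<b uc →
            started q b m e′ k≤b (asc′ l l<b uc) (Perm-up l<b b<N P) (Desc-tr l<b d) (Inv-tr P b<N l<b uc d I)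
              (λ c p c<E → trans (tr-hi {W} l<b p) (trans (cs c (<⇒≤ p) c<E) (cong suc (sym (tr-hi {W} l<b (m<n⇒m<1+n p))))))))
        where
        e′ : suc b + q ≡ E
        e′ = +-shift b e
        e″ : suc b + (q + r) ≡ N
        e″ = trans (sym (ℕₚ.+-assoc (suc b) q r)) (trans (cong (_+ r) e′) E+r)
        b<N : b < N
        b<N = +-bound b e″
        asc′ : ∀ l → l < b → UCov W l b → 0 < q → W (tr l b b) < W (tr l b (suc b))
        asc′ l l<b uc 0<q = subst₂ _<_ (cong W (sym (tr-r l b))) (sym (tr-hi {W} l<b ≤-refl))
          (≤∧≢⇒< (≤-pred (subst (W l <_) (cs b ≤-refl sb<E) (proj₁ uc)))
                 (λ z → <⇒≢ (<-trans l<b ≤-refl) (inj P (<-trans l<b b<N) (<-≤-trans sb<E E≤N) z)))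
          where
          sb<E : suc b < E
          sb<E = subst (suc b <_) e′ (ℕₚ.m<m+n (suc b) 0<q)
          E≤N : E ≤ N
          E≤N = subst (E ≤_) E+r (m≤m+n E r)

  -- The entries of W that are at least n lie behind position k; V follows each inversion among them.
  record BigInv (n : ℕ) (V W : ℕ → ℕ) : Set where
    field
      front : ∀ i → i < k → W i < n
      pairs : ∀ {i j} → k ≤ i → i < j → j < N → n ≤ W i → n ≤ W j → W j < W i → V j < V i
  open BigInv

  module Final (n : ℕ) (k≤n : k ≤ n) (n≤N : n ≤ N) where
    q r E : ℕ
    q = N ∸ n
    r = n ∸ k
    E = k + q

    E+r : E + r ≡ N
    E+r = trans (lem k q r) (trans (cong (_+ q) (m+[n∸m]≡n k≤n)) (m+[n∸m]≡n n≤N))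
      where
      lem : ∀ a b c → (a + b) + c ≡ (a + c) + b
      lem = ℕ-Solver.solve-∀

    module Sorted {V W : ℕ → ℕ} (PV : Perm V) (PW : Perm W) (d : Desc k W) (B : BigInv n V W) where
      -- The values N-1, ..., n all lie behind position k, where W decreases, so they fill the
      -- positions k, k+1, ... in this order. Strong induction on i, with x as its bound: a larger
      -- or smaller entry at k + i would repeat a value or a position already accounted for.
      entry : ∀ x i → i < x → i < q → suc (W (k + i) + i) ≡ N
      entry (suc x) i (s≤s i≤x) i<q = trans (cong (λ z → suc (z + i)) Wki) v+i
        where
        v : ℕ
        v = N ∸ suc i
        i<N : suc i ≤ N
        i<N = ≤-trans i<q (ℕₚ.m∸n≤m N n)
        v+i : suc (v + i) ≡ N
        v+i = trans (sym (+-suc v i)) (m∸n+n≡m i<N)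
        v<N : v < N
        v<N = subst (v <_) v+i (s≤s (m≤m+n v i))
        n≤v : n ≤ v
        n≤v = ℕₚ.+-cancelʳ-≤ (suc i) n v (subst (n + suc i ≤_) (sym (m∸n+n≡m i<N))
                (≤-trans (ℕₚ.+-monoʳ-≤ n i<q) (≤-reflexive (m+[n∸m]≡n n≤N))))
        p : ℕ
        p = inv PW v
        p<N : p < N
        p<N = inv< PW v<N
        Wp : W p ≡ v
        Wp = Vinv PW v<N
        k≤p : k ≤ p
        k≤p = ≮⇒≥ λ p<k → ≤⇒≯ n≤v (subst (_< n) Wp (front B p p<k))
        ki<N : k + i < N
        ki<N = <-≤-trans (ℕₚ.+-monoʳ-< k i<q) (subst (E ≤_) E+r (m≤m+n E r))
        Wki : W (k + i) ≡ v
        Wki with <-cmp p (k + i)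
        ... | tri≈ _ e _ = trans (cong W (sym e)) Wp
        ... | tri< p<ki _ _ = ⊥-elim (<⇒≢ i′<i (suc-injective (ℕₚ.+-cancelˡ-≡ v _ _ (trans (trans (+-suc v i′) (trans (cong (λ z → suc (z + i′)) (sym Wki′)) e′)) (trans (sym v+i) (sym (+-suc v i)))))))
          where
          i′ = p ∸ k
          ki′ : k + i′ ≡ p
          ki′ = m+[n∸m]≡n k≤p
          i′<i : i′ < i
          i′<i = ℕₚ.+-cancelˡ-< k i′ i (subst (_< k + i) (sym ki′) p<ki)
          Wki′ : W (k + i′) ≡ v
          Wki′ = trans (cong W ki′) Wp
          e′ = entry x i′ (<-≤-trans i′<i i≤x) (<-trans i′<i i<q)
        ... | tri> _ _ ki<p = ⊥-elim (<⇒≢ (ℕₚ.+-monoʳ-< k i′<i) (inj PW (<-trans (ℕₚ.+-monoʳ-< k i′<i) ki<N) ki<N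
                (ℕₚ.+-cancelʳ-≡ i′ _ _ (suc-injective (trans (entry x i′ (<-≤-trans i′<i i≤x) (<-trans i′<i i<q)) (sym y+i′))))))
          where
          y = W (k + i)
          v<y : v < y
          v<y = subst (_< y) Wp (d (m≤m+n k i) ki<p p<N)
          y<N : y < N
          y<N = bnd PW ki<N
          i′ = N ∸ suc y
          y+i′ : suc (y + i′) ≡ N
          y+i′ = m+[n∸m]≡n y<N
          i′<i : i′ < i
          i′<i = ℕₚ.+-cancelˡ-< v i′ i (≤-pred (subst (suc (suc (v + i′)) ≤_) (trans y+i′ (sym v+i)) (s≤s (ℕₚ.+-monoˡ-< i′ v<y))))

      big : ∀ c → k ≤ c → c < E → suc (W c + (c ∸ k)) ≡ N
      big c k≤c c<E = subst (λ z → suc (W z + (c ∸ k)) ≡ N) (m+[n∸m]≡n k≤c)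
        (entry (suc (c ∸ k)) (c ∸ k) ≤-refl (ℕₚ.+-cancelˡ-< k (c ∸ k) q (subst (_< E) (sym (m+[n∸m]≡n k≤c)) c<E)))

      n≤big : ∀ c → k ≤ c → c < E → n ≤ W c
      n≤big c k≤c c<E = ℕₚ.+-cancelʳ-≤ (suc (c ∸ k)) n (W c) (subst (n + suc (c ∸ k) ≤_) (sym (trans (+-suc (W c) (c ∸ k)) (big c k≤c c<E)))
        (≤-trans (ℕₚ.+-monoʳ-≤ n (ℕₚ.+-cancelˡ-< k (c ∸ k) q (subst (_< E) (sym (m+[n∸m]≡n k≤c)) c<E))) (≤-reflexive (m+[n∸m]≡n n≤N))))

      E≤N : E ≤ N
      E≤N = subst (E ≤_) E+r (m≤m+n E r)

      dscV : ∀ c → k ≤ c → suc c < E → V (suc c) < V c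
      dscV c k≤c c<E = pairs B k≤c ≤-refl (<-≤-trans c<E E≤N) (n≤big c k≤c (<⇒≤ c<E)) (n≤big (suc c) (m≤n⇒m≤1+n k≤c) c<E)
        (d k≤c ≤-refl (<-≤-trans c<E E≤N))

      consec : ∀ c → k ≤ c → suc c < E → W c ≡ suc (W (suc c))
      consec c k≤c c<E = ℕₚ.+-cancelʳ-≡ (c ∸ k) _ _ (suc-injective (trans (big c k≤c (<⇒≤ c<E))
        (trans (sym (big (suc c) (m≤n⇒m≤1+n k≤c) c<E)) (cong suc (trans (cong (λ z → W (suc c) + z) (ℕₚ.+-∸-assoc 1 k≤c)) (+-suc (W (suc c)) (c ∸ k)))))))

      bound : ∀ m₁ m₂ → ap (pt W) (H 0 k m₁ (H 0 k m₂ ⟦ V ⟧)) ℤ.≤ + (2 ^ r)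
      bound m₁ m₂ = ℤₚ.≤-trans (Main.Big.unstarted m₂ PV E r E+r dscV q k m₁ refl ≤-refl PW d
          (λ k≤s s<t t<k → ⊥-elim (≤⇒≯ k≤s (<-trans s<t t<k))) consec)
        (+≤+ (≤-trans (free≤ r q m₁) (binsum≤ r m₁)))

    bound : ∀ m₁ m₂ {V W} → Perm V → Perm W → BigInv n V W → ap (pt W) (H 0 k m₁ (H 0 k m₂ ⟦ V ⟧)) ℤ.≤ + (2 ^ r)
    bound m₁ m₂ = sort-ind (hO m₁ (hO m₂ idO)) (λ V W x → BigInv n V W → x ℤ.≤ + (2 ^ r))
      (λ PV PW d B → Sorted.bound PV PW d B m₁ m₂) step (λ _ _ _ → +≤+ z≤n)
      where
      step : ∀ {V W x} j → k ≤ j → suc j < N → W j < W (suc j) → V j < V (suc j) →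
        (BigInv n (V ∘ s j) (W ∘ s j) → x ℤ.≤ + (2 ^ r)) → BigInv n V W → x ℤ.≤ + (2 ^ r)
      step {V} {W} j k≤j j<N ascW ascV ih B = ih (record { front = fr ; pairs = pr })
        where
        fr : ∀ i → i < k → W (s j i) < n
        fr i i<k = subst (λ z → W z < n) (sym (s-other j (<⇒≢ (<-≤-trans i<k k≤j)) (<⇒≢ (<-≤-trans i<k (m≤n⇒m≤1+n k≤j))))) (front B i i<k)
        pr : ∀ {a c} → k ≤ a → a < c → c < N → n ≤ W (s j a) → n ≤ W (s j c) → W (s j c) < W (s j a) → V (s j c) < V (s j a)
        pr {a} {c} k≤a a<c c<N p₁ p₂ lt with a ≟ j | c ≟ suc j
        -- The only inversion that the exchange creates is (j, j+1); the ascent of V at j provides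
        -- the required descent.
        ... | yes refl | yes refl = subst₂ (λ x y → V x < V y) (sym (s-sj j)) (sym (s-j j)) ascV
        ... | yes refl | no ne    = pairs B (s-≥ k≤j k≤a) (s-mono j a<c (λ _ → ne)) (s-< j j<N c<N) p₁ p₂ lt
        ... | no ne    | _        = pairs B (s-≥ k≤j k≤a) (s-mono j a<c (λ e → ⊥-elim (ne e))) (s-< j j<N c<N) p₁ p₂ lt

-- Polynomials as lists of terms

≡ᵇ-true : ∀ {a b} → (a ≡ᵇ b) ≡ true → a ≡ b
≡ᵇ-true {a} {b} p = ℕₚ.≡ᵇ⇒≡ a b (subst Bool.T (sym p) _)

≡ᵇ-refl : ∀ {a b} → a ≡ b → (a ≡ᵇ b) ≡ true
≡ᵇ-refl {zero}  refl = refl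
≡ᵇ-refl {suc a} refl = ≡ᵇ-refl {a} refl

∧-true : ∀ {x y} → (x ∧ y) ≡ true → x ≡ true × y ≡ true
∧-true {true} {true} p = refl , refl

monEq-sound : ∀ a b → monEq a b ≡ true → expo a ≗ expo b
monEq-sound []       []       p i = refl
monEq-sound []       (b ∷ bs) p zero    = sym (≡ᵇ-true (proj₁ (∧-true p)))
monEq-sound []       (b ∷ bs) p (suc i) = monEq-sound [] bs (proj₂ (∧-true {b ≡ᵇ 0} p)) i
monEq-sound (a ∷ as) []       p zero    = ≡ᵇ-true (proj₁ (∧-true p))
monEq-sound (a ∷ as) []       p (suc i) = monEq-sound as [] (proj₂ (∧-true {a ≡ᵇ 0} p)) i
monEq-sound (a ∷ as) (b ∷ bs) p zero    = ≡ᵇ-true (proj₁ (∧-true p))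
monEq-sound (a ∷ as) (b ∷ bs) p (suc i) = monEq-sound as bs (proj₂ (∧-true {a ≡ᵇ b} p)) i

monEq-complete : ∀ a b → expo a ≗ expo b → monEq a b ≡ true
monEq-complete []       []       p = refl
monEq-complete []       (b ∷ bs) p rewrite ≡ᵇ-refl (sym (p 0)) = monEq-complete [] bs (p ∘ suc)
monEq-complete (a ∷ as) []       p rewrite ≡ᵇ-refl (p 0) = monEq-complete as [] (p ∘ suc)
monEq-complete (a ∷ as) (b ∷ bs) p rewrite ≡ᵇ-refl (p 0) = monEq-complete as bs (p ∘ suc)

ev : Fn → Poly → ℤ
ev L []            = 0ℤ
ev L ((c , m) ∷ p) = c ℤ.* at L (expo m) ℤ.+ ev L p

ev-++ : ∀ L p q → ev L (p ++ q) ≡ ev L p ℤ.+ ev L q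
ev-++ L []            q = sym (ℤₚ.+-identityˡ _)
ev-++ L ((c , m) ∷ p) q = trans (cong (λ z → c ℤ.* at L (expo m) ℤ.+ z) (ev-++ L p q)) (sym (ℤₚ.+-assoc (c ℤ.* at L (expo m)) _ _))

ev-scale : ∀ L c p → ev L (scaleP c p) ≡ c ℤ.* ev L p
ev-scale L c []            = sym (ℤₚ.*-zeroʳ c)
ev-scale L c ((d , m) ∷ p) = trans (cong₂ ℤ._+_ (ℤₚ.*-assoc c d _) (ev-scale L c p)) (sym (ℤₚ.*-distribˡ-+ c _ _))

private
  rem : Monomial → Poly → Poly
  rem a []            = []
  rem a ((c , b) ∷ p) = if monEq b a then rem a p else (c , b) ∷ rem a p

  rem-len : ∀ a p → length (rem a p) ≤ length p
  rem-len a []            = z≤n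
  rem-len a ((c , b) ∷ p) with monEq b a
  ... | true  = m≤n⇒m≤1+n (rem-len a p)
  ... | false = s≤s (rem-len a p)

  ev-rem : ∀ L a p → ev L p ≡ coeff p a ℤ.* at L (expo a) ℤ.+ ev L (rem a p)
  ev-rem L a []            = refl
  ev-rem L a ((c , b) ∷ p) with monEq b a in eq
  ... | true  = trans (cong₂ (λ x y → c ℤ.* x ℤ.+ y) (ext L (monEq-sound b a eq)) (ev-rem L a p))
                      (lem c (coeff p a) (at L (expo a)) (ev L (rem a p)))
    where lem : ∀ c d l r → c ℤ.* l ℤ.+ (d ℤ.* l ℤ.+ r) ≡ (c ℤ.+ d) ℤ.* l ℤ.+ r
          lem = ℤ-Solver.solve-∀
  ... | false = trans (cong (λ y → c ℤ.* at L (expo b) ℤ.+ y) (ev-rem L a p))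
                      (lem (c ℤ.* at L (expo b)) (coeff p a) (at L (expo a)) (ev L (rem a p)))
    where lem : ∀ x d l r → x ℤ.+ (d ℤ.* l ℤ.+ r) ≡ (0ℤ ℤ.+ d) ℤ.* l ℤ.+ (x ℤ.+ r)
          lem = ℤ-Solver.solve-∀

  coeff-rem : ∀ a p m → (monEq a m ≡ true → coeff (rem a p) m ≡ 0ℤ) × (monEq a m ≡ false → coeff (rem a p) m ≡ coeff p m)
  coeff-rem a []            m = (λ _ → refl) , (λ _ → refl)
  coeff-rem a ((c , b) ∷ p) m with monEq b a in eq
  ... | true  = proj₁ (coeff-rem a p m) , λ h → trans (proj₂ (coeff-rem a p m) h) (sym (trans (cong (λ z → (if z then c else 0ℤ) ℤ.+ coeff p m) (bm h)) (ℤₚ.+-identityˡ _)))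
    where
    bm : monEq a m ≡ false → monEq b m ≡ false
    bm h with monEq b m in e
    ... | false = refl
    ... | true  = trans (sym (monEq-complete a m (λ i → trans (sym (monEq-sound b a eq i)) (monEq-sound b m e i)))) h
  ... | false = (λ h → trans (cong₂ ℤ._+_ (cong (λ z → if z then c else 0ℤ) (bm h)) (proj₁ (coeff-rem a p m) h)) refl)
              , (λ h → cong (λ z → (if monEq b m then c else 0ℤ) ℤ.+ z) (proj₂ (coeff-rem a p m) h))
    where
    bm : monEq a m ≡ true → monEq b m ≡ false
    bm h with monEq b m in e
    ... | false = refl
    ... | true  = trans (sym (monEq-complete b a (λ i → trans (monEq-sound b m e i) (sym (monEq-sound a m h i))))) eq

  -- Formal sums may repeat monomials. Deleting every term with the monomial of the head removes a
  -- total coefficient of zero and shortens the list.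
  ev-zero : ∀ n L p → length p ≤ n → (∀ m → coeff p m ≡ 0ℤ) → ev L p ≡ 0ℤ
  ev-zero n       L []            le h = refl
  ev-zero (suc n) L ((c , a) ∷ p) (s≤s le) h = trans (ev-rem L a ((c , a) ∷ p)) (trans
      (cong₂ (λ x y → x ℤ.* at L (expo a) ℤ.+ y) (h a) (ev-zero n L (rem a ((c , a) ∷ p)) le′ h′)) refl)
    where
    aa : monEq a a ≡ true
    aa = monEq-complete a a (λ _ → refl)
    le′ : length (rem a ((c , a) ∷ p)) ≤ n
    le′ rewrite aa = ≤-trans (rem-len a p) le
    h′ : ∀ m → coeff (rem a ((c , a) ∷ p)) m ≡ 0ℤ
    h′ m with monEq a m in e
    ... | true  = proj₁ (coeff-rem a ((c , a) ∷ p) m) e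
    ... | false = trans (proj₂ (coeff-rem a ((c , a) ∷ p) m) e) (h m)

  coeff-++ : ∀ p q m → coeff (p ++ q) m ≡ coeff p m ℤ.+ coeff q m
  coeff-++ []            q m = sym (ℤₚ.+-identityˡ _)
  coeff-++ ((c , a) ∷ p) q m = trans (cong (λ z → (if monEq a m then c else 0ℤ) ℤ.+ z) (coeff-++ p q m)) (sym (ℤₚ.+-assoc (if monEq a m then c else 0ℤ) _ _))

  coeff-neg : ∀ p m → coeff (scaleP ℤ.-1ℤ p) m ≡ ℤ.- coeff p m
  coeff-neg []            m = refl
  coeff-neg ((c , a) ∷ p) m with monEq a m
  ... | true  = trans (cong₂ ℤ._+_ (ℤₚ.-1*i≡-i c) (coeff-neg p m)) (sym (ℤₚ.neg-distrib-+ c _))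
  ... | false = trans (cong (λ z → 0ℤ ℤ.+ z) (coeff-neg p m)) (sym (ℤₚ.neg-distrib-+ 0ℤ (coeff p m)))

ev-resp : ∀ L p q → p ≈P q → ev L p ≡ ev L q
ev-resp L p q h = ℤₚ.i-j≡0⇒i≡j _ _ (trans (sym lhs) (ev-zero _ L (p ++ scaleP ℤ.-1ℤ q) ≤-refl zr))
  where
  lhs : ev L (p ++ scaleP ℤ.-1ℤ q) ≡ ev L p ℤ.- ev L q
  lhs = trans (ev-++ L p _) (cong (λ z → ev L p ℤ.+ z) (trans (ev-scale L ℤ.-1ℤ q) (ℤₚ.-1*i≡-i _)))
  zr : ∀ m → coeff (p ++ scaleP ℤ.-1ℤ q) m ≡ 0ℤ
  zr m = trans (coeff-++ p _ m) (trans (cong₂ ℤ._+_ (h m) (coeff-neg q m)) (ℤₚ.+-inverseʳ (coeff q m)))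

ΣZ-front : ∀ n g → ΣZ (suc n) g ≡ g 0 ℤ.+ ΣZ n (g ∘ suc)
ΣZ-front zero    g = ℤₚ.+-comm 0ℤ (g 0)
ΣZ-front (suc n) g = trans (cong (ℤ._+ g (suc n)) (ΣZ-front n g)) (ℤₚ.+-assoc (g 0) _ _)

-- With `dd-≤` and `dd-≡`: the recursion of `dd` unrolled into the explicit sums used by `∂mon`.
dd-≥ : ∀ G d b → dd G (d + b) b ≡ ΣZ d (λ i → G (d + b ∸ suc i) (b + i))
dd-≥ G zero    zero    = refl
dd-≥ G (suc d) zero    = trans (cong (ℤ._+ G (d + 0) 0) (dd-≥ (λ u v → G u (suc v)) d zero)) (trans (ℤₚ.+-comm _ (G (d + 0) 0)) (sym (ΣZ-front d _)))
dd-≥ G d       (suc b) = trans (cong (λ z → dd G z (suc b)) (+-suc d b)) (trans (dd-≥ (λ u v → G (suc u) (suc v)) d b)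
  (ΣZ-cong d λ i p → cong (λ z → G z (suc (b + i))) (trans (sym (ℕₚ.+-∸-assoc 1 {d + b} {suc i} (≤-trans p (ℕₚ.m≤m+n d b)))) (cong (_∸ suc i) (sym (+-suc d b))))))

dd-≤ : ∀ G d a → dd G a (d + a) ≡ ℤ.- ΣZ d (λ i → G (d + a ∸ suc i) (a + i))
dd-≤ G zero    zero    = refl
dd-≤ G (suc d) zero    = trans (cong₂ (λ x y → x ℤ.- G 0 y) (dd-≤ (λ u v → G (suc u) v) d zero) (+-identityʳ d)) (trans
   (sym (ℤₚ.neg-distrib-+ (ΣZ d (λ i → G (suc (d + 0 ∸ suc i)) i)) (G 0 d)))
   (cong ℤ.-_ (cong₂ ℤ._+_ (ΣZ-cong d (λ i p → cong (λ z → G z i) (sym (ℕₚ.+-∸-assoc 1 {d + 0} {suc i} (≤-trans p (ℕₚ.m≤m+n d 0)))))) (cong (λ z → G z d) (sym (trans (cong (_∸ d) (+-identityʳ d)) (ℕₚ.n∸n≡0 d)))))))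
dd-≤ G d       (suc a) = trans (cong (λ z → dd G (suc a) z) (+-suc d a)) (trans (dd-≤ (λ u v → G (suc u) (suc v)) d a)
  (cong ℤ.-_ (ΣZ-cong d λ i p → cong (λ z → G z (suc (a + i))) (trans (sym (ℕₚ.+-∸-assoc 1 {d + a} {suc i} (≤-trans p (ℕₚ.m≤m+n d a)))) (cong (_∸ suc i) (sym (+-suc d a)))))))

dd-≡ : ∀ G a → dd G a a ≡ 0ℤ
dd-≡ G zero    = refl
dd-≡ G (suc a) = dd-≡ _ a

ev-upTo : ∀ L c (f : ℕ → Monomial) n → ev L (map (λ j → (c , f j)) (upTo n)) ≡ c ℤ.* ΣZ n (λ j → at L (expo (f j)))
ev-upTo L c f n = trans (cong (ev L) (map-upTo (λ j → (c , f j)) n)) (go f n)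
  where
  go : ∀ (f : ℕ → Monomial) n → ev L (applyUpTo (λ j → (c , f j)) n) ≡ c ℤ.* ΣZ n (λ j → at L (expo (f j)))
  go f zero    = sym (ℤₚ.*-zeroʳ c)
  go f (suc n) = trans (cong (λ z → c ℤ.* at L (expo (f 0)) ℤ.+ z) (go (f ∘ suc) n))
    (trans (sym (ℤₚ.*-distribˡ-+ c _ _)) (cong (c ℤ.*_) (sym (ΣZ-front n _))))

expo-setExp : ∀ j u v m → expo (setExp (suc j) v (setExp j u m)) ≗ set₂ j u v (expo m)
expo-setExp zero    u v []          zero          = refl
expo-setExp zero    u v []          (suc zero)    = refl
expo-setExp zero    u v []          (suc (suc i)) = refl
expo-setExp zero    u v (a ∷ [])    zero          = refl
expo-setExp zero    u v (a ∷ [])    (suc zero)    = refl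
expo-setExp zero    u v (a ∷ [])    (suc (suc i)) = refl
expo-setExp zero    u v (a ∷ b ∷ m) zero          = refl
expo-setExp zero    u v (a ∷ b ∷ m) (suc zero)    = refl
expo-setExp zero    u v (a ∷ b ∷ m) (suc (suc i)) = refl
expo-setExp (suc j) u v []          zero          = refl
expo-setExp (suc j) u v []          (suc i)       = expo-setExp j u v [] i
expo-setExp (suc j) u v (a ∷ m)     zero          = refl
expo-setExp (suc j) u v (a ∷ m)     (suc i)       = expo-setExp j u v m i

<ᵇ-true : ∀ {a b} → (a <ᵇ b) ≡ true → a < b
<ᵇ-true {a} {b} p = ℕₚ.<ᵇ⇒< a b (subst Bool.T (sym p) _)

<ᵇ-false : ∀ {a b} → (a <ᵇ b) ≡ false → b ≤ a
<ᵇ-false {a} {b} p = ≮⇒≥ λ lt → subst Bool.T p (ℕₚ.<⇒<ᵇ lt)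

ev-∂mon : ∀ L j c m → ev L (∂mon (suc j) (c , m)) ≡ c ℤ.* at (D j L) (expo m)
ev-∂mon L j c m with expo m j in ea | expo m (suc j) in eb
... | a | b with b <ᵇ a in lt
...   | true = trans (ev-upTo L c _ (a ∸ b)) (cong (c ℤ.*_) (sym (trans (at-D j L (expo m)) (trans (cong₂ (dd _) ea eb)
          (trans (cong (λ z → dd G z b) (sym ab)) (trans (dd-≥ G (a ∸ b) b)
          (ΣZ-cong (a ∸ b) λ i _ → trans (cong (λ z → G (z ∸ suc i) (b + i)) ab) (ext L (λ x → sym (expo-setExp j _ _ m x))))))))))
  where
  G : ℕ → ℕ → ℤ
  G u v = at L (set₂ j u v (expo m))
  ab : a ∸ b + b ≡ a
  ab = m∸n+n≡m (<⇒≤ (<ᵇ-true lt))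
...   | false with a <ᵇ b in gt
...     | true = trans (ev-upTo L (ℤ.- c) _ (b ∸ a)) (trans (neg-swap c _) (cong (c ℤ.*_) (sym (trans (at-D j L (expo m)) (trans (cong₂ (dd _) ea eb)
          (trans (cong (λ z → dd G a z) (sym ab)) (trans (dd-≤ G (b ∸ a) a)
          (cong ℤ.-_ (ΣZ-cong (b ∸ a) λ i _ → trans (cong (λ z → G (z ∸ suc i) (a + i)) ab) (ext L (λ x → sym (expo-setExp j _ _ m x))))))))))))
  where
  G : ℕ → ℕ → ℤ
  G u v = at L (set₂ j u v (expo m))
  ab : b ∸ a + a ≡ b
  ab = m∸n+n≡m (<⇒≤ (<ᵇ-true gt))
  neg-swap : ∀ c x → (ℤ.- c) ℤ.* x ≡ c ℤ.* (ℤ.- x)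
  neg-swap = ℤ-Solver.solve-∀
...     | false = sym (trans (cong (c ℤ.*_) (trans (at-D j L (expo m)) (trans (cong₂ (dd _) ea (trans eb (ℕₚ.≤-antisym (<ᵇ-false gt) (<ᵇ-false lt)))) (dd-≡ (λ u v → at L (set₂ j u v (expo m))) a)))) (ℤₚ.*-zeroʳ c))

ev-∂ : ∀ L j p → ev L (∂ (suc j) p) ≡ ev (D j L) p
ev-∂ L j []            = refl
ev-∂ L j ((c , m) ∷ p) = trans (ev-++ L (∂mon (suc j) (c , m)) _) (cong₂ ℤ._+_ (ev-∂mon L j c m) (ev-∂ L j p))

evᴾ : Poly → Point
evᴾ p = record
  { ap   = λ L → ev L p
  ; resp = λ e → rs p e
  ; add  = λ L M → ad p L M
  ; neg  = λ L → ng p L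
  ; zer  = zr p }
  where
  rs : ∀ p {L M} → L ≈ M → ev L p ≡ ev M p
  rs []            e = refl
  rs ((c , m) ∷ p) e = cong₂ (λ x y → c ℤ.* x ℤ.+ y) (un e (expo m)) (rs p e)
  ad : ∀ p L M → ev (L ⊕ M) p ≡ ev L p ℤ.+ ev M p
  ad []            L M = refl
  ad ((c , m) ∷ p) L M = trans (cong₂ (λ x y → c ℤ.* x ℤ.+ y) (at-⊕ L M (expo m)) (ad p L M)) (lem c (at L (expo m)) (at M (expo m)) _ _)
    where lem : ∀ c x y a b → c ℤ.* (x ℤ.+ y) ℤ.+ (a ℤ.+ b) ≡ (c ℤ.* x ℤ.+ a) ℤ.+ (c ℤ.* y ℤ.+ b)
          lem = ℤ-Solver.solve-∀
  ng : ∀ p L → ev (⊖ L) p ≡ ℤ.- ev L p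
  ng []            L = refl
  ng ((c , m) ∷ p) L = trans (cong₂ (λ x y → c ℤ.* x ℤ.+ y) (at-⊖ L (expo m)) (ng p L)) (lem c (at L (expo m)) _)
    where lem : ∀ c x a → c ℤ.* (ℤ.- x) ℤ.+ ℤ.- a ≡ ℤ.- (c ℤ.* x ℤ.+ a)
          lem = ℤ-Solver.solve-∀
  zr : ∀ p → ev 𝟘 p ≡ 0ℤ
  zr []            = refl
  zr ((c , m) ∷ p) = trans (cong₂ (λ x y → c ℤ.* x ℤ.+ y) (at-𝟘 (expo m)) (zr p)) (trans (ℤₚ.+-identityʳ _) (ℤₚ.*-zeroʳ c))

X^ : ℕ → ℕ → Fn → Fn
X^ o zero    L = L
X^ o (suc n) L = X o (X^ o n L)

Xᵐ : ℕ → Monomial → Fn → Fn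
Xᵐ o []       L = L
Xᵐ o (n ∷ as) L = X^ o n (Xᵐ (suc o) as L)

at-X^ : ∀ o n L e → at (X^ o n L) e ≡ at L (incn o n e)
at-X^ o zero    L e = refl
at-X^ o (suc n) L e = trans (at-X o _ e) (at-X^ o n L (inc o e))

private
  sx : ℕ → Monomial → Exp
  sx zero    a i       = expo a i
  sx (suc o) a zero    = 0
  sx (suc o) a (suc i) = sx o a i

  sx-[] : ∀ o i → sx o [] i ≡ 0
  sx-[] zero    i       = refl
  sx-[] (suc o) zero    = refl
  sx-[] (suc o) (suc i) = sx-[] o i

  sx-same : ∀ o n as → sx o (n ∷ as) o ≡ n
  sx-same zero    n as = refl
  sx-same (suc o) n as = sx-same o n as

  sx-same′ : ∀ o as → sx (suc o) as o ≡ 0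
  sx-same′ zero    as = refl
  sx-same′ (suc o) as = sx-same′ o as

  sx-other : ∀ o n as {i} → i ≢ o → sx o (n ∷ as) i ≡ sx (suc o) as i
  sx-other zero    n as {zero}  p = ⊥-elim (p refl)
  sx-other zero    n as {suc i} p = refl
  sx-other (suc o) n as {zero}  p = refl
  sx-other (suc o) n as {suc i} p = sx-other o n as (p ∘ cong suc)

  at-Xᵐ′ : ∀ o a L e → at (Xᵐ o a L) e ≡ at L (λ i → sx o a i + e i)
  at-Xᵐ′ o []       L e = ext L (λ i → cong (_+ e i) (sym (sx-[] o i)))
  at-Xᵐ′ o (n ∷ as) L e = trans (at-X^ o n _ e) (trans (at-Xᵐ′ (suc o) as L (incn o n e)) (ext L pw))
    where
    pw : ∀ i → sx (suc o) as i + incn o n e i ≡ sx o (n ∷ as) i + e i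
    pw i with i ≟ o
    ... | yes refl = trans (cong₂ _+_ (sx-same′ i as) (incn-same i n e)) (cong (_+ e i) (sym (sx-same i n as)))
    ... | no p     = cong₂ _+_ (sym (sx-other o n as p)) (incn-other o n e p)

at-Xᵐ : ∀ a L e → at (Xᵐ 0 a L) e ≡ at L (λ i → expo a i + e i)
at-Xᵐ a L e = at-Xᵐ′ 0 a L e

H-Xᵐ : ∀ c n m o a L → H c n m (Xᵐ o a L) ≈ Xᵐ o a (H c n m L)
H-Xᵐ c n m o []       L = ≈-refl
H-Xᵐ c n m o (x ∷ as) L = pw x
  where
  pw : ∀ x → H c n m (X^ o x (Xᵐ (suc o) as L)) ≈ X^ o x (Xᵐ (suc o) as (H c n m L))
  pw zero    = H-Xᵐ c n m (suc o) as L
  pw (suc x) = H-X c n m o _ ▸ X-cong o (pw x)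

expo-monMul : ∀ a b i → expo (monMul a b) i ≡ expo a i + expo b i
expo-monMul []       b        i       = refl
expo-monMul (x ∷ as) []       i       = sym (+-identityʳ _)
expo-monMul (x ∷ as) (y ∷ bs) zero    = refl
expo-monMul (x ∷ as) (y ∷ bs) (suc i) = expo-monMul as bs i

ev-*P-∷ : ∀ L c a p q → ev L (((c , a) ∷ p) *P q) ≡ c ℤ.* ev (Xᵐ 0 a L) q ℤ.+ ev L (p *P q)
ev-*P-∷ L c a p q = trans (ev-++ L (map _ q) (p *P q)) (cong (ℤ._+ ev L (p *P q)) (go q))
  where
  go : ∀ q → ev L (map (λ t → (c ℤ.* proj₁ t , monMul a (proj₂ t))) q) ≡ c ℤ.* ev (Xᵐ 0 a L) q
  go []            = sym (ℤₚ.*-zeroʳ c)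
  go ((d , m) ∷ q) = trans (cong₂ ℤ._+_ (trans (ℤₚ.*-assoc c d _) (cong (λ z → c ℤ.* (d ℤ.* z)) (trans (ext L (expo-monMul a m)) (sym (at-Xᵐ a L (expo m)))))) (go q))
                           (sym (ℤₚ.*-distribˡ-+ c _ _))

-- Permutations as lists

nth : ℕ → List ℕ → ℕ → ℕ
nth d []       i       = d
nth d (a ∷ as) zero    = a
nth d (a ∷ as) (suc i) = nth d as i

nth-unique : (G : List ℕ → ℕ → List ℕ → ℕ → ℕ) → (∀ w d j → G w d [] j ≡ d) → (∀ w d a as → G w d (a ∷ as) 0 ≡ a) →
  (∀ w d a as j → G w d (a ∷ as) (suc j) ≡ G w d as j) → ∀ w d as j → G w d as j ≡ nth d as j
nth-unique G p q r w d []       j       = p w d j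
nth-unique G p q r w d (a ∷ as) zero    = q w d a as
nth-unique G p q r w d (a ∷ as) (suc j) = trans (r w d a as j) (nth-unique G p q r w d as j)

-- The local function of app cannot be named; unification solves appGo to it.
mutual
  appGo : List ℕ → ℕ → List ℕ → ℕ → ℕ
  appGo = _

  app-nth : ∀ w i → app w (suc i) ≡ nth (suc i) w i
  app-nth []       i       = refl
  app-nth (a ∷ as) zero    = refl
  app-nth (a ∷ as) (suc i) with a ∷ as | suc (suc i)
  ... | w | d = nth-unique appGo (λ _ _ _ → refl) (λ _ _ _ _ → refl) (λ _ _ _ _ _ → refl) w d as i

nth-∈ : ∀ d w {i} → i < length w → nth d w i ∈ w
nth-∈ d (a ∷ w) {zero}  p = here refl
nth-∈ d (a ∷ w) {suc i} (s≤s p) = there (nth-∈ d w p)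

nth-≥ : ∀ d w {i} → length w ≤ i → nth d w i ≡ d
nth-≥ d []      p = refl
nth-≥ d (a ∷ w) {suc i} (s≤s p) = nth-≥ d w p

nth-inj : ∀ d d′ {w} → Unique w → ∀ {i j} → i < length w → j < length w → nth d w i ≡ nth d′ w j → i ≡ j
nth-inj d d′ (u ∷ us) {zero}  {zero}  p q e = refl
nth-inj d d′ {a ∷ w} (u ∷ us) {zero}  {suc j} p (s≤s q) e = ⊥-elim (All.lookup u (nth-∈ d′ w q) e)
nth-inj d d′ {a ∷ w} (u ∷ us) {suc i} {zero}  (s≤s p) q e = ⊥-elim (All.lookup u (nth-∈ d w p) (sym e))
nth-inj d d′ (u ∷ us) {suc i} {suc j} (s≤s p) (s≤s q) e = cong suc (nth-inj d d′ us p q e)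

∈-nth : ∀ {x w} → x ∈ w → Σ ℕ λ i → i < length w × (∀ d → nth d w i ≡ x)
∈-nth (here refl) = 0 , s≤s z≤n , λ _ → refl
∈-nth (there p) with ∈-nth p
... | i , q , e = suc i , s≤s q , e

nth-ext : ∀ d {v w} → length v ≡ length w → (∀ i → i < length v → nth d v i ≡ nth d w i) → v ≡ w
nth-ext d {[]}    {[]}    p h = refl
nth-ext d {a ∷ v} {b ∷ w} p h = cong₂ _∷_ (h 0 (s≤s z≤n)) (nth-ext d (suc-injective p) (λ i q → h (suc i) (s≤s q)))

nth-d : ∀ d d′ w {i} → i < length w → nth d w i ≡ nth d′ w i
nth-d d d′ (a ∷ w) {zero}  p = refl
nth-d d d′ (a ∷ w) {suc i} (s≤s p) = nth-d d d′ w p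

nth-swapAt : ∀ d j w i → suc j < length w → nth d (swapAt j w) i ≡ nth d w (s j i)
nth-swapAt d zero    (a ∷ b ∷ w) zero          p = refl
nth-swapAt d zero    (a ∷ b ∷ w) (suc zero)    p = refl
nth-swapAt d zero    (a ∷ b ∷ w) (suc (suc i)) p = refl
nth-swapAt d zero    (a ∷ [])    i (s≤s ())
nth-swapAt d (suc j) (a ∷ w)     zero    p = refl
nth-swapAt d (suc j) (a ∷ w)     (suc i) (s≤s p) = nth-swapAt d j w i p

swapAt-↭ : ∀ j w → swapAt j w ↭ w
swapAt-↭ zero    []          = ↭-refl
swapAt-↭ zero    (a ∷ [])    = ↭-refl
swapAt-↭ zero    (a ∷ b ∷ w) = ↭-swap b a ↭-refl
swapAt-↭ (suc j) []          = ↭-refl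
swapAt-↭ (suc j) (a ∷ w)     = ↭-prep a (swapAt-↭ j w)

firstAscent-just : ∀ w {j} → firstAscent w ≡ just j → suc j < length w × (∀ d → nth d w j < nth d w (suc j))
firstAscent-just (a ∷ b ∷ r) e with a <ᵇ b in lt
firstAscent-just (a ∷ b ∷ r) refl | true = s≤s (s≤s z≤n) , λ _ → <ᵇ-true lt
firstAscent-just (a ∷ b ∷ r) e | false with firstAscent (b ∷ r) in eq
firstAscent-just (a ∷ b ∷ r) refl | false | just j with firstAscent-just (b ∷ r) eq
... | p , q = s≤s p , q

firstAscent-nothing : ∀ w → firstAscent w ≡ nothing → ∀ d i → suc i < length w → nth d w (suc i) ≤ nth d w i
firstAscent-nothing (a ∷ [])    e d i (s≤s ())
firstAscent-nothing (a ∷ b ∷ r) e d i p with a <ᵇ b in lt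
firstAscent-nothing (a ∷ b ∷ r) () d i p | true
firstAscent-nothing (a ∷ b ∷ r) e d i p | false with firstAscent (b ∷ r) in eq
firstAscent-nothing (a ∷ b ∷ r) e d zero    p | false | nothing = <ᵇ-false lt
firstAscent-nothing (a ∷ b ∷ r) e d (suc i) (s≤s p) | false | nothing = firstAscent-nothing (b ∷ r) eq d i p

above : ℕ → List ℕ → ℕ
above a []      = 0
above a (b ∷ w) = (if a <ᵇ b then 1 else 0) + above a w

-- Counts the pairs in increasing order. Each recursive step of `schubFuel` lowers it by one, and it
-- is at most the square of the length, so the fuel suffices.
noninv : List ℕ → ℕ
noninv []      = 0
noninv (a ∷ w) = above a w + noninv w

above-swapAt : ∀ a j w → above a (swapAt j w) ≡ above a w
above-swapAt a zero    []          = refl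
above-swapAt a zero    (b ∷ [])    = refl
above-swapAt a zero    (b ∷ c ∷ w) = lem (if a <ᵇ c then 1 else 0) (if a <ᵇ b then 1 else 0) (above a w)
  where
  lem : ∀ x y z → x + (y + z) ≡ y + (x + z)
  lem = ℕ-Solver.solve-∀
above-swapAt a (suc j) []      = refl
above-swapAt a (suc j) (b ∷ w) = cong (λ z → (if a <ᵇ b then 1 else 0) + z) (above-swapAt a j w)

noninv-swapAt : ∀ j w → suc j < length w → (∀ d → nth d w j < nth d w (suc j)) → suc (noninv (swapAt j w)) ≡ noninv w
noninv-swapAt zero    (a ∷ [])    (s≤s ()) lt
noninv-swapAt zero    (a ∷ b ∷ w) p lt = trans (cong (λ z → suc ((if z then 1 else 0) + above b w + (above a w + noninv w))) ba)
    (trans (lem (above b w) (above a w) (noninv w)) (cong (λ z → (if z then 1 else 0) + above a w + (above b w + noninv w)) (sym ab)))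
  where
  lem : ∀ x y z → suc (x + (y + z)) ≡ suc (y + (x + z))
  lem = ℕ-Solver.solve-∀
  ab : (a <ᵇ b) ≡ true
  ab with a <ᵇ b in e
  ... | true  = refl
  ... | false = ⊥-elim (≤⇒≯ (<ᵇ-false e) (lt 0))
  ba : (b <ᵇ a) ≡ false
  ba with b <ᵇ a in e
  ... | false = refl
  ... | true  = ⊥-elim (<-asym (<ᵇ-true e) (lt 0))
noninv-swapAt (suc j) (a ∷ w) (s≤s p) lt = trans (sym (+-suc (above a (swapAt j w)) _)) (cong₂ _+_ (above-swapAt a j w) (noninv-swapAt j w p lt))

above≤ : ∀ a w → above a w ≤ length w
above≤ a []      = z≤n
above≤ a (b ∷ w) with a <ᵇ b
... | true  = s≤s (above≤ a w)
... | false = m≤n⇒m≤1+n (above≤ a w)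

noninv≤ : ∀ w → noninv w ≤ length w * length w
noninv≤ []      = z≤n
noninv≤ (a ∷ w) = ≤-trans (ℕₚ.+-mono-≤ (above≤ a w) (noninv≤ w))
  (≤-trans (ℕₚ.+-monoʳ-≤ (length w) (ℕₚ.*-monoʳ-≤ (length w) (n≤s (length w)))) (n≤s _))
  where n≤s : ∀ n → n ≤ suc n
        n≤s = ℕₚ.n≤1+n

-- One-line notation with positions and values counted from 0.
F : List ℕ → ℕ → ℕ
F w i = app w (suc i) ∸ 1

F-nth : ∀ w i → F w i ≡ nth (suc i) w i ∸ 1
F-nth w i = cong (_∸ 1) (app-nth w i)

module _ {n w} (P : IsPerm n w) where
  perm-length : length w ≡ n
  perm-length = trans (↭-length P) (trans (length-map suc (upTo n)) (length-upTo n))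

  perm-∈ : ∀ {x} → x ∈ w → 1 ≤ x × x ≤ n
  perm-∈ p with ∈-map⁻ suc (∈-resp-↭ P p)
  ... | y , q , refl = s≤s z≤n , ∈-upTo⁻ q

  perm-nth : ∀ d {i} → i < n → 1 ≤ nth d w i × nth d w i ≤ n
  perm-nth d p = perm-∈ (nth-∈ d w (subst (_ <_) (sym perm-length) p))

  perm-Unique : Unique w
  perm-Unique = Permutationₛ.Unique-resp-↭ (setoid ℕ) (↭⇒↭ₛ (↭-sym P)) (map⁺ suc-injective (upTo⁺ n))

  F-suc : ∀ d {i} → i < n → suc (F w i) ≡ nth d w i
  F-suc d {i} p = trans (cong suc (F-nth w i)) (trans (m+[n∸m]≡n (proj₁ (perm-nth (suc i) p))) (nth-d (suc i) d w (subst (i <_) (sym perm-length) p)))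

  F-< : ∀ {i} → i < n → F w i < n
  F-< p = subst (_≤ n) (sym (F-suc 0 p)) (proj₂ (perm-nth 0 p))

  F-≥ : ∀ {i} → n ≤ i → F w i ≡ i
  F-≥ {i} p = trans (F-nth w i) (cong (_∸ 1) (nth-≥ (suc i) w (subst (_≤ i) (sym perm-length) p)))

  app-suc : ∀ i → app w (suc i) ≡ suc (F w i)
  app-suc i with i <? n
  ... | yes p = trans (app-nth w i) (sym (F-suc (suc i) p))
  ... | no p  = trans (trans (app-nth w i) (nth-≥ (suc i) w (subst (_≤ i) (sym perm-length) (≮⇒≥ p)))) (cong suc (sym (F-≥ (≮⇒≥ p))))

  F-inj : ∀ {i j} → i < n → j < n → F w i ≡ F w j → i ≡ j
  F-inj {i} {j} p q e = nth-inj 0 0 perm-Unique (subst (i <_) (sym perm-length) p) (subst (j <_) (sym perm-length) q)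
    (trans (sym (F-suc 0 p)) (trans (cong suc e) (F-suc 0 q)))

  F-surj : ∀ {v} → v < n → Σ ℕ λ i → i < n × F w i ≡ v
  F-surj {v} p with ∈-nth (∈-resp-↭ (↭-sym P) (∈-map⁺ suc (∈-upTo⁺ p)))
  ... | i , q , e = i , i<n , suc-injective (trans (F-suc 0 i<n) (e 0))
    where i<n = subst (i <_) perm-length q

module Lists (N : ℕ) where
  open JacobiTrudi N

  F-Perm : ∀ {n w} → n ≤ N → IsPerm n w → Perm (F w)
  F-Perm {n} {w} n≤N P = record { bnd = bnd′ ; inj = inj′ ; inv = inv′ ; inv< = λ {i} → inv<′ {i} ; Vinv = λ {i} → Vinv′ {i} }
    where
    bnd′ : ∀ {i} → i < N → F w i < N
    bnd′ {i} p with i <? n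
    ... | yes q = <-≤-trans (F-< P q) n≤N
    ... | no q  = subst (_< N) (sym (F-≥ P (≮⇒≥ q))) p
    inj′ : Inj N (F w)
    inj′ {a} {b} _ _ e with a <? n | b <? n
    ... | yes p | yes q = F-inj P p q e
    ... | yes p | no q  = ⊥-elim (≤⇒≯ (≮⇒≥ q) (subst (_< n) (trans e (F-≥ P (≮⇒≥ q))) (F-< P p)))
    ... | no p  | yes q = ⊥-elim (≤⇒≯ (≮⇒≥ p) (subst (_< n) (trans (sym e) (F-≥ P (≮⇒≥ p))) (F-< P q)))
    ... | no p  | no q  = trans (sym (F-≥ P (≮⇒≥ p))) (trans e (F-≥ P (≮⇒≥ q)))
    inv′ : ℕ → ℕ
    inv′ v with v <? n
    ... | yes p = proj₁ (F-surj P p)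
    ... | no _  = v
    inv<′ : ∀ {v} → v < N → inv′ v < N
    inv<′ {v} p with v <? n
    ... | yes q = <-≤-trans (proj₁ (proj₂ (F-surj P q))) n≤N
    ... | no _  = p
    Vinv′ : ∀ {v} → v < N → F w (inv′ v) ≡ v
    Vinv′ {v} _ with v <? n
    ... | yes q = proj₂ (proj₂ (F-surj P q))
    ... | no q  = F-≥ P (≮⇒≥ q)

  F-≐-inj : ∀ {n v w} → n ≤ N → IsPerm n v → IsPerm n w → F v ≐ F w → v ≡ w
  F-≐-inj n≤N P Q e = nth-ext 0 (trans (perm-length P) (sym (perm-length Q))) λ i p →
    let i<n = subst (i <_) (perm-length P) p in
    trans (sym (F-suc P 0 i<n)) (trans (cong suc (e i (<-≤-trans i<n n≤N))) (F-suc Q 0 i<n))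

  top-Sch : ∀ {n w} → n ≤ N → IsPerm n w → (∀ d i → suc i < length w → nth d w (suc i) ≤ nth d w i) → Sch (F w) (evᴾ (topSchub n))
  top-Sch {n} {w} n≤N P ds U PU = trans (trans (ℤₚ.+-identityʳ _) (ℤₚ.*-identityˡ _))
      (Dom n n≤N (F-Perm n≤N P) dsc (λ a b c → subst₂ _<_ (sym (F-≥ P a)) (sym (F-≥ P (≤-trans a (<⇒≤ b)))) b) (expo mon) e< e≥ U PU)
    where
    mon : List ℕ
    mon = map (λ j → n ∸ suc j) (upTo n)
    expoU : ∀ f n j → (j < n → expo (applyUpTo f n) j ≡ f j) × (n ≤ j → expo (applyUpTo f n) j ≡ 0)
    expoU f zero    j       = (λ ()) , (λ _ → refl)
    expoU f (suc n) zero    = (λ _ → refl) , (λ ())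
    expoU f (suc n) (suc j) = (λ { (s≤s p) → proj₁ (expoU (f ∘ suc) n j) p }) , (λ { (s≤s p) → proj₂ (expoU (f ∘ suc) n j) p })
    adj : ∀ i → suc i < n → F w (suc i) < F w i
    adj i p = ≤∧≢⇒< (≤-pred (subst₂ _≤_ (sym (F-suc P 0 p)) (sym (F-suc P 0 (<⇒≤ p))) (ds 0 i (subst (suc i <_) (sym (perm-length P)) p))))
                    (λ e → >⇒≢ (n<1+n i) (F-inj P p (<⇒≤ p) e))
    dsc : ∀ {a c} → a < c → c < n → F w c < F w a
    dsc {a} {suc c} (s≤s p) q with m≤n⇒m<n∨m≡n p
    ... | inj₁ r    = <-trans (adj c q) (dsc r (<⇒≤ q))
    ... | inj₂ refl = adj c q
    -- With `lo` this pins the entry at j to n - 1 - j: a strictly decreasing sequence below n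
    -- leaves no other choice.
    up : ∀ i → i < n → F w i + suc i ≤ n
    up zero    p = subst (_≤ n) (ℕₚ.+-comm 1 (F w 0)) (F-< P p)
    up (suc i) p = ≤-trans (subst (_≤ F w i + suc i) (sym (+-suc (F w (suc i)) (suc i))) (ℕₚ.+-monoˡ-≤ (suc i) (adj i p))) (up i (<⇒≤ p))
    lo : ∀ x i → suc (i + x) ≡ n → x ≤ F w i
    lo zero    i e = z≤n
    lo (suc x) i e = ≤-<-trans (lo x (suc i) (trans (cong suc (sym (+-suc i x))) e)) (adj i (subst (suc i <_) e (s≤s (ℕₚ.m<m+n i (s≤s z≤n)))))
    e< : ∀ j → j < n → expo mon j ≡ F w j
    e< j p = trans (trans (cong (λ z → expo z j) (map-upTo (λ j → n ∸ suc j) n)) (proj₁ (expoU (λ j → n ∸ suc j) n j) p))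
      (ℕₚ.≤-antisym (lo (n ∸ suc j) j (m+[n∸m]≡n p)) (ℕₚ.+-cancelʳ-≤ (suc j) _ _ (≤-trans (up j p) (≤-reflexive (sym (m∸n+n≡m p))))))
    e≥ : ∀ j → n ≤ j → expo mon j ≡ 0
    e≥ j p = trans (cong (λ z → expo z j) (map-upTo (λ j → n ∸ suc j) n)) (proj₂ (expoU (λ j → n ∸ suc j) n j) p)

  schubFuel-Sch : ∀ {n} f {w} → n ≤ N → IsPerm n w → noninv w ≤ f → Sch (F w) (evᴾ (schubFuel n f w))
  schubFuel-Sch zero {w} n≤N P le with firstAscent w in eq
  ... | nothing = top-Sch n≤N P (firstAscent-nothing w eq)
  ... | just j  = ⊥-elim (≤⇒≯ le (subst (0 <_) (noninv-swapAt j w (proj₁ (firstAscent-just w eq)) (proj₂ (firstAscent-just w eq))) (s≤s z≤n)))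
  schubFuel-Sch {n} (suc f) {w} n≤N P le with firstAscent w in eq
  ... | nothing = top-Sch n≤N P (firstAscent-nothing w eq)
  ... | just j  = λ U PU → trans (ev-∂ ⟦ U ⟧ j (schubFuel n f (swapAt j w)))
        (Sch-≐ (evᴾ (schubFuel n f w′) ∘D j) eqF
          (Sch-D (evᴾ (schubFuel n f w′)) j sj<N dsc
            (schubFuel-Sch f n≤N P′ (≤-pred (subst (_≤ suc f) (sym (noninv-swapAt j w sj<l asc)) le)))) U PU)
    where
    w′ = swapAt j w
    sj<l = proj₁ (firstAscent-just w eq)
    asc = proj₂ (firstAscent-just w eq)
    sj<n : suc j < n
    sj<n = subst (suc j <_) (perm-length P) sj<l
    sj<N : suc j < N
    sj<N = <-≤-trans sj<n n≤N
    P′ : IsPerm n w′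
    P′ = ↭-trans (swapAt-↭ j w) P
    Fw′ : ∀ {i} → i < n → F w′ i ≡ F w (s j i)
    Fw′ {i} p = suc-injective (trans (F-suc P′ 0 p) (trans (nth-swapAt 0 j w i sj<l) (sym (F-suc P 0 (s-< j sj<n p)))))
    eqF : F w′ ∘ s j ≐ F w
    eqF i _ with i <? n
    ... | yes p = trans (Fw′ (s-< j sj<n p)) (cong (F w) (s-inv j i))
    ... | no p  = trans (cong (F w′) fix) (trans (F-≥ P′ (≮⇒≥ p)) (sym (F-≥ P (≮⇒≥ p))))
      where fix : s j i ≡ i
            fix = s-other j (>⇒≢ (<-≤-trans (<⇒≤ sj<n) (≮⇒≥ p))) (>⇒≢ (<-≤-trans sj<n (≮⇒≥ p)))
    dsc : F w′ (suc j) < F w′ j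
    dsc = subst₂ _<_ (sym (trans (Fw′ sj<n) (cong (F w) (s-sj j)))) (sym (trans (Fw′ (<⇒≤ sj<n)) (cong (F w) (s-j j))))
      (≤-pred (subst₂ _<_ (sym (F-suc P 0 (<⇒≤ sj<n))) (sym (F-suc P 0 sj<n)) (asc 0)))

  Schub-Sch : ∀ {n w} → n ≤ N → IsPerm n w → Sch (F w) (evᴾ (Schub n w))
  Schub-Sch {n} {w} n≤N P = schubFuel-Sch (n * n) n≤N P (subst (λ z → noninv w ≤ z * z) (perm-length P) (noninv≤ w))

  -- Duality: ⟦F v⟧ vanishes on every Schubert polynomial of the expansion except that of v, which
  -- occurs once.
  coefficient : ∀ {n cs} p → n ≤ N → IsSchubExpansion n p cs → ∀ {c v} → (c , v) ∈ cs → c ≡ ev ⟦ F v ⟧ p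
  coefficient {n} {cs} p n≤N (perms , uniq , eq) {c} {v} mem =
    sym (trans (ev-resp ⟦ F v ⟧ p (total cs) eq) (pick perms uniq mem))
    where
    total : List (ℤ × List ℕ) → Poly
    total cs = sumP (map (λ t → scaleP (proj₁ t) (Schub n (proj₂ t))) cs)
    term : ∀ c′ v′ → IsPerm n v → IsPerm n v′ → ev ⟦ F v ⟧ (scaleP c′ (Schub n v′)) ≡ c′ ℤ.* δ (F v) (F v′)
    term c′ v′ P P′ = trans (ev-scale ⟦ F v ⟧ c′ (Schub n v′)) (cong (c′ ℤ.*_) (Schub-Sch n≤N P′ (F v) (F-Perm n≤N P)))
    none : ∀ {cs} → IsPerm n v → All (λ t → IsPerm n (proj₂ t)) cs → All (v ≢_) (map proj₂ cs) → ev ⟦ F v ⟧ (total cs) ≡ 0ℤ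
    none {[]} P [] [] = refl
    none {(c′ , v′) ∷ cs} P (P′ ∷ ps) (ne ∷ nes) = trans (ev-++ ⟦ F v ⟧ (scaleP c′ (Schub n v′)) (total cs))
      (cong₂ ℤ._+_ (trans (term c′ v′ P P′) (trans (cong (c′ ℤ.*_) (δ-no (ne ∘ F-≐-inj n≤N P P′))) (ℤₚ.*-zeroʳ c′))) (none P ps nes))
    pick : ∀ {cs} → All (λ t → IsPerm n (proj₂ t)) cs → Unique (map proj₂ cs) → (c , v) ∈ cs → ev ⟦ F v ⟧ (total cs) ≡ c
    pick {_ ∷ cs} (P ∷ ps) (u ∷ us) (here refl) = trans (ev-++ ⟦ F v ⟧ (scaleP c (Schub n v)) (total cs))
      (trans (cong₂ ℤ._+_ (trans (term c v P P) (trans (cong (c ℤ.*_) δ-refl) (ℤₚ.*-identityʳ c))) (none P ps u)) (ℤₚ.+-identityʳ c))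
    pick {(c′ , v′) ∷ cs} (P′ ∷ ps) (u ∷ us) (there m) = trans (ev-++ ⟦ F v ⟧ (scaleP c′ (Schub n v′)) (total cs))
      (trans (cong₂ ℤ._+_ (trans (term c′ v′ P P′) (trans (cong (c′ ℤ.*_) (δ-no λ e → ne (sym (F-≐-inj n≤N P P′ e)))) (ℤₚ.*-zeroʳ c′))) (pick ps us m)) (ℤₚ.+-identityˡ c))
      where
      P : IsPerm n v
      P = All.lookup ps m
      ne : v′ ≢ v
      ne = All.lookup u (∈-map⁺ proj₂ m)

  Span-Xᵐ : ∀ o a {L} → Span L → Span (Xᵐ o a L)
  Span-Xᵐ o []       S = S
  Span-Xᵐ o (n ∷ as) S = go n
    where
    go : ∀ n → Span (X^ o n (Xᵐ (suc o) as _))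
    go zero    = Span-Xᵐ (suc o) as S
    go (suc n) = Span-X o (go n)

  -- Monomial by monomial in p: f ↦ L(x^a f) stays in the span, so ψ may be replaced by φ there, and
  -- the h's commute with x^a.
  product-jt : ∀ {τ} φ ψ k m₁ m₂ → Sch τ φ → Sch τ (evᴾ ψ) → (∀ L → ap φ L ≡ jt k m₁ m₂ L) → ∀ p {L} → Span L →
    ev L (p *P ψ) ≡ ev (H 0 k m₁ (H 0 k (suc m₂) L)) p ℤ.- ev (H 0 k (suc m₁) (H 0 k m₂ L)) p
  product-jt φ ψ k m₁ m₂ s₁ s₂ val []            S = refl
  product-jt φ ψ k m₁ m₂ s₁ s₂ val ((c , a) ∷ p) {L} S = trans (ev-*P-∷ L c a p ψ)
      (trans (cong₂ (λ x y → c ℤ.* x ℤ.+ y) one (product-jt φ ψ k m₁ m₂ s₁ s₂ val p S)) (lem c _ _ _ _))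
    where
    HH : ℕ → ℕ → Fn → Fn
    HH x y L = H 0 k x (H 0 k y L)
    at0 : ∀ x y → at (HH x y (Xᵐ 0 a L)) (λ _ → 0) ≡ at (HH x y L) (expo a)
    at0 x y = trans (un (H-cong 0 k x (H-Xᵐ 0 k y 0 a L) ▸ H-Xᵐ 0 k x 0 a _) (λ _ → 0)) (trans (at-Xᵐ a (HH x y L) (λ _ → 0)) (ext (HH x y L) (λ i → +-identityʳ _)))
    one : ev (Xᵐ 0 a L) ψ ≡ at (HH m₁ (suc m₂) L) (expo a) ℤ.- at (HH (suc m₁) m₂ L) (expo a)
    one = trans (Sch-span (evᴾ ψ) φ s₂ s₁ (Span-Xᵐ 0 a S)) (trans (val _) (cong₂ ℤ._-_ (at0 m₁ (suc m₂)) (at0 (suc m₁) m₂)))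
    lem : ∀ c x y u v → c ℤ.* (x ℤ.- y) ℤ.+ (u ℤ.- v) ≡ (c ℤ.* x ℤ.+ u) ℤ.- (c ℤ.* y ℤ.+ v)
    lem = ℤ-Solver.solve-∀

-- Grassmannian permutations with two rows

module _ where
  private
    nz : List ℕ → List ℕ
    nz = filter (λ p → ¬? (p ≟ 0))

  nz-zero : ∀ g k → (∀ i → i < k → g i ≡ 0) → nz (applyUpTo g k) ≡ []
  nz-zero g zero    h = refl
  nz-zero g (suc k) h with g 0 in e
  ... | zero  = nz-zero (g ∘ suc) k (λ i p → h (suc i) (s≤s p))
  ... | suc _ = ⊥-elim (ℕₚ.1+n≢0 (trans (sym e) (h 0 (s≤s z≤n))))

  nz-[] : ∀ g k → nz (applyUpTo g k) ≡ [] → ∀ i → i < k → g i ≡ 0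
  nz-[] g (suc k) e i p with g 0 in q
  nz-[] g (suc k) e zero    p       | zero = q
  nz-[] g (suc k) e (suc i) (s≤s p) | zero = nz-[] (g ∘ suc) k e i p
  nz-[] g (suc k) () i p | suc _

  -- In a weakly decreasing sequence the zeros come last, so the first nonzero part is the first
  -- entry.
  nz-∷ : ∀ g k {x xs} → (∀ i → suc i < k → g (suc i) ≤ g i) → nz (applyUpTo g k) ≡ x ∷ xs →
    Σ ℕ λ k′ → k ≡ suc k′ × g 0 ≡ x × nz (applyUpTo (g ∘ suc) k′) ≡ xs
  nz-∷ g zero    d ()
  nz-∷ g (suc k) d e with g 0 in q
  nz-∷ g (suc k) {x} {xs} d e | zero = ⊥-elim (absurd (trans (sym e) (nz-zero (g ∘ suc) k (λ i p → zr (suc i) (s≤s p)))))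
    where
    absurd : ¬ (x ∷ xs ≡ [])
    absurd ()
    zr : ∀ i → i < suc k → g i ≡ 0
    zr zero    p = q
    zr (suc i) p = ℕₚ.n≤0⇒n≡0 (subst (g (suc i) ≤_) (zr i (<⇒≤ p)) (d i p))
  nz-∷ g (suc k) d refl | suc _ = k , refl , refl , refl

  two-rows : ∀ g k {x y} → (∀ i → suc i < k → g (suc i) ≤ g i) → nz (applyUpTo g k) ≡ x ∷ y ∷ [] →
    Σ ℕ λ k′ → k ≡ suc (suc k′) × g 0 ≡ x × g 1 ≡ y × (∀ i → i < k′ → g (suc (suc i)) ≡ 0)
  two-rows g k d e with nz-∷ g k d e
  ... | k₁ , refl , g0 , e₁ with nz-∷ (g ∘ suc) k₁ (λ i p → d (suc i) (s≤s p)) e₁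
  ...   | k₂ , refl , g1 , e₂ = k₂ , refl , g0 , g1 , nz-[] (g ∘ suc ∘ suc) k₂ e₂

shape-two-rows : ∀ {n k τ m₁ m₂} → IsPerm n τ → Grassmannian n k τ → shape k τ ≡ m₁ ∷ m₂ ∷ [] →
  Σ ℕ λ k′ → k ≡ suc (suc k′) × (∀ i → i < k′ → F τ i ≡ i) × F τ k′ ≡ k′ + m₂ × F τ (suc k′) ≡ suc k′ + m₁
shape-two-rows {n} {k} {τ} {m₁} {m₂} P (inc₁ , _) sh with two-rows g k dec′ (trans (cong (filter _) (sym (map-upTo g k))) sh)
  where
  g : ℕ → ℕ
  g i = app τ (k ∸ i) ∸ (k ∸ i)
  dec′ : ∀ i → suc i < k → g (suc i) ≤ g i
  dec′ i p = subst (λ z → app τ (k ∸ suc i) ∸ (k ∸ suc i) ≤ app τ z ∸ z) (sym e)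
    (ℕₚ.∸-monoˡ-≤ (suc j) (inc₁ j (suc j) 1≤j (n<1+n j) j<k))
    where
    j = k ∸ suc i
    e : k ∸ i ≡ suc j
    e = ℕₚ.+-∸-assoc 1 (<⇒≤ p)
    1≤j : 1 ≤ j
    1≤j = ℕₚ.m<n⇒0<n∸m p
    j<k : suc j ≤ k
    j<k = subst (_≤ k) e (ℕₚ.m∸n≤m k i)
... | k′ , refl , g0 , g1 , gz = k′ , refl , low , row₂ , row₁
  where
  K = suc (suc k′)
  asc : ∀ i → suc i < K → F τ i < F τ (suc i)
  asc i p = ≤-pred (subst₂ _<_ (app-suc P i) (app-suc P (suc i)) (inc₁ (suc i) (suc (suc i)) (s≤s z≤n) (n<1+n _) p))
  ge : ∀ i → i < K → i ≤ F τ i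
  ge zero    p = z≤n
  ge (suc i) p = ≤-<-trans (ge i (<⇒≤ p)) (asc i p)
  row : ∀ i {x} → i < K → app τ (suc i) ∸ suc i ≡ x → F τ i ≡ i + x
  row i p e = sym (trans (cong (λ z → i + z) (trans (sym e) (cong (_∸ suc i) (app-suc P i)))) (m+[n∸m]≡n (ge i p)))
  row₁ : F τ (suc k′) ≡ suc k′ + m₁
  row₁ = row (suc k′) ≤-refl g0
  row₂ : F τ k′ ≡ k′ + m₂
  row₂ = row k′ (<⇒≤ ≤-refl) g1
  low : ∀ i → i < k′ → F τ i ≡ i
  low i p = trans (row i (<-trans p (<⇒≤ ≤-refl)) (subst (λ z → app τ z ∸ z ≡ 0) e (gz j j<k))) (+-identityʳ i)
    where
    j = k′ ∸ suc i
    j<k : j < k′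
    j<k = ℕₚ.∸-monoʳ-< (s≤s z≤n) p
    e : k′ ∸ j ≡ suc i
    e = ℕₚ.m∸[m∸n]≡n p

-- The bound for the coefficients

module Theorem {n₁ n₂ k′ m₁ m₂ : ℕ} {τ w : List ℕ} (Pτ : IsPerm n₁ τ) (G : Grassmannian n₁ (suc (suc k′)) τ)
  (low : ∀ i → i < k′ → F τ i ≡ i) (row₂ : F τ k′ ≡ k′ + suc m₂) (row₁ : F τ (suc k′) ≡ suc k′ + m₁)
  (m₂<m₁ : suc m₂ ≤ m₁) (Pw : IsPerm n₂ w) where

  private
    k : ℕ
    k = suc (suc k′)

  bound : ∀ N₀ cs → IsSchubExpansion N₀ (Schub n₂ w *P Schub n₁ τ) cs → All (λ t → proj₁ t ℤ.≤ + (2 ^ (n₂ ∸ k))) cs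
  bound N₀ cs ex = All.tabulate λ {t} mem → one (proj₁ t) (proj₂ t) mem
    where
    N : ℕ
    N = N₀ + (n₁ + (n₂ + k))
    N₀≤N : N₀ ≤ N
    N₀≤N = m≤m+n N₀ _
    n₁≤N : n₁ ≤ N
    n₁≤N = ≤-trans (m≤m+n n₁ _) (m≤n+m _ N₀)
    n₂+k≤N : n₂ + k ≤ N
    n₂+k≤N = ≤-trans (m≤n+m _ n₁) (m≤n+m _ N₀)
    n₂≤N : n₂ ≤ N
    n₂≤N = ≤-trans (m≤m+n n₂ k) n₂+k≤N
    k≤N : k ≤ N
    k≤N = ≤-trans (m≤n+m k n₂) n₂+k≤N
    open JacobiTrudi N
    open Lists N
    open Count N k k≤N
    n : ℕ
    -- From n on, w fixes every value, and the first k entries of w are below n. The maximum with k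
    -- does not change the exponent: n ∸ k = n₂ ∸ k.
    n = n₂ ⊔ k
    k≤n : k ≤ n
    k≤n = ℕₚ.m≤n⊔m n₂ k
    n≤N : n ≤ N
    n≤N = ℕₚ.⊔-lub n₂≤N k≤N
    r≡ : n ∸ k ≡ n₂ ∸ k
    r≡ = trans (ℕₚ.∸-distribʳ-⊔ k n₂ k) (trans (cong (n₂ ∸ k ⊔_) (ℕₚ.n∸n≡0 k)) (ℕₚ.⊔-identityʳ _))
    PW : Perm (F w)
    PW = F-Perm n₂≤N Pw

    big-fixed : ∀ {i} → n ≤ F w i → F w i ≡ i
    big-fixed {i} h with i <? n₂
    ... | yes p = ⊥-elim (≤⇒≯ h (<-≤-trans (F-< Pw p) (ℕₚ.m≤m⊔n n₂ k)))
    ... | no p  = F-≥ Pw (≮⇒≥ p)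

    big : ∀ v → BigInv n (F v) (F w)
    big v = record
      { front = fr
      ; pairs = λ {i} {j} _ i<j _ p q lt → ⊥-elim (<-asym i<j (subst₂ _<_ (big-fixed q) (big-fixed p) lt)) }
      where
      fr : ∀ i → i < k → F w i < n
      fr i i<k with i <? n₂
      ... | yes p = <-≤-trans (F-< Pw p) (ℕₚ.m≤m⊔n n₂ k)
      ... | no p  = subst (_< n) (sym (F-≥ Pw (≮⇒≥ p))) (<-≤-trans i<k k≤n)

    asc : ∀ {a c} → k ≤ a → a < c → c < N → F τ a < F τ c
    asc {a} {c} k≤a a<c c<N with c <? n₁
    ... | yes p = ≤-pred (subst₂ _<_ (app-suc Pτ a) (app-suc Pτ c) (proj₂ G (suc a) (suc c) (subst (_≤ suc a) (ℕₚ.+-comm 1 k) (s≤s k≤a)) (s≤s a<c) p))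
    ... | no p with a <? n₁
    ...   | yes q = <-≤-trans (F-< Pτ q) (≤-trans (≮⇒≥ p) (≤-reflexive (sym (F-≥ Pτ (≮⇒≥ p)))))
    ...   | no q  = subst₂ _<_ (sym (F-≥ Pτ (≮⇒≥ q))) (sym (F-≥ Pτ (≮⇒≥ p))) a<c

    value : ∀ v → Perm (F v) → ev ⟦ F v ⟧ (Schub n₂ w *P Schub n₁ τ) ℤ.≤ + (2 ^ (n₂ ∸ k))
    value v PV = subst₂ ℤ._≤_ (sym prod) (cong (λ z → + (2 ^ z)) r≡)
        (ℤₚ.≤-trans (ℤₚ.+-mono-≤ (Final.bound n k≤n n≤N m₁ (suc m₂) PV PW (big v)) (ℤₚ.neg-mono-≤ (pos PV PW))) (ℤₚ.≤-reflexive (ℤₚ.+-identityʳ _)))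
      where
      GR = Grassmann (F-Perm n₁≤N Pτ) k′ m₁ m₂ k≤N low row₂ row₁ m₂<m₁ asc
      pos : ∀ {V W} → Perm V → Perm W → 0ℤ ℤ.≤ ap (pt W) (H 0 k (suc m₁) (H 0 k m₂ ⟦ V ⟧))
      pos = nonneg-step (hO m₂ idO) (suc m₁) (nonneg-step idO m₂ nonneg₀)
      swp : ∀ x y → ev (H 0 k x (H 0 k y ⟦ F v ⟧)) (Schub n₂ w) ≡ ap (pt (F w)) (H 0 k x (H 0 k y ⟦ F v ⟧))
      swp x y = Sch-span (evᴾ (Schub n₂ w)) (pt (F w)) (Schub-Sch n₂≤N Pw) (pt-Sch PW) (Span-H 0 k x (Span-H 0 k y (gen PV)))
      prod : ev ⟦ F v ⟧ (Schub n₂ w *P Schub n₁ τ) ≡ ap (pt (F w)) (H 0 k m₁ (H 0 k (suc m₂) ⟦ F v ⟧)) ℤ.- ap (pt (F w)) (H 0 k (suc m₁) (H 0 k m₂ ⟦ F v ⟧))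
      prod = trans (product-jt (proj₁ GR) (Schub n₁ τ) k m₁ m₂ (proj₁ (proj₂ GR)) (Schub-Sch n₁≤N Pτ) (proj₂ (proj₂ GR)) (Schub n₂ w) (gen PV))
        (cong₂ ℤ._-_ (swp m₁ (suc m₂)) (swp (suc m₁) m₂))

    one : ∀ c v → (c , v) ∈ cs → c ℤ.≤ + (2 ^ (n₂ ∸ k))
    one c v mem = subst (ℤ._≤ + (2 ^ (n₂ ∸ k))) (sym (coefficient (Schub n₂ w *P Schub n₁ τ) N₀≤N ex mem))
      (value v (F-Perm N₀≤N (All.lookup (proj₁ ex) mem)))

theorem1p2 : (n₁ n₂ k m₁ m₂ : ℕ) (τ w : List ℕ) →
    1 ≤ n₁ → 1 ≤ n₂ →
    IsPerm n₁ τ → Grassmannian n₁ k τ →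
    shape k τ ≡ m₁ ∷ m₂ ∷ [] → m₂ ≤ m₁ → 0 < m₂ →
    IsPerm n₂ w →
    n₂ ∸ k < m₂ →
    ((N : ℕ) (cs : List (ℤ × List ℕ)) →
    IsSchubExpansion N (Schub n₂ w *P Schub n₁ τ) cs →
    All (λ t → proj₁ t ℤ.≤ + (2 ^ (n₂ ∸ k) * (n₂ ∸ k) !)) cs)
    ×
    ((∀ i j → k + 1 ≤ i → i < j → j ≤ n₂ → app w j < app w i) →
    (N : ℕ) (cs : List (ℤ × List ℕ)) →
    IsSchubExpansion N (Schub n₂ w *P Schub n₁ τ) cs →
    All (λ t → proj₁ t ℤ.≤ + (2 ^ (n₂ ∸ k))) cs)
theorem1p2 n₁ n₂ k m₁ (suc m₂) τ w _ _ Pτ G sh m₂<m₁ _ Pw _ with shape-two-rows Pτ G sh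
... | k′ , refl , low , row₂ , row₁ =
  -- The factorial is at least 1.
  (λ N cs ex → All.map (λ le → ℤₚ.≤-trans le (+≤+ (ℕₚ.m≤m*n (2 ^ (n₂ ∸ k)) ((n₂ ∸ k) !) {{ℕₚ._!≢0 (n₂ ∸ k)}}))) (bound N cs ex)) ,
  (λ _ → bound)
  where open Theorem Pτ G low row₂ row₁ m₂<m₁ Pw
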